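{- For any convex lattice polygon $P$ in the plane, the following are equivalent: (1) $P$ can be dissected into lattice triangles of area $1$; (2) $P$ can be dissected into lattice triangles of integer area; (3) $P$ can be diagonally dissected into lattice triangles of integer area; (4) the boundary word of $P$ is contractible. Moreover, there is a linear-time algorithm (linear in the number $n$ of vertices of $P$) that decides, given $P$, whether or not (1)-(4) hold.
   Context: A lattice point is a point of $\mathbb{Z}^2$. A lattice polygon is a polygon in $\mathbb{R}^2$ (with its interior) all of whose vertices are lattice points; a lattice triangle is a lattice polygon that is a triangle. The vertices of a polygon are its corners. Dissection: to dissect a polygon $P$ into triangles is to express $P$ as a union of finitely many (nondegenerate) triangles whose interiors do not overlap. Triangles need not meet edge-to-edge, and vertices of the triangles need not be vertices of $P$. A diagonal dissection of a convex polygon is a dissection into triangles obtained by drawing diagonals of $P$, without introducing any new vertices (every vertex of every triangle is a vertex of $P$). Colors: the color (parity) of a lattice point is one of the four symbols $A=(\text{even},\text{even})$, $B=(\text{odd},\text{even})$, $C=(\text{odd},\text{odd})$, $D=(\text{even},\text{odd})$, according to the parities of its two coordinates. Words: a cyclic word $(X_1X_2\ldots X_n)$ is a finite string of letters considered up to cyclic permutation; indices are taken modulo $n$. The boundary word of a lattice polygon $P$ is the cyclic word obtained by recording the colors of the vertices of $P$ in counterclockwise order. For a cyclic word $(X_1\ldots X_n)$ with $n\ge 2$, a contracting step is: if the letters $X_{i-1},X_i,X_{i+1}$ are not all distinct (as letters), delete $X_i$ from the word. A cyclic word is contractible if there is a (possibly empty) sequence of contracting steps starting with it that results in a word $(X)$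 consisting of a single letter. Computation model: $P$ is given by its list of vertices in counterclockwise order; reading the color of a vertex (which depends only on the least significant bit of each coordinate) and comparing two colors each count as one elementary step. -}

module Defs where

open import Data.Bool.Base using (Bool; true; false; if_then_else_)
open import Data.Fin.Base using (Fin; toℕ)
open import Data.Integer.Base as ℤ using (ℤ; ∣_∣)
open import Data.List.Base
  using (List; []; _∷_; [_]; length; lookup; removeAt; tabulate; map; head; drop)
open import Data.List.Membership.Propositional using (_∈_)
open import Data.List.Relation.Unary.All using (All)
open import Data.List.Relation.Unary.AllPairs using (AllPairs)
open import Data.List.Relation.Unary.Any using (Any)
open import Data.List.Relation.Unary.Unique.Propositional using (Unique)
open import Data.Maybe.Base using (Maybe; just; nothing)
open import Data.Nat.Base as ℕ using (ℕ; zero; suc; pred; parity; _≡ᵇ_)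
open import Data.Nat.DivMod using (_mod_)
open import Data.Nat.GeneralisedArithmetic using (iterate)
open import Data.Parity.Base using (Parity; 0ℙ; 1ℙ)
open import Data.Product.Base using (Σ; ∃; _×_; _,_; proj₁; proj₂)
open import Data.Rational.Base as ℚ using (ℚ; 0ℚ; 1ℚ)
open import Function.Bundles using (_⇔_)
open import Relation.Binary.Construct.Closure.ReflexiveTransitive using (Star)
open import Relation.Binary.PropositionalEquality.Core using (_≡_; _≢_)
open import Relation.Nullary.Negation.Core using (¬_)

------------------------------------------------------------------------
-- Indices modulo n

next prev : ∀ {n} → Fin n → Fin n
next {suc n} i = suc (toℕ i) mod suc n
prev {suc n} i = (toℕ i ℕ.+ n) mod suc n

------------------------------------------------------------------------
-- Cyclic words

-- A cyclic word is given by any one of its linear representatives; since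
-- neighbours are taken modulo the length, rotating the representative
-- does not affect which letters may be deleted.

infix 4 _⟶_

data _⟶_ {A : Set} : List A → List A → Set where
  contract : ∀ w → 2 ℕ.≤ length w → (i : Fin (length w)) →
             ¬ Unique (lookup w (prev i) ∷ lookup w i ∷ lookup w (next i) ∷ []) →
             w ⟶ removeAt w i

Contractible : {A : Set} → List A → Set
Contractible w = ∃ λ X → Star _⟶_ w [ X ]

------------------------------------------------------------------------
-- Lattice points and their colours

LatticePoint : Set
LatticePoint = ℤ × ℤ

data Colour : Set where
  A B C D : Colour

colour : LatticePoint → Colour
colour (x , y) with parity ∣ x ∣ | parity ∣ y ∣
... | 0ℙ | 0ℙ = A
... | 1ℙ | 0ℙ = B
... | 1ℙ | 1ℙ = C
... | 0ℙ | 1ℙ = D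

-- Twice the signed area of the triangle abc: positive precisely when
-- a, b, c are in counterclockwise order.

det : LatticePoint → LatticePoint → LatticePoint → ℤ
det (a₁ , a₂) (b₁ , b₂) (c₁ , c₂) =
  (b₁ ℤ.- a₁) ℤ.* (c₂ ℤ.- a₂) ℤ.- (b₂ ℤ.- a₂) ℤ.* (c₁ ℤ.- a₁)

------------------------------------------------------------------------
-- The real plane

Eventually : (ℕ → Set) → Set
Eventually P = ∃ λ N → ∀ n → N ℕ.≤ n → P n

-- A real number is a Cauchy sequence of rationals.

record ℝ : Set where
  field
    seq    : ℕ → ℚ
    cauchy : ∀ ε → 0ℚ ℚ.< ε →
             ∃ λ N → ∀ m n → N ℕ.≤ m → N ℕ.≤ n →
             ℚ.∣ seq m ℚ.- seq n ∣ ℚ.< ε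

open ℝ public

Point : Set
Point = ℝ × ℝ

-- The signs of the real number represented by a Cauchy sequence.

Positive NonNegative : (ℕ → ℚ) → Set
Positive    s = ∃ λ ε → 0ℚ ℚ.< ε × Eventually (λ n → ε ℚ.< s n)
NonNegative s = ∀ ε → 0ℚ ℚ.< ε → Eventually (λ n → ℚ.- ε ℚ.< s n)

-- side a b p represents the real number det a b p; it is computed
-- termwise, and is a Cauchy sequence because det is affine in p.

side : LatticePoint → LatticePoint → Point → ℕ → ℚ
side (a₁ , a₂) (b₁ , b₂) (x , y) n =
  ((b₁ ℤ.- a₁) ℚ./ 1) ℚ.* (seq y n ℚ.- a₂ ℚ./ 1) ℚ.-
  ((b₂ ℤ.- a₂) ℚ./ 1) ℚ.* (seq x n ℚ.- a₁ ℚ./ 1)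

------------------------------------------------------------------------
-- Convex lattice polygons and lattice triangles

-- The vertices are listed counterclockwise: all the others lie strictly
-- to the left of the line through a vertex and its successor. Strictness
-- makes the vertices distinct corners.

record ConvexLatticePolygon : Set where
  field
    size   : ℕ
    3≤size : 3 ℕ.≤ size
    vertex : Fin size → LatticePoint
    convex : ∀ i j → j ≢ i → j ≢ next i →
             ℤ.0ℤ ℤ.< det (vertex i) (vertex (next i)) (vertex j)

  vertices : List LatticePoint
  vertices = tabulate vertex

  boundaryWord : List Colour
  boundaryWord = map colour vertices

  Region : Point → Set
  Region p = ∀ i → NonNegative (side (vertex i) (vertex (next i)) p)

open ConvexLatticePolygon public

record LatticeTriangle : Set where
  field
    a b c            : LatticePoint
    counterclockwise : ℤ.0ℤ ℤ.< det a b c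

  corners : List LatticePoint
  corners = a ∷ b ∷ c ∷ []

  area : ℚ
  area = det a b c ℚ./ 2

  Closed Interior : Point → Set
  Closed p =
    NonNegative (side a b p) × NonNegative (side b c p) × NonNegative (side c a p)
  Interior p =
    Positive (side a b p) × Positive (side b c p) × Positive (side c a p)

open LatticeTriangle public using (corners; area; Closed; Interior)

HasArea1 HasIntegerArea : LatticeTriangle → Set
HasArea1       T = area T ≡ 1ℚ
HasIntegerArea T = ∃ λ (k : ℤ) → area T ≡ k ℚ./ 1

------------------------------------------------------------------------
-- Dissections

-- The double negation makes the union the classical one: which triangle
-- contains a given real point is not decidable.

record Dissects (P : ConvexLatticePolygon) (Ts : List LatticeTriangle) : Set where
  field
    union          : ∀ p → Region P p ⇔ (¬ ¬ Any (λ T → Closed T p) Ts)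
    nonoverlapping : AllPairs (λ S T → ∀ p → ¬ (Interior S p × Interior T p)) Ts

DissectableInto : (LatticeTriangle → Set) → ConvexLatticePolygon → Set
DissectableInto Q P = ∃ λ Ts → Dissects P Ts × All Q Ts

DiagonallyDissectableInto : (LatticeTriangle → Set) → ConvexLatticePolygon → Set
DiagonallyDissectableInto Q P = ∃ λ Ts →
  Dissects P Ts × All (λ T → All (_∈ vertices P) (corners T)) Ts × All Q Ts

------------------------------------------------------------------------
-- Algorithms: programs for a unit-cost random access machine

-- Registers are numbered by ℕ and hold natural numbers; registers, vertices
-- and instructions are all numbered from 0. The arithmetic is only
-- successor and predecessor, so that t steps on n vertices only produce
-- numbers of O(log (t + n)) bits, and the input is accessible only through
-- the number of vertices and the colours of individual vertices.

data Instruction : Set where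
  const  : (r k : ℕ) → Instruction    -- R[r] := k
  copy   : (r s : ℕ) → Instruction    -- R[r] := R[s]
  inc    : (r : ℕ) → Instruction      -- R[r] := R[r] + 1
  dec    : (r : ℕ) → Instruction      -- R[r] := R[r] ∸ 1
  load   : (r s : ℕ) → Instruction    -- R[r] := R[R[s]]
  store  : (r s : ℕ) → Instruction    -- R[R[r]] := R[s]
  count  : (r : ℕ) → Instruction      -- R[r] := number of vertices
  read   : (r s : ℕ) → Instruction    -- R[r] := colour of vertex number R[s]
  jumpEq : (r s l : ℕ) → Instruction  -- if R[r] = R[s], go to instruction l
  halt   : Bool → Instruction

Program : Set
Program = List Instruction

Registers : Set
Registers = ℕ → ℕ

_[_≔_] : Registers → ℕ → ℕ → Registers
(R [ r ≔ v ]) s = if s ≡ᵇ r then v else R s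

data State : Set where
  running : (pc : ℕ) → Registers → State
  halted  : Bool → State

code : Colour → ℕ
code A = 0
code B = 1
code C = 2
code D = 3

-- The code 4 signals that there is no such vertex.

codeAt : List LatticePoint → ℕ → ℕ
codeAt vs j with head (drop j vs)
... | just v  = code (colour v)
... | nothing = 4

execute : List LatticePoint → Instruction → ℕ → Registers → State
execute vs (const r k)    pc R = running (suc pc) (R [ r ≔ k ])
execute vs (copy r s)     pc R = running (suc pc) (R [ r ≔ R s ])
execute vs (inc r)        pc R = running (suc pc) (R [ r ≔ suc (R r) ])
execute vs (dec r)        pc R = running (suc pc) (R [ r ≔ pred (R r) ])
execute vs (load r s)     pc R = running (suc pc) (R [ r ≔ R (R s) ])
execute vs (store r s)    pc R = running (suc pc) (R [ R r ≔ R s ])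
execute vs (count r)      pc R = running (suc pc) (R [ r ≔ length vs ])
execute vs (read r s)     pc R = running (suc pc) (R [ r ≔ codeAt vs (R s) ])
execute vs (jumpEq r s l) pc R = running (if R r ≡ᵇ R s then l else suc pc) R
execute vs (halt b)       pc R = halted b

-- A machine that runs off its program is stuck, and never halts.

step : Program → List LatticePoint → State → State
step prog vs (halted b) = halted b
step prog vs (running pc R) with head (drop pc prog)
... | just ins = execute vs ins pc R
... | nothing  = running pc R

initial : State
initial = running 0 (λ _ → 0)

HaltsWithin : Program → List LatticePoint → ℕ → Bool → Set
HaltsWithin prog vs t b = iterate (step prog vs) initial t ≡ halted b

-- One program and one constant serve all polygons.

LinearTimeDecidable : (ConvexLatticePolygon → Set) → Set
LinearTimeDecidable Q =
  Σ Program λ prog → Σ ℕ λ k → ∀ P → Σ Bool λ b →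
  HaltsWithin prog (vertices P) (k ℕ.* size P) b × (b ≡ true ⇔ Q P)

{-# OPTIONS --safe #-}
module Submission where

open import Defs
open import Data.Bool.Base using (Bool; false; if_then_else_; true)
open import Data.Fin.Base using (Fin; fromℕ; fromℕ<; suc; toℕ; zero)
open import Data.Fin.Properties as Fin using (toℕ-fromℕ; toℕ-fromℕ<; toℕ-injective; toℕ<n)
open import Data.Integer.Base as ℤ using (+_; -[1+_]; _⊖_; ℤ; ∣_∣)
import Data.Integer.DivMod as ℤ
import Data.Integer.Divisibility.Signed as ℤ
import Data.Integer.Properties as ℤ
open import Data.Integer.Tactic.RingSolver using (solve-∀)
open import Data.List.Base
  using (List; []; [_]; _++_; _∷_; _∷ʳ_; drop; length; lookup; map; removeAt;
    reverse; tabulate)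
open import Data.List.Membership.Propositional using (_∈_)
open import Data.List.Membership.Propositional.Properties
  using (∈-++⁺ʳ; ∈-++⁺ˡ; ∈-++⁻; ∈-tabulate⁺; ∈-tabulate⁻)
open import Data.List.Properties
  using (++-assoc; ++-conicalʳ; ++-identityʳ; length-++; length-tabulate; map-++;
    unfold-reverse; ∷-injective)
open import Data.List.Relation.Binary.Sublist.Propositional
  using ([]; _∷_; _⊆_; from∈; minimum; to∈; ⊆-refl)
  renaming (_∷ʳ_ to omit; lookup to ⊆-lookup)
open import Data.List.Relation.Binary.Sublist.Propositional.Properties using (++⁺; All-resp-⊆)
open import Data.List.Relation.Unary.All as All using (All; []; _∷_)
import Data.List.Relation.Unary.All.Properties as All
open import Data.List.Relation.Unary.AllPairs as AllPairs using (AllPairs; []; _∷_)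
import Data.List.Relation.Unary.AllPairs.Properties as AllPairs
open import Data.List.Relation.Unary.Any as Any using (Any; here; there)
import Data.List.Relation.Unary.Any.Properties as Any
open import Data.List.Relation.Unary.Linked using (Linked; [-]; []; _∷_)
open import Data.List.Relation.Unary.Unique.Propositional using (Unique)
open import Data.Maybe.Base using (Maybe; just; nothing)
open import Data.Maybe.Properties using (just-injective)
open import Data.Nat.Base as ℕ using (_≡ᵇ_; _⊔_; parity; pred; suc; s≤s; z<s; zero; z≤n; ℕ)
open import Data.Nat.DivMod using ([m+n]%n≡m%n; _%_; m<n⇒m%n≡m; n%n≡0)
open import Data.Nat.GeneralisedArithmetic using (iterate)
import Data.Nat.Properties as ℕ
open import Data.Parity.Base as ℙ using (0ℙ; 1ℙ; Parity)
import Data.Parity.Properties as ℙ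
open import Data.Product.Base using (_,_; _×_; proj₁; proj₂; ∃; ∃₂)
open import Data.Rational.Base as ℚ using (0ℚ; 1/_; 1ℚ; NonZero; ½; ℚ)
import Data.Rational.Properties as ℚ
open import Data.Rational.Solver using (module +-*-Solver)
open import Data.Rational.Unnormalised.Base as ℚᵘ using (*≡*; mkℚᵘ)
import Data.Rational.Unnormalised.Properties as ℚᵘ
open import Data.Sum.Base using ([_,_]′; _⊎_; inj₁; inj₂)
open import Data.Unit.Base using (tt; ⊤)
open import Function.Base using (_∘_)
open import Function.Bundles using (Equivalence; _⇔_; mk⇔)
open import Relation.Binary.Construct.Closure.ReflexiveTransitive using (Star; _◅_; _◅◅_) renaming (ε to stop)
open import Relation.Binary.Definitions using (tri<; tri>; tri≈)
open import Relation.Binary.PropositionalEquality hiding ([_])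
open import Relation.Nullary using (Dec; contradiction; no; yes; ¬_)
open import Relation.Nullary.Decidable using (_×-dec_; _→-dec_; decidable-stable; from-yes)
open +-*-Solver using (solve; _:=_; _:+_; _:*_; :-_; _:-_)

-- A lattice triangle has integer area if and only if two of its corners have the same
-- colour, and a contracting step is a homotopy of closed walks in the complete graph on the
-- four colours; so a word is contractible if and only if, as a closed walk, it is
-- null-homotopic. A contracting step cuts an ear of integer area off P, which gives
-- (4) ⇒ (3).
--
-- For (2) ⇒ (4), every triangle T of the dissection has a colour X that occurs on each of
-- its edges. Moving colours from p to q, for p and q in T, through X does not depend on T,
-- because the lattice points on a line have at most two colours. This defines a walk along
-- every segment in P. Its holonomy around a triangle in P is trivial, as one sees by cutting
-- the triangle along the lines spanned by the edges of the dissection; hence so is its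
-- holonomy around P, which is the boundary word.
--
-- For (2) ⇒ (1), let 2k be the doubled area of a triangle, with k > 1. A lattice
-- vector with even determinants against two of the edges, reduced modulo the lattice that
-- they span, gives a lattice point that is not a corner and divides the triangle into
-- triangles of smaller integer area.
--
-- The algorithm reduces the boundary word freely on a stack.

-- Real points are Cauchy sequences, so the sign of a linear form at a point cannot be decided.
-- Covers of a region by triangles are therefore proved under double negation. The homotopy argument
-- for (2) ⇒ (4) looks at the dissection only in rational points, given by integer homogeneous
-- coordinates: there signs are decidable, p + q is a point between p and q, and a segment is cut
-- without division.
--
-- A dissection need not be edge-to-edge, and the lines spanned by its edges cut segments in points
-- that are not lattice points. Such a point receives the centre of some tile as its colour; it is
-- not a corner, so the tiles on both sides of an edge through it have edges on one line, and the
-- choice is harmless there. The cutting ends because each line is used once: it separates no two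
-- corners of the pieces it leaves.
--
-- The implications are closed into the cycle (4) ⇒ (3) ⇒ (2) ⇒ null-homotopic ⇒ (4). In particular,
-- that a contractible word is null-homotopic is obtained by way of the dissections, and the stack
-- decides all four conditions at once.

infix 4 _≟ᶜ_

_≟ᶜ_ : (x y : Colour) → Dec (x ≡ y)
A ≟ᶜ A = yes refl
A ≟ᶜ B = no λ ()
A ≟ᶜ C = no λ ()
A ≟ᶜ D = no λ ()
B ≟ᶜ A = no λ ()
B ≟ᶜ B = yes refl
B ≟ᶜ C = no λ ()
B ≟ᶜ D = no λ ()
C ≟ᶜ A = no λ ()
C ≟ᶜ B = no λ ()
C ≟ᶜ C = yes refl
C ≟ᶜ D = no λ ()
D ≟ᶜ A = no λ ()
D ≟ᶜ B = no λ ()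
D ≟ᶜ C = no λ ()
D ≟ᶜ D = yes refl

-- The side condition of a contracting step in positive form, so that one can match on which two
-- letters agree.
data Repeats {A : Set} (x y z : A) : Set where
  ₁₂ : x ≡ y → Repeats x y z
  ₂₃ : y ≡ z → Repeats x y z
  ₁₃ : x ≡ z → Repeats x y z

Repeats-rotate : {A : Set} {x y z : A} → Repeats x y z → Repeats y z x
Repeats-rotate (₁₂ p) = ₁₃ (sym p)
Repeats-rotate (₂₃ p) = ₁₂ p
Repeats-rotate (₁₃ p) = ₂₃ (sym p)

Repeats⇒¬Unique : {A : Set} {x y z : A} → Repeats x y z → ¬ Unique (x ∷ y ∷ z ∷ [])
Repeats⇒¬Unique (₁₂ p) ((x≢y ∷ _) ∷ _)           = x≢y p
Repeats⇒¬Unique (₂₃ p) (_ ∷ (y≢z ∷ _) ∷ _)       = y≢z p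
Repeats⇒¬Unique (₁₃ p) ((_ ∷ x≢z ∷ _) ∷ _)       = x≢z p

repeats : ∀ x y z → ¬ (x ≢ y × y ≢ z × x ≢ z) → Repeats {Colour} x y z
repeats x y z h with x ≟ᶜ y | y ≟ᶜ z | x ≟ᶜ z
... | yes p | _     | _     = ₁₂ p
... | no _  | yes p | _     = ₂₃ p
... | no _  | no _  | yes p = ₁₃ p
... | no p  | no q  | no r  = contradiction (p , q , r) h

¬Unique⇒Repeats : {x y z : Colour} → ¬ Unique (x ∷ y ∷ z ∷ []) → Repeats x y z
¬Unique⇒Repeats h = repeats _ _ _ λ (p , q , r) → h ((p ∷ r ∷ []) ∷ (q ∷ []) ∷ [] ∷ [])

-- Stacks of letters, topmost letter first. A walk in the complete graph on
-- the colours is folded onto a stack by free reduction (with XX = X), so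
-- that two walks are homotopic if and only if they act in the same way.

push : Colour → List Colour → List Colour
push x []            = x ∷ []
push x (y ∷ s) with x ≟ᶜ y
... | yes _ = y ∷ s
push x (y ∷ [])    | no _ = x ∷ y ∷ []
push x (y ∷ z ∷ s) | no _ with x ≟ᶜ z
... | yes _ = z ∷ s
... | no _  = x ∷ y ∷ z ∷ s

run : List Colour → List Colour → List Colour
run []      s = s
run (x ∷ w) s = run w (push x s)

run-++ : ∀ v w s → run (v ++ w) s ≡ run w (run v s)
run-++ []      w s = refl
run-++ (x ∷ v) w s = run-++ v w (push x s)

-- Walks without stationary steps and without backtracking. The empty stack is left out: the lowest
-- letter is the base point of the walk.
data Reduced : List Colour → Set where
  one  : ∀ {x} → Reduced (x ∷ [])
  two  : ∀ {x y} → x ≢ y → Reduced (x ∷ y ∷ [])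
  more : ∀ {x y z s} → x ≢ y → x ≢ z → Reduced (y ∷ z ∷ s) → Reduced (x ∷ y ∷ z ∷ s)

push-same : ∀ x r → push x (x ∷ r) ≡ x ∷ r
push-same x r with x ≟ᶜ x
... | yes _ = refl
... | no ¬p = contradiction refl ¬p

push-top : ∀ x s → ∃ λ r → push x s ≡ x ∷ r
push-top x []      = _ , refl
push-top x (y ∷ s) with x ≟ᶜ y
... | yes refl = _ , refl
push-top x (y ∷ [])    | no _ = _ , refl
push-top x (y ∷ z ∷ s) | no _ with x ≟ᶜ z
... | yes refl = _ , refl
... | no _     = _ , refl

push-reduced : ∀ x {s} → Reduced s → Reduced (push x s)
push-reduced x {y ∷ s} h with x ≟ᶜ y
... | yes refl = h
push-reduced x {y ∷ []}    h | no p = two p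
push-reduced x {y ∷ z ∷ s} h | no p with x ≟ᶜ z
push-reduced x {y ∷ z ∷ []}    _            | no p | yes _ = one
push-reduced x {y ∷ z ∷ _ ∷ _} (more _ _ h) | no p | yes _ = h
... | no q  = more p q h

push-idem : ∀ x s → push x (push x s) ≡ push x s
push-idem x s with push x s | push-top x s
... | _ | r , refl = push-same x r

-- If the move to y pops x, the move back has to push x again; this would fail only if x also lay
-- directly below y, which `Reduced` excludes.
push-back : ∀ x y {r} → Reduced (x ∷ r) → push x (push y (x ∷ r)) ≡ x ∷ r
push-back x y {r} h with y ≟ᶜ x
... | yes refl = push-same x r
push-back x y {[]} h | no p with x ≟ᶜ y
... | yes q = contradiction (sym q) p
... | no _ with x ≟ᶜ x
... | yes _ = refl
... | no q = contradiction refl q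
push-back x y {z ∷ r} h | no p with y ≟ᶜ z
push-back x y {z ∷ r} h | no p | no _ with x ≟ᶜ y
... | yes q = contradiction (sym q) p
... | no _ with x ≟ᶜ x
... | yes _ = refl
... | no q = contradiction refl q
push-back x y {z ∷ r} h | no p | yes refl with x ≟ᶜ y
... | yes q = contradiction (sym q) p
push-back x y {z ∷ []} h | no p | yes refl | no _ = refl
push-back x y {z ∷ t ∷ r} (more _ q _) | no p | yes refl | no _ with x ≟ᶜ t
... | yes e = contradiction e q
... | no _  = refl

-- An even triangle can be filled in: the detour through w is either stationary at one end or a
-- backtracking. All homotopies below are composed of this relation and `push-back`.
push-repeats : ∀ u w v {r} → Reduced (u ∷ r) → Repeats u w v →
               push v (push w (u ∷ r)) ≡ push v (u ∷ r)
push-repeats u w v {r} h (₁₂ refl) = cong (push v) (push-same u r)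
push-repeats u w v {r} h (₂₃ refl) = push-idem v (u ∷ r)
push-repeats u w v {r} h (₁₃ refl) = trans (push-back u w h) (sym (push-same u r))

-- The word, read cyclically, is a null-homotopic walk.

Null : List Colour → Set
Null w = ∃₂ λ x v → w ≡ x ∷ v × run (v ∷ʳ x) [ x ] ≡ [ x ]

-- Contracting steps

-- The neighbours of y in the cyclic word us y vs are the last and the
-- first letter of vs us.

nth : {A : Set} → List A → ℕ → Maybe A
nth []       _       = nothing
nth (x ∷ _)  zero    = just x
nth (_ ∷ xs) (suc n) = nth xs n

nth-lookup : {A : Set} (xs : List A) (i : Fin (length xs)) → nth xs (toℕ i) ≡ just (lookup xs i)
nth-lookup (x ∷ xs) zero    = refl
nth-lookup (x ∷ xs) (suc i) = nth-lookup xs i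

nth-++ : {A : Set} (us : List A) (y : A) (vs : List A) → nth (us ++ y ∷ vs) (length us) ≡ just y
nth-++ []       y vs = refl
nth-++ (x ∷ us) y vs = nth-++ us y vs

lookup-nth : {A : Set} (xs us : List A) (y : A) (vs : List A) (i : Fin (length xs)) →
             xs ≡ us ++ y ∷ vs → toℕ i ≡ length us → lookup xs i ≡ y
lookup-nth xs us y vs i refl e = just-injective
  (trans (sym (nth-lookup xs i)) (trans (cong (nth xs) e) (nth-++ us y vs)))

toℕ-next : ∀ {n} (i : Fin n) → suc (toℕ i) ℕ.< n → toℕ (next i) ≡ suc (toℕ i)
toℕ-next {suc n} i h = trans (toℕ-fromℕ< _) (m<n⇒m%n≡m h)

toℕ-next-last : ∀ {n} (i : Fin n) → suc (toℕ i) ≡ n → toℕ (next i) ≡ 0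
toℕ-next-last {suc n} i h = trans (toℕ-fromℕ< _) (trans (cong (_% suc n) h) (n%n≡0 (suc n)))

toℕ-prev : ∀ {n} (i : Fin n) {j} → toℕ i ≡ suc j → toℕ (prev i) ≡ j
toℕ-prev {suc n} i {j} h = begin
  toℕ (prev i)             ≡⟨ toℕ-fromℕ< _ ⟩
  (toℕ i ℕ.+ n) % suc n    ≡⟨ cong (λ m → (m ℕ.+ n) % suc n) h ⟩
  (suc j ℕ.+ n) % suc n    ≡⟨ cong (_% suc n) (sym (ℕ.+-suc j n)) ⟩
  (j ℕ.+ suc n) % suc n    ≡⟨ [m+n]%n≡m%n j (suc n) ⟩
  j % suc n                ≡⟨ m<n⇒m%n≡m (ℕ.<-trans (ℕ.n<1+n j) (subst (ℕ._< suc n) h (toℕ<n i))) ⟩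
  j                        ∎
  where open ≡-Reasoning

toℕ-prev-first : ∀ {n} (i : Fin (suc n)) → toℕ i ≡ 0 → toℕ (prev i) ≡ n
toℕ-prev-first {n} i h = trans (toℕ-fromℕ< _)
  (trans (cong (λ m → (m ℕ.+ n) % suc n) h) (m<n⇒m%n≡m (ℕ.n<1+n n)))

module _ {A : Set} where

  length-∷ʳ : ∀ (us : List A) p → length (us ∷ʳ p) ≡ suc (length us)
  length-∷ʳ us p = trans (length-++ us) (ℕ.+-comm (length us) 1)

  lookup-next : ∀ (us : List A) y vs (i : Fin (length (us ++ y ∷ vs))) → toℕ i ≡ length us →
                ∀ {n ts} → vs ++ us ≡ n ∷ ts → lookup (us ++ y ∷ vs) (next i) ≡ n
  lookup-next us y (n ∷ vs) i h refl = lookup-nth _ (us ∷ʳ y) n vs (next i)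
    (sym (++-assoc us [ y ] (n ∷ vs)))
    (trans (toℕ-next i bound) (trans (cong suc h) (sym (length-∷ʳ us y))))
    where
    bound : suc (toℕ i) ℕ.< length (us ++ y ∷ n ∷ vs)
    bound = subst₂ ℕ._<_ (trans (ℕ.+-comm (length us) 1) (cong suc (sym h))) (sym (length-++ us))
              (ℕ.+-monoʳ-< (length us) (s≤s (s≤s z≤n)))
  lookup-next (n ∷ us) y [] i h refl = lookup-nth _ [] n (us ++ y ∷ []) (next i) refl
    (toℕ-next-last i (trans (cong suc h) (sym (cong suc (length-∷ʳ us y)))))

  snoc-inj : ∀ (xs : List A) {x ys y} → xs ∷ʳ x ≡ ys ∷ʳ y → xs ≡ ys × x ≡ y
  snoc-inj []           {ys = []}         refl = refl , refl
  snoc-inj []           {ys = _ ∷ []}     ()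
  snoc-inj []           {ys = _ ∷ _ ∷ _}  ()
  snoc-inj (_ ∷ [])     {ys = []}         ()
  snoc-inj (_ ∷ _ ∷ _)  {ys = []}         ()
  snoc-inj (x ∷ xs)     {ys = y ∷ ys} e with ∷-injective e
  ... | refl , e′ with snoc-inj xs e′
  ... | refl , refl = refl , refl

  data Snoc : List A → Set where
    []   : Snoc []
    snoc : ∀ xs x → Snoc (xs ∷ʳ x)

  snocView : ∀ xs → Snoc xs
  snocView []       = []
  snocView (x ∷ xs) with snocView xs
  ... | []         = snoc [] x
  ... | snoc ys y  = snoc (x ∷ ys) y

  lookup-prev : ∀ (us : List A) y vs (i : Fin (length (us ++ y ∷ vs))) → toℕ i ≡ length us →
                ∀ {p ts} → vs ++ us ≡ ts ∷ʳ p → lookup (us ++ y ∷ vs) (prev i) ≡ p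
  lookup-prev us y vs i h {p} {ts} e with snocView us
  ... | snoc us′ q with snoc-inj (vs ++ us′) (trans (++-assoc vs us′ [ q ]) e)
  ... | _ , refl = lookup-nth _ us′ p (y ∷ vs) (prev i) (++-assoc us′ [ p ] (y ∷ vs))
    (toℕ-prev i (trans h (length-∷ʳ us′ p)))
  lookup-prev _ y vs i h {p} {ts} e | [] with trans (sym (++-identityʳ vs)) e
  ... | refl = lookup-nth _ (y ∷ ts) p [] (prev i) refl
    (trans (toℕ-prev-first i h) (length-∷ʳ ts p))

-- Contracting steps without indices, so that later proofs can match on splittings of lists. That
-- `vs ++ us` is nonempty expresses that the word has at least two letters.
data Step : List Colour → List Colour → Set where
  delete : ∀ us y vs {p n ts ts′} → vs ++ us ≡ n ∷ ts → vs ++ us ≡ ts′ ∷ʳ p →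
           Repeats p y n → Step (us ++ y ∷ vs) (us ++ vs)

splitAt-lookup : {A : Set} (w : List A) (i : Fin (length w)) → ∃₂ λ us vs →
  w ≡ us ++ lookup w i ∷ vs × toℕ i ≡ length us × removeAt w i ≡ us ++ vs
splitAt-lookup (x ∷ w) zero = [] , w , refl , refl , refl
splitAt-lookup (x ∷ w) (suc i) with splitAt-lookup w i
... | us , vs , p , q , r = x ∷ us , vs , cong (x ∷_) p , cong suc q , cong (x ∷_) r

Step-at : ∀ w (i : Fin (length w)) {us y vs} → w ≡ us ++ y ∷ vs → toℕ i ≡ length us → 2 ℕ.≤ length w →
          ¬ Unique (lookup w (prev i) ∷ lookup w i ∷ lookup w (next i) ∷ []) → Step w (us ++ vs)
Step-at _ i {us} {y} {vs} refl q 2≤ nu = go _ refl (snocView (vs ++ us))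
  where
  go : ∀ xs → vs ++ us ≡ xs → Snoc xs → Step (us ++ y ∷ vs) (us ++ vs)
  go [] e _ = contradiction (subst (2 ℕ.≤_) len 2≤) λ { (s≤s ()) }
    where
    len : length (us ++ y ∷ vs) ≡ 1
    len = trans (length-++ us) (trans (ℕ.+-suc (length us) (length vs)) (cong suc
            (trans (ℕ.+-comm (length us) (length vs)) (trans (sym (length-++ vs)) (cong length e)))))
  go (n ∷ ts) e sv = go′ sv refl
    where
    go′ : ∀ {xs} → Snoc xs → xs ≡ n ∷ ts → Step (us ++ y ∷ vs) (us ++ vs)
    go′ [] ()
    go′ (snoc ts′ p) e″ = delete us y vs e (trans e (sym e″))
      (¬Unique⇒Repeats (subst (λ l → ¬ Unique l) triple nu))
      where
      triple : lookup (us ++ y ∷ vs) (prev i) ∷ lookup (us ++ y ∷ vs) i ∷ lookup (us ++ y ∷ vs) (next i) ∷ []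
               ≡ p ∷ y ∷ n ∷ []
      triple = cong₂ _∷_ (lookup-prev us y vs i q (trans e (sym e″)))
        (cong₂ (λ a b → a ∷ b ∷ []) (lookup-nth _ us y vs i refl q) (lookup-next us y vs i q e))

⟶⇒Step : ∀ {w w′} → w ⟶ w′ → Step w w′
⟶⇒Step (contract w 2≤ i nu) with splitAt-lookup w i
... | us , vs , p , q , r = subst (Step w) (sym r) (Step-at w i p q 2≤ nu)

middle : {A : Set} (us : List A) (y : A) (vs : List A) → Fin (length (us ++ y ∷ vs))
middle []       y vs = zero
middle (_ ∷ us) y vs = suc (middle us y vs)

toℕ-middle : {A : Set} (us : List A) (y : A) (vs : List A) → toℕ (middle us y vs) ≡ length us
toℕ-middle []       y vs = refl
toℕ-middle (_ ∷ us) y vs = cong suc (toℕ-middle us y vs)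

removeAt-middle : {A : Set} (us : List A) (y : A) (vs : List A) →
                  removeAt (us ++ y ∷ vs) (middle us y vs) ≡ us ++ vs
removeAt-middle []       y vs = refl
removeAt-middle (u ∷ us) y vs = cong (u ∷_) (removeAt-middle us y vs)

Step⇒⟶ : ∀ {w w′} → Step w w′ → w ⟶ w′
Step⇒⟶ (delete us y vs {p} {n} e e′ rep) = subst (us ++ y ∷ vs ⟶_) (removeAt-middle us y vs)
  (contract (us ++ y ∷ vs) 2≤ i (subst (λ l → ¬ Unique l) (sym triple) (Repeats⇒¬Unique rep)))
  where
  i = middle us y vs
  q = toℕ-middle us y vs
  triple : lookup (us ++ y ∷ vs) (prev i) ∷ lookup (us ++ y ∷ vs) i ∷ lookup (us ++ y ∷ vs) (next i) ∷ []
           ≡ p ∷ y ∷ n ∷ []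
  triple = cong₂ _∷_ (lookup-prev us y vs i q e′)
    (cong₂ (λ a b → a ∷ b ∷ []) (lookup-nth _ us y vs i refl q) (lookup-next us y vs i q e))
  2≤ : 2 ℕ.≤ length (us ++ y ∷ vs)
  2≤ = subst (2 ℕ.≤_) (sym (trans (length-++ us) (trans (ℕ.+-suc (length us) (length vs)) (cong suc
          (trans (ℕ.+-comm (length us) (length vs)) (trans (sym (length-++ vs)) (cong length e))))))) (s≤s (s≤s z≤n))

contract-repeated : ∀ us x vs → us ++ x ∷ x ∷ vs ⟶ us ++ x ∷ vs
contract-repeated us x vs = subst₂ _⟶_ (++-assoc us [ x ] (x ∷ vs)) (++-assoc us [ x ] vs) (Step⇒⟶ step′)
  where
  step′ : Step ((us ∷ʳ x) ++ x ∷ vs) ((us ∷ʳ x) ++ vs)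
  step′ = go _ refl
    where
    go : ∀ xs → vs ++ (us ∷ʳ x) ≡ xs → Step ((us ∷ʳ x) ++ x ∷ vs) ((us ∷ʳ x) ++ vs)
    go []       e = contradiction (++-conicalʳ us [ x ] (++-conicalʳ vs (us ∷ʳ x) e)) λ ()
    go (n ∷ ts) e = delete (us ∷ʳ x) x vs e (sym (++-assoc vs us [ x ])) (₁₂ refl)

contract-interior : ∀ us x y z vs → Repeats x y z → us ++ x ∷ y ∷ z ∷ vs ⟶ us ++ x ∷ z ∷ vs
contract-interior us x y z vs rep = subst₂ _⟶_ (++-assoc us [ x ] (y ∷ z ∷ vs)) (++-assoc us [ x ] (z ∷ vs))
  (Step⇒⟶ (delete (us ∷ʳ x) y (z ∷ vs) {ts′ = z ∷ vs ++ us} refl (sym (++-assoc (z ∷ vs) us [ x ])) rep))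

reverse-∷-++ : {A : Set} (x : A) (s w : List A) → reverse (x ∷ s) ++ w ≡ reverse s ++ x ∷ w
reverse-∷-++ x s w = trans (cong (_++ w) (unfold-reverse x s)) (++-assoc (reverse s) [ x ] w)

-- The reversed stack followed by the unread letters is one word. A pop turns x y x into x x by
-- deleting y between equal neighbours, and then into x.
push-contracts : ∀ x s w → Star _⟶_ (reverse s ++ x ∷ w) (reverse (push x s) ++ w)
push-contracts x []      w = stop
push-contracts x (y ∷ s) w with x ≟ᶜ y
... | yes refl = subst₂ (Star _⟶_) (sym (reverse-∷-++ x s (x ∷ w))) (sym (reverse-∷-++ x s w))
      (contract-repeated (reverse s) x w ◅ stop)
push-contracts x (y ∷ []) w | no _ = stop
push-contracts x (y ∷ z ∷ s) w | no _ with x ≟ᶜ z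
... | yes refl = subst₂ (Star _⟶_)
      (sym (trans (reverse-∷-++ y (x ∷ s) (x ∷ w)) (reverse-∷-++ x s (y ∷ x ∷ w)))) (sym (reverse-∷-++ x s w))
      (contract-interior (reverse s) x y x w (₁₃ refl) ◅ contract-repeated (reverse s) x w ◅ stop)
... | no _ = subst (Star _⟶_ (reverse (y ∷ z ∷ s) ++ x ∷ w)) (sym (reverse-∷-++ x (y ∷ z ∷ s) w)) stop

run-contracts : ∀ w s → Star _⟶_ (reverse s ++ w) (reverse (run w s))
run-contracts []      s = subst (Star _⟶_ (reverse s ++ [])) (++-identityʳ (reverse s)) stop
run-contracts (x ∷ w) s = push-contracts x s w ◅◅ run-contracts w (push x s)

-- The stacks that the closing letter x reduces to `[ x ]`. In the second case the walk has gone
-- along one edge, and closing it up goes back along the same edge; this is why the machine accepts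
-- two letters as well as one.
data Small (x : Colour) : List Colour → Set where
  single : Small x (x ∷ [])
  double : ∀ {y} → x ≢ y → Small x (y ∷ x ∷ [])

small : ∀ x s → push x s ≡ [ x ] → s ≢ [] → Small x s
small x [] e ne = contradiction refl ne
small x (y ∷ s) e _ with x ≟ᶜ y
small x (y ∷ s) refl _ | yes refl = single
small x (y ∷ []) () _ | no _
small x (y ∷ z ∷ s) e _ | no _ with x ≟ᶜ z
small x (y ∷ z ∷ s) refl _ | no p | yes refl = double p
small x (y ∷ z ∷ s) () _ | no _ | no _

run-nonempty : ∀ w {s} → s ≢ [] → run w s ≢ []
run-nonempty []      h = h
run-nonempty (x ∷ w) {s} _ = run-nonempty w λ e → contradiction (trans (sym (proj₂ (push-top x s))) e) λ ()

Null⇒Small : ∀ x w → run (w ∷ʳ x) [ x ] ≡ [ x ] → Small x (run w [ x ])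
Null⇒Small x w h = small x _ (trans (sym (run-++ w [ x ] [ x ])) h) (run-nonempty w λ ())

Small⇒Null : ∀ x w → Small x (run w [ x ]) → run (w ∷ʳ x) [ x ] ≡ [ x ]
Small⇒Null x w h = trans (run-++ w [ x ] [ x ]) (lemma h)
  where
  lemma : ∀ {s} → Small x s → push x s ≡ [ x ]
  lemma single = push-same x []
  lemma (double {y} p) with x ≟ᶜ y
  ... | yes q = contradiction q p
  ... | no _ with x ≟ᶜ x
  ... | yes _ = refl
  ... | no q  = contradiction refl q

Null⇒Contractible : ∀ x w → run (w ∷ʳ x) [ x ] ≡ [ x ] → Contractible (x ∷ w)
Null⇒Contractible x w h = finish (Null⇒Small x w h) (run-contracts w [ x ])
  where
  finish : ∀ {s} → Small x s → Star _⟶_ (x ∷ w) (reverse s) → Contractible (x ∷ w)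
  finish single     r = x , r
  -- In a cyclic word of two letters both neighbours of y are the same letter x.
  finish (double {y} _) r = x , r ◅◅ Step⇒⟶ (delete [ x ] y [] {ts′ = []} refl refl (₁₃ refl)) ◅ stop

-- Triangulations along a chain

-- A triangulation of the polygon with vertices a ms z, whose base is the
-- edge between z and a.

data Triangulation {V : Set} (f : V → Colour) (a : V) : List V → V → Set where
  edge   : ∀ {z} → Triangulation f a [] z
  triangle : ∀ {ms b ns z} → Triangulation f a ms b → Triangulation f b ns z →
             Repeats (f a) (f b) (f z) → Triangulation f a (ms ++ b ∷ ns) z

-- Ins y a ms z l r ms′: inserting y between the neighbours l and r turns
-- the chain a ms z into a ms′ z.

data Ins {V : Set} (y : V) : (a : V) (ms : List V) (z l r : V) (ms′ : List V) → Set where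
  end  : ∀ {a z} → Ins y a [] z a z (y ∷ [])
  here : ∀ {a m ms z} → Ins y a (m ∷ ms) z a m (y ∷ m ∷ ms)
  skip : ∀ {a m ms z l r ms′} → Ins y m ms z l r ms′ → Ins y a (m ∷ ms) z l r (m ∷ ms′)

module _ {V : Set} {f : V → Colour} where

  Ins-++ : ∀ {y a b z l r : V} {ns ks} ms → Ins y a (ms ++ b ∷ ns) z l r ks →
           (∃ λ ms′ → ks ≡ ms′ ++ b ∷ ns × Ins y a ms b l r ms′) ⊎
           (∃ λ ns′ → ks ≡ ms ++ b ∷ ns′ × Ins y b ns z l r ns′)
  Ins-++ []       here     = inj₁ (_ , refl , end)
  Ins-++ []       (skip i) = inj₂ (_ , refl , i)
  Ins-++ (m ∷ ms) here     = inj₁ (_ , refl , here)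
  Ins-++ (m ∷ ms) (skip i) with Ins-++ ms i
  ... | inj₁ (_ , refl , j) = inj₁ (_ , refl , skip j)
  ... | inj₂ (_ , refl , j) = inj₂ (_ , refl , j)

  -- The boundary edge from l to r belongs to one `edge` leaf of the tree; the ear replaces that
  -- leaf.
  insert-ear : ∀ {y a ms z l r ms′} → Triangulation f a ms z → Ins y a ms z l r ms′ →
               Repeats (f l) (f y) (f r) → Triangulation f a ms′ z
  insert-ear edge end rep = triangle edge edge rep
  insert-ear (triangle {ms} s t c) i rep with Ins-++ ms i
  ... | inj₁ (_ , refl , j) = triangle (insert-ear s j rep) t c
  ... | inj₂ (_ , refl , j) = triangle s (insert-ear t j rep) c

  data Triangulated : List V → Set where
    point : ∀ {v} → Triangulated (v ∷ [])
    chain  : ∀ {a ms z} → Triangulation f a ms z → Triangulated (a ∷ ms ∷ʳ z)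

  Ins-∷ʳ : ∀ us {y l r z : V} {a vs ws} ms → a ∷ us ≡ ws ∷ʳ l → us ++ r ∷ vs ≡ ms ∷ʳ z →
           ∃ λ ms′ → Ins y a ms z l r ms′ × us ++ y ∷ r ∷ vs ≡ ms′ ∷ʳ z
  Ins-∷ʳ [] {ws = []} [] refl refl = _ , end , refl
  Ins-∷ʳ [] {ws = []} (m ∷ ms) refl refl = _ , here , refl
  Ins-∷ʳ [] {ws = _ ∷ []} _ () _
  Ins-∷ʳ [] {ws = _ ∷ _ ∷ _} _ () _
  Ins-∷ʳ (u ∷ us) {ws = []} _ () _
  Ins-∷ʳ (u ∷ us) {r = r} {vs = vs} [] _ e = contradiction (proj₂ (∷-injective e)) (nonempty us)
    where
    nonempty : ∀ (us : List V) → us ++ r ∷ vs ≢ []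
    nonempty []      ()
    nonempty (_ ∷ _) ()
  Ins-∷ʳ (u ∷ us) {ws = w ∷ ws} (m ∷ ms) e e′ with ∷-injective e | ∷-injective e′
  ... | _ , e₁ | refl , e₂ with Ins-∷ʳ us {ws = ws} ms e₁ e₂
  ... | _ , i , e₃ = _ , skip i , cong (u ∷_) e₃

  -- If y becomes the first or the last vertex, the ear is glued to the base: it is the new root,
  -- and the old triangulation becomes one of its two subtrees. Otherwise the ear is glued to an
  -- edge of the chain.
  insert-point : ∀ us {y vs p n ts ts′} → vs ++ us ≡ n ∷ ts → vs ++ us ≡ ts′ ∷ʳ p →
                  Repeats (f p) (f y) (f n) → Triangulated (us ++ vs) → Triangulated (us ++ y ∷ vs)
  insert-point [] {y} {vs} {p} {n} e e′ rep T = first T refl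
    where
    first : ∀ {xs} → Triangulated xs → xs ≡ vs → Triangulated (y ∷ vs)
    first point refl = chain edge
    first (chain {a} {ms} {z} t) refl
      with ∷-injective (trans (sym (++-identityʳ _)) e)
         | snoc-inj (a ∷ ms) (trans (sym (++-identityʳ _)) e′)
    ... | refl , _ | _ , refl = chain (triangle edge t (Repeats-rotate rep))
  insert-point (u ∷ us) {y} {[]} {p} {n} {ts} {ts′} refl e′ rep T = last T (++-identityʳ (u ∷ us))
    where
    last : ∀ {xs} → Triangulated xs → xs ≡ u ∷ us → Triangulated (u ∷ us ∷ʳ y)
    last point refl = chain edge
    last (chain {a} {ms} {z} t) refl with snoc-inj (a ∷ ms) e′
    ... | _ , refl = chain (triangle t edge (Repeats-rotate (Repeats-rotate rep)))
  insert-point (u ∷ us) {y} {v ∷ vs} {p} {n} {ts} {ts′} refl e′ rep T = inside T refl (snocView (u ∷ us)) refl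
    where
    inside : ∀ {xs ws} → Triangulated xs → xs ≡ u ∷ us ++ v ∷ vs → Snoc ws → ws ≡ u ∷ us →
             Triangulated (u ∷ us ++ y ∷ v ∷ vs)
    inside point e _ _ = contradiction (trans (cong length (proj₂ (∷-injective e))) (length-++ us))
      λ e → contradiction (trans e (ℕ.+-suc (length us) (length vs))) λ ()
    inside (chain {ms = ms} t) e (snoc ws l) e₁ with ∷-injective e
    ... | refl , e₂ with Ins-∷ʳ us {ws = ws} ms (sym e₁) (sym e₂) | snoc-inj (v ∷ vs ++ ws)
                           (trans (++-assoc (v ∷ vs) ws [ l ]) (trans (cong (λ l → v ∷ vs ++ l) e₁) e′))
    ... | ms′ , i , e₃ | _ , refl = subst (λ l → Triangulated (u ∷ l)) (sym e₃) (chain (insert-ear t i rep))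

map-++⁻ : {V W : Set} (f : V → W) (xs : List V) (us : List W) {y : W} {ws : List W} → map f xs ≡ us ++ y ∷ ws →
          ∃₂ λ us′ y′ → ∃ λ ws′ → xs ≡ us′ ++ y′ ∷ ws′ × map f us′ ≡ us × f y′ ≡ y × map f ws′ ≡ ws
map-++⁻ f [] [] ()
map-++⁻ f [] (_ ∷ _) ()
map-++⁻ f (x ∷ xs) [] refl = [] , x , xs , refl , refl , refl , refl
map-++⁻ f (x ∷ xs) (u ∷ us) e with ∷-injective e
... | refl , e′ with map-++⁻ f xs us e′
... | us′ , y′ , ws′ , refl , refl , refl , refl = x ∷ us′ , y′ , ws′ , refl , refl , refl , refl

module _ {V : Set} (f : V → Colour) where

  -- A step deletes a colour; it is lifted to the deletion of a vertex, so that the ear has corners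
  -- and not only colours.
  uncontract : ∀ vs {w′} → Step (map f vs) w′ →
               ∃ λ vs′ → w′ ≡ map f vs′ × (Triangulated {f = f} vs′ → Triangulated {f = f} vs)
  uncontract vs st = go st refl
    where
    go : ∀ {w w′} → Step w w′ → map f vs ≡ w →
         ∃ λ vs′ → w′ ≡ map f vs′ × (Triangulated {f = f} vs′ → Triangulated {f = f} vs)
    go (delete us y ws {ts = ts} {ts′} e e′ rep) eq with map-++⁻ f vs us eq
    ... | us′ , y′ , ws′ , refl , refl , refl , refl
      with map-++⁻ f (ws′ ++ us′) [] (trans (map-++ f ws′ us′) e)
         | map-++⁻ f (ws′ ++ us′) ts′ (trans (map-++ f ws′ us′) e′)
    ... | [] , n′ , ts″ , e₁ , _ , refl , _ | _ , p′ , [] , e₂ , _ , refl , _ =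
      us′ ++ ws′ , sym (map-++ f us′ ws′) , insert-point us′ e₁ e₂ rep
    ... | _ ∷ _ , _ , _ , _ , () , _ | _
    ... | _ | _ , _ , _ ∷ _ , _ , _ , _ , ()

  -- Read backwards, a contraction builds a triangulation ear by ear, starting from a single vertex.
  Contractible⇒Triangulated : ∀ vs {w} → Star _⟶_ (map f vs) w → ∀ {X} → w ≡ [ X ] → Triangulated {f = f} vs
  Contractible⇒Triangulated vs r e = go vs r refl e
    where
    go : ∀ vs {w w′} → Star _⟶_ w w′ → map f vs ≡ w → ∀ {X} → w′ ≡ [ X ] → Triangulated {f = f} vs
    go (v ∷ []) stop e refl = point
    go [] stop () refl
    go (_ ∷ _ ∷ _) stop () refl
    go vs (s ◅ r) refl e with uncontract vs (⟶⇒Step s)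
    ... | vs′ , refl , k = k (go vs′ r refl e)

-- Parity: integer area and repeated colours

π : ℤ → Parity
π z = parity ∣ z ∣

π-neg : ∀ i → π (ℤ.- i) ≡ π i
π-neg i = cong parity (ℤ.∣-i∣≡∣i∣ i)

π-⊖ : ∀ m n → π (m ⊖ n) ≡ parity m ℙ.+ parity n
π-⊖ zero    zero    = refl
π-⊖ zero    (suc n) = refl
π-⊖ (suc m) zero    = sym (ℙ.+-identityʳ _)
π-⊖ (suc m) (suc n) = trans (cong π (ℤ.[1+m]⊖[1+n]≡m⊖n m n)) (trans (π-⊖ m n)
  (sym (trans (sym (ℙ.+-homo-+ (suc m) (suc n))) (trans (cong parity (cong suc (ℕ.+-suc m n))) (ℙ.+-homo-+ m n)))))

π-+ : ∀ i j → π (i ℤ.+ j) ≡ π i ℙ.+ π j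
π-+ (+ m)    (+ n)    = ℙ.+-homo-+ m n
π-+ (+ m)    -[1+ n ] = π-⊖ m (suc n)
π-+ -[1+ m ] (+ n)    = trans (π-⊖ n (suc m)) (ℙ.+-comm (parity n) (parity (suc m)))
π-+ -[1+ m ] -[1+ n ] = trans (ℙ.+-homo-+ m n) (trans (sym (ℙ.+-homo-+ m n))
  (trans (cong parity (sym (cong suc (ℕ.+-suc m n)))) (ℙ.+-homo-+ (suc m) (suc n))))

π-minus : ∀ i j → π (i ℤ.- j) ≡ π i ℙ.+ π j
π-minus i j = trans (π-+ i (ℤ.- j)) (cong (π i ℙ.+_) (π-neg j))

π-* : ∀ i j → π (i ℤ.* j) ≡ π i ℙ.* π j
π-* i j = trans (cong parity (ℤ.abs-* i j)) (ℙ.*-homo-* ∣ i ∣ ∣ j ∣)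

detℙ : (a₁ a₂ b₁ b₂ c₁ c₂ : Parity) → Parity
detℙ a₁ a₂ b₁ b₂ c₁ c₂ = ((b₁ ℙ.+ a₁) ℙ.* (c₂ ℙ.+ a₂)) ℙ.+ ((b₂ ℙ.+ a₂) ℙ.* (c₁ ℙ.+ a₁))

π-det : ∀ a₁ a₂ b₁ b₂ c₁ c₂ →
  π (det (a₁ , a₂) (b₁ , b₂) (c₁ , c₂)) ≡ detℙ (π a₁) (π a₂) (π b₁) (π b₂) (π c₁) (π c₂)
π-det a₁ a₂ b₁ b₂ c₁ c₂ = trans (π-minus ((b₁ ℤ.- a₁) ℤ.* (c₂ ℤ.- a₂)) ((b₂ ℤ.- a₂) ℤ.* (c₁ ℤ.- a₁)))
  (cong₂ ℙ._+_ (trans (π-* (b₁ ℤ.- a₁) _) (cong₂ ℙ._*_ (π-minus b₁ a₁) (π-minus c₂ a₂)))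
               (trans (π-* (b₂ ℤ.- a₂) _) (cong₂ ℙ._*_ (π-minus b₂ a₂) (π-minus c₁ a₁))))

colourℙ : Parity → Parity → Colour
colourℙ 0ℙ 0ℙ = A
colourℙ 1ℙ 0ℙ = B
colourℙ 1ℙ 1ℙ = C
colourℙ 0ℙ 1ℙ = D

colour-π : ∀ x y → colour (x , y) ≡ colourℙ (π x) (π y)
colour-π x y with parity ∣ x ∣ | parity ∣ y ∣
... | 0ℙ | 0ℙ = refl
... | 1ℙ | 0ℙ = refl
... | 1ℙ | 1ℙ = refl
... | 0ℙ | 1ℙ = refl

repeats? : (x y z : Colour) → Dec (Repeats x y z)
repeats? x y z with x ≟ᶜ y | y ≟ᶜ z | x ≟ᶜ z
... | yes p | _     | _     = yes (₁₂ p)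
... | no _  | yes p | _     = yes (₂₃ p)
... | no _  | no _  | yes p = yes (₁₃ p)
... | no p  | no q  | no r  = no λ { (₁₂ h) → p h ; (₂₃ h) → q h ; (₁₃ h) → r h }

∀ℙ? : {P : Parity → Set} → (∀ p → Dec (P p)) → Dec (∀ p → P p)
∀ℙ? P? with P? 0ℙ | P? 1ℙ
... | yes x | yes y = yes λ { 0ℙ → x ; 1ℙ → y }
... | no x  | _     = no λ h → x (h 0ℙ)
... | yes _ | no y  = no λ h → y (h 1ℙ)

-- Three points of the affine plane over the field with two elements are
-- collinear only if two of them coincide.

detℙ⇒repeats : ∀ a₁ a₂ b₁ b₂ c₁ c₂ → detℙ a₁ a₂ b₁ b₂ c₁ c₂ ≡ 0ℙ →
               Repeats (colourℙ a₁ a₂) (colourℙ b₁ b₂) (colourℙ c₁ c₂)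
detℙ⇒repeats = from-yes (∀ℙ? λ a₁ → ∀ℙ? λ a₂ → ∀ℙ? λ b₁ → ∀ℙ? λ b₂ → ∀ℙ? λ c₁ → ∀ℙ? λ c₂ →
  (detℙ a₁ a₂ b₁ b₂ c₁ c₂ ℙ.≟ 0ℙ) →-dec repeats? (colourℙ a₁ a₂) (colourℙ b₁ b₂) (colourℙ c₁ c₂))

repeats⇒detℙ : ∀ a₁ a₂ b₁ b₂ c₁ c₂ → Repeats (colourℙ a₁ a₂) (colourℙ b₁ b₂) (colourℙ c₁ c₂) →
               detℙ a₁ a₂ b₁ b₂ c₁ c₂ ≡ 0ℙ
repeats⇒detℙ = from-yes (∀ℙ? λ a₁ → ∀ℙ? λ a₂ → ∀ℙ? λ b₁ → ∀ℙ? λ b₂ → ∀ℙ? λ c₁ → ∀ℙ? λ c₂ →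
  repeats? (colourℙ a₁ a₂) (colourℙ b₁ b₂) (colourℙ c₁ c₂) →-dec (detℙ a₁ a₂ b₁ b₂ c₁ c₂ ℙ.≟ 0ℙ))

parity-even : ∀ n → parity n ≡ 0ℙ → ∃ λ k → n ≡ k ℕ.* 2
parity-even zero          _ = 0 , refl
parity-even (suc zero)    ()
parity-even (suc (suc n)) h with parity-even n h
... | k , e = suc k , cong (λ m → suc (suc m)) e

π-even : ∀ z → π z ≡ 0ℙ → ∃ λ k → z ≡ k ℤ.* + 2
π-even (+ n) h with parity-even n h
... | k , e = + k , trans (cong +_ e) (ℤ.pos-* k 2)
π-even -[1+ n ] h with parity-even (suc n) h
... | k , e = ℤ.- (+ k) , trans (cong (λ m → ℤ.- (+ m)) e)
  (trans (cong ℤ.-_ (ℤ.pos-* k 2)) (ℤ.neg-distribˡ-* (+ k) (+ 2)))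

π-double : ∀ k → π (k ℤ.* + 2) ≡ 0ℙ
π-double k = trans (π-* k (+ 2)) (ℙ.*-zeroʳ (π k))

even-det⇒repeats : ∀ a b c k → det a b c ≡ k ℤ.* + 2 → Repeats (colour a) (colour b) (colour c)
even-det⇒repeats (a₁ , a₂) (b₁ , b₂) (c₁ , c₂) k e
  rewrite colour-π a₁ a₂ | colour-π b₁ b₂ | colour-π c₁ c₂ =
  detℙ⇒repeats (π a₁) (π a₂) (π b₁) (π b₂) (π c₁) (π c₂)
    (trans (sym (π-det a₁ a₂ b₁ b₂ c₁ c₂)) (trans (cong π e) (π-double k)))

repeats⇒even-det : ∀ a b c → Repeats (colour a) (colour b) (colour c) → ∃ λ k → det a b c ≡ k ℤ.* + 2
repeats⇒even-det (a₁ , a₂) (b₁ , b₂) (c₁ , c₂) rep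
  rewrite colour-π a₁ a₂ | colour-π b₁ b₂ | colour-π c₁ c₂ =
  π-even _ (trans (π-det a₁ a₂ b₁ b₂ c₁ c₂) (repeats⇒detℙ (π a₁) (π a₂) (π b₁) (π b₂) (π c₁) (π c₂) rep))

half≡integer⇒ : ∀ d k → d ℚ./ 2 ≡ k ℚ./ 1 → d ≡ k ℤ.* + 2
half≡integer⇒ d k e with ℚ.fromℚᵘ-injective {mkℚᵘ d 1} {mkℚᵘ k 0} e
... | *≡* h = trans (sym (ℤ.*-identityʳ d)) h

half≡integer : ∀ d k → d ≡ k ℤ.* + 2 → d ℚ./ 2 ≡ k ℚ./ 1
half≡integer d k e = ℚ.fromℚᵘ-cong {mkℚᵘ d 1} {mkℚᵘ k 0} (*≡* (trans (ℤ.*-identityʳ d) e))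

-- Signs of Cauchy sequences

Sequence : Set
Sequence = ℕ → ℚ

infix 4 _≗ˢ_
_≗ˢ_ : Sequence → Sequence → Set
s ≗ˢ t = ∀ n → s n ≡ t n

NonNegative-cong : ∀ {s t} → s ≗ˢ t → NonNegative s → NonNegative t
NonNegative-cong e h ε ε>0 with h ε ε>0
... | N , k = N , λ n N≤n → subst (ℚ.- ε ℚ.<_) (e n) (k n N≤n)

Positive-cong : ∀ {s t} → s ≗ˢ t → Positive s → Positive t
Positive-cong e (ε , ε>0 , N , k) = ε , ε>0 , N , λ n N≤n → subst (ε ℚ.<_) (e n) (k n N≤n)

half : ∀ ε → ½ ℚ.* ε ℚ.+ ½ ℚ.* ε ≡ ε
half ε = trans (sym (ℚ.*-distribʳ-+ ε ½ ½)) (ℚ.*-identityˡ ε)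

half>0 : ∀ {ε} → 0ℚ ℚ.< ε → 0ℚ ℚ.< ½ ℚ.* ε
half>0 {ε} h = subst (ℚ._< ½ ℚ.* ε) (ℚ.*-zeroʳ ½) (ℚ.*-monoʳ-<-pos ½ h)

NonNegative-+ : ∀ {s t} → NonNegative s → NonNegative t → NonNegative (λ n → s n ℚ.+ t n)
NonNegative-+ {s} {t} h k ε ε>0 with h (½ ℚ.* ε) (half>0 ε>0) | k (½ ℚ.* ε) (half>0 ε>0)
... | M , h′ | N , k′ = M ⊔ N , λ n le →
  subst (ℚ._< s n ℚ.+ t n) (trans (sym (ℚ.neg-distrib-+ (½ ℚ.* ε) (½ ℚ.* ε))) (cong ℚ.-_ (half ε)))
    (ℚ.+-mono-< (h′ n (ℕ.≤-trans (ℕ.m≤m⊔n M N) le)) (k′ n (ℕ.≤-trans (ℕ.m≤n⊔m M N) le)))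

Positive-+ : ∀ {s t} → Positive s → NonNegative t → Positive (λ n → s n ℚ.+ t n)
Positive-+ {s} {t} (ε , ε>0 , M , h) k with k (½ ℚ.* ε) (half>0 ε>0)
... | N , k′ = ½ ℚ.* ε , half>0 ε>0 , M ⊔ N , λ n le →
  subst (ℚ._< s n ℚ.+ t n) eq (ℚ.+-mono-< (h n (ℕ.≤-trans (ℕ.m≤m⊔n M N) le)) (k′ n (ℕ.≤-trans (ℕ.m≤n⊔m M N) le)))
  where
  eq : ε ℚ.+ ℚ.- (½ ℚ.* ε) ≡ ½ ℚ.* ε
  eq = trans (cong (ℚ._+ ℚ.- (½ ℚ.* ε)) (sym (half ε)))
    (solve 1 (λ x → x :+ x :+ (:- x) := x) refl (½ ℚ.* ε))

Positive⇒NonNegative : ∀ {s} → Positive s → NonNegative s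
Positive⇒NonNegative (ε , ε>0 , M , h) δ δ>0 = M , λ n le →
  ℚ.<-trans (ℚ.<-trans (ℚ.neg-antimono-< δ>0) ε>0) (h n le)

Positive⇒¬NonNegative : ∀ {s} → Positive s → ¬ NonNegative (λ n → ℚ.- s n)
Positive⇒¬NonNegative {s} (ε , ε>0 , M , h) k with k ε ε>0
... | N , k′ = ℚ.<-asym (h (M ⊔ N) (ℕ.m≤m⊔n M N))
  (subst₂ ℚ._<_ (ℚ-neg² (s (M ⊔ N))) (ℚ-neg² ε) (ℚ.neg-antimono-< (k′ (M ⊔ N) (ℕ.m≤n⊔m M N))))
  where
  ℚ-neg² : ∀ x → ℚ.- (ℚ.- x) ≡ x
  ℚ-neg² = solve 1 (λ x → :- (:- x) := x) refl

module _ (c : ℚ) .{{_ : ℚ.Positive c}} where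

  private
    instance
      c≢0 : NonZero c
      c≢0 = ℚ.pos⇒nonZero c
      1/c>0 : ℚ.Positive (1/ c)
      1/c>0 = ℚ.1/pos⇒pos c

    c*1/c : ∀ ε → c ℚ.* (1/ c ℚ.* ε) ≡ ε
    c*1/c ε = trans (sym (ℚ.*-assoc c (1/ c) ε)) (trans (cong (ℚ._* ε) (ℚ.*-inverseʳ c)) (ℚ.*-identityˡ ε))

  *>0 : ∀ {ε} → 0ℚ ℚ.< ε → 0ℚ ℚ.< c ℚ.* ε
  *>0 {ε} h = subst (ℚ._< c ℚ.* ε) (ℚ.*-zeroʳ c) (ℚ.*-monoʳ-<-pos c h)

  />0 : ∀ {ε} → 0ℚ ℚ.< ε → 0ℚ ℚ.< 1/ c ℚ.* ε
  />0 {ε} h = subst (ℚ._< 1/ c ℚ.* ε) (ℚ.*-zeroʳ (1/ c)) (ℚ.*-monoʳ-<-pos (1/ c) h)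

  NonNegative-* : ∀ {s} → NonNegative s → NonNegative (λ n → c ℚ.* s n)
  NonNegative-* {s} h ε ε>0 with h (1/ c ℚ.* ε) (/>0 ε>0)
  ... | N , k = N , λ n le → subst (ℚ._< c ℚ.* s n)
    (trans (sym (ℚ.neg-distribʳ-* c (1/ c ℚ.* ε))) (cong ℚ.-_ (c*1/c ε))) (ℚ.*-monoʳ-<-pos c (k n le))

  NonNegative-*⁻¹ : ∀ {s} → NonNegative (λ n → c ℚ.* s n) → NonNegative s
  NonNegative-*⁻¹ {s} h ε ε>0 with h (c ℚ.* ε) (*>0 ε>0)
  ... | N , k = N , λ n le → ℚ.*-cancelˡ-<-nonNeg c {{ℚ.pos⇒nonNeg c}}
    (subst (ℚ._< c ℚ.* s n) (ℚ.neg-distribʳ-* c ε) (k n le))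

  Positive-* : ∀ {s} → Positive s → Positive (λ n → c ℚ.* s n)
  Positive-* (ε , ε>0 , N , k) = c ℚ.* ε , *>0 ε>0 , N , λ n le → ℚ.*-monoʳ-<-pos c (k n le)

  Positive-*⁻¹ : ∀ {s} → Positive (λ n → c ℚ.* s n) → Positive s
  Positive-*⁻¹ {s} (ε , ε>0 , N , k) = 1/ c ℚ.* ε , />0 ε>0 , N , λ n le →
    ℚ.*-cancelˡ-<-nonNeg c {{ℚ.pos⇒nonNeg c}} (subst (ℚ._< c ℚ.* s n) (sym (c*1/c ε)) (k n le))

Cauchy : Sequence → Set
Cauchy s = ∀ ε → 0ℚ ℚ.< ε → ∃ λ N → ∀ m n → N ℕ.≤ m → N ℕ.≤ n → ℚ.∣ s m ℚ.- s n ∣ ℚ.< ε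

Cauchy-const : ∀ c → Cauchy (λ _ → c)
Cauchy-const c ε ε>0 = 0 , λ _ _ _ _ → subst (λ x → ℚ.∣ x ∣ ℚ.< ε) (sym (ℚ.+-inverseʳ c)) ε>0

Cauchy-+ : ∀ s t → Cauchy s → Cauchy t → Cauchy (λ n → s n ℚ.+ t n)
Cauchy-+ s t h k ε ε>0 with h (½ ℚ.* ε) (half>0 ε>0) | k (½ ℚ.* ε) (half>0 ε>0)
... | M , h′ | N , k′ = M ⊔ N , λ m n m≥ n≥ → subst (_ ℚ.<_) (half ε) (ℚ.≤-<-trans
  (subst (λ x → ℚ.∣ x ∣ ℚ.≤ ℚ.∣ s m ℚ.- s n ∣ ℚ.+ ℚ.∣ t m ℚ.- t n ∣)
    (solve 4 (λ a b c d → (a :- b) :+ (c :- d) := (a :+ c) :- (b :+ d)) refl (s m) (s n) (t m) (t n))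
    (ℚ.∣p+q∣≤∣p∣+∣q∣ (s m ℚ.- s n) (t m ℚ.- t n)))
  (ℚ.+-mono-< (h′ m n (ℕ.≤-trans (ℕ.m≤m⊔n M N) m≥) (ℕ.≤-trans (ℕ.m≤m⊔n M N) n≥))
              (k′ m n (ℕ.≤-trans (ℕ.m≤n⊔m M N) m≥) (ℕ.≤-trans (ℕ.m≤n⊔m M N) n≥))))

Cauchy-* : ∀ c s → Cauchy s → Cauchy (λ n → c ℚ.* s n)
Cauchy-* c s h ε ε>0 = go (h (1/ d ℚ.* ε) (/>0 d ε>0))
  where
  d = ℚ.∣ c ∣ ℚ.+ 1ℚ
  instance
    d>0 : ℚ.Positive d
    d>0 = ℚ.nonNeg+pos⇒pos ℚ.∣ c ∣ {{ℚ.∣-∣-nonNeg c}} 1ℚ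
    d≢0 : NonZero d
    d≢0 = ℚ.pos⇒nonZero d
  bound : ∀ x y → ℚ.∣ x ℚ.- y ∣ ℚ.< 1/ d ℚ.* ε → ℚ.∣ c ℚ.* x ℚ.- c ℚ.* y ∣ ℚ.< ε
  bound x y lt = begin-strict
    ℚ.∣ c ℚ.* x ℚ.- c ℚ.* y ∣   ≡⟨ cong ℚ.∣_∣ (solve 3 (λ c x y → c :* x :- c :* y := c :* (x :- y)) refl c x y) ⟩
    ℚ.∣ c ℚ.* (x ℚ.- y) ∣       ≡⟨ ℚ.∣p*q∣≡∣p∣*∣q∣ c (x ℚ.- y) ⟩
    ℚ.∣ c ∣ ℚ.* ℚ.∣ x ℚ.- y ∣   ≤⟨ ℚ.*-monoʳ-≤-nonNeg ℚ.∣ x ℚ.- y ∣ {{ℚ.∣-∣-nonNeg (x ℚ.- y)}}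
                                     (subst (ℚ._≤ d) (ℚ.+-identityʳ ℚ.∣ c ∣) (ℚ.+-monoʳ-≤ ℚ.∣ c ∣ (ℚ.<⇒≤ (ℚ.positive⁻¹ 1ℚ)))) ⟩
    d ℚ.* ℚ.∣ x ℚ.- y ∣         <⟨ ℚ.*-monoʳ-<-pos d lt ⟩
    d ℚ.* (1/ d ℚ.* ε)          ≡⟨ trans (sym (ℚ.*-assoc d (1/ d) ε)) (trans (cong (ℚ._* ε) (ℚ.*-inverseʳ d)) (ℚ.*-identityˡ ε)) ⟩
    ε                           ∎
    where open ℚ.≤-Reasoning
  go : (∃ λ N → ∀ m n → N ℕ.≤ m → N ℕ.≤ n → ℚ.∣ s m ℚ.- s n ∣ ℚ.< 1/ d ℚ.* ε) →
       ∃ λ N → ∀ m n → N ℕ.≤ m → N ℕ.≤ n → ℚ.∣ c ℚ.* s m ℚ.- c ℚ.* s n ∣ ℚ.< ε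
  go (N , k) = N , λ m n m≥ n≥ → bound (s m) (s n) (k m n m≥ n≥)

p≤∣p∣ : ∀ p → p ℚ.≤ ℚ.∣ p ∣
p≤∣p∣ p with ℚ.≤-total 0ℚ p
... | inj₁ 0≤p = ℚ.≤-reflexive (sym (ℚ.0≤p⇒∣p∣≡p 0≤p))
... | inj₂ p≤0 = ℚ.≤-trans p≤0 (ℚ.0≤∣p∣ p)

half< : ∀ {ε} → 0ℚ ℚ.< ε → ½ ℚ.* ε ℚ.< ε
half< {ε} h = subst₂ ℚ._<_ (ℚ.+-identityʳ (½ ℚ.* ε)) (half ε) (ℚ.+-monoʳ-< (½ ℚ.* ε) (half>0 h))

-- A single term decides. From an index N on, terms differ by less than ε / 4: if `s N` is above -ε
-- / 2, all later terms are above -ε; otherwise they all stay below -ε / 4, and the opposite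
-- sequence is positive.
¬Positive⇒NonNegative : ∀ {s} → Cauchy s → ¬ Positive (λ n → ℚ.- s n) → NonNegative s
¬Positive⇒NonNegative {s} c np ε ε>0 = go (c δ (half>0 (half>0 ε>0)))
  where
  open ℚ.≤-Reasoning
  δ = ½ ℚ.* (½ ℚ.* ε)
  go : (∃ λ N → ∀ m n → N ℕ.≤ m → N ℕ.≤ n → ℚ.∣ s m ℚ.- s n ∣ ℚ.< δ) → Eventually (λ n → ℚ.- ε ℚ.< s n)
  go (N , k) with ℚ.- (½ ℚ.* ε) ℚ.<? s N
  ... | yes lt = N , λ n le → begin-strict
    ℚ.- ε                                 ≡⟨ trans (cong ℚ.-_ (sym (half ε))) (ℚ.neg-distrib-+ (½ ℚ.* ε) (½ ℚ.* ε)) ⟩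
    ℚ.- (½ ℚ.* ε) ℚ.+ ℚ.- (½ ℚ.* ε)       <⟨ ℚ.+-mono-< lt (ℚ.neg-antimono-<
                                               (ℚ.≤-<-trans (p≤∣p∣ (s N ℚ.- s n)) (ℚ.<-trans (k N n ℕ.≤-refl le) (half< (half>0 ε>0))))) ⟩
    s N ℚ.+ ℚ.- (s N ℚ.- s n)             ≡⟨ solve 2 (λ x y → x :+ (:- (x :- y)) := y) refl (s N) (s n) ⟩
    s n                                   ∎
  ... | no ¬lt = contradiction (δ , half>0 (half>0 ε>0) , N , λ n le → begin-strict
    δ                                     ≡⟨ solve 1 (λ x → x := :- ((:- (x :+ x)) :+ x)) refl δ ⟩
    ℚ.- (ℚ.- (δ ℚ.+ δ) ℚ.+ δ)             <⟨ ℚ.neg-antimono-< (ℚ.+-mono-≤-<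
                                               (subst (s N ℚ.≤_) (cong ℚ.-_ (sym (half (½ ℚ.* ε)))) (ℚ.≮⇒≥ ¬lt))
                                               (ℚ.≤-<-trans (p≤∣p∣ (s n ℚ.- s N)) (k n N le ℕ.≤-refl))) ⟩
    ℚ.- (s N ℚ.+ (s n ℚ.- s N))           ≡⟨ cong ℚ.-_ (solve 2 (λ x y → x :+ (y :- x) := y) refl (s N) (s n)) ⟩
    ℚ.- s n                               ∎) np

-- The dichotomy of signs survives under double negation, which is enough for the doubly negated
-- union in `Dissects`.
NonNegative-total : ∀ {s} → Cauchy s → ¬ ¬ (NonNegative s ⊎ NonNegative (λ n → ℚ.- s n))
NonNegative-total c k = k (inj₁ (¬Positive⇒NonNegative c λ pos → k (inj₂ (Positive⇒NonNegative pos))))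

-- Linear forms on homogeneous coordinates

ℤ³ : Set
ℤ³ = ℤ × ℤ × ℤ

infix  8 _·_
infixl 6 _⊕_
infixr 7 _⊛_

_·_ : ℤ³ → ℤ³ → ℤ
(α , β , γ) · (x , y , z) = α ℤ.* x ℤ.+ β ℤ.* y ℤ.+ γ ℤ.* z

_⊕_ : ℤ³ → ℤ³ → ℤ³
(α , β , γ) ⊕ (x , y , z) = α ℤ.+ x , β ℤ.+ y , γ ℤ.+ z

_⊛_ : ℤ → ℤ³ → ℤ³
k ⊛ (x , y , z) = k ℤ.* x , k ℤ.* y , k ℤ.* z

⊖_ : ℤ³ → ℤ³
⊖ (x , y , z) = ℤ.- x , ℤ.- y , ℤ.- z

lift : LatticePoint → ℤ³
lift (x , y) = x , y , + 1

-- The cross product of `lift a` and `lift b`, that is, the coefficients of the line through a and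
-- b.
form : LatticePoint → LatticePoint → ℤ³
form (a₁ , a₂) (b₁ , b₂) = a₂ ℤ.- b₂ , b₁ ℤ.- a₁ , a₁ ℤ.* b₂ ℤ.- a₂ ℤ.* b₁

cong₃ : {a a′ b b′ c c′ : ℤ} → a ≡ a′ → b ≡ b′ → c ≡ c′ → (a , b , c) ≡ (a′ , b′ , c′)
cong₃ refl refl refl = refl

form-lift : ∀ a b c → form a b · lift c ≡ det a b c
form-lift (a₁ , a₂) (b₁ , b₂) (c₁ , c₂) = lemma a₁ a₂ b₁ b₂ c₁ c₂
  where
  lemma : ∀ a₁ a₂ b₁ b₂ c₁ c₂ → (a₂ ℤ.- b₂) ℤ.* c₁ ℤ.+ (b₁ ℤ.- a₁) ℤ.* c₂ ℤ.+ (a₁ ℤ.* b₂ ℤ.- a₂ ℤ.* b₁) ℤ.* + 1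
                              ≡ (b₁ ℤ.- a₁) ℤ.* (c₂ ℤ.- a₂) ℤ.- (b₂ ℤ.- a₂) ℤ.* (c₁ ℤ.- a₁)
  lemma = solve-∀

form-sym : ∀ a b → form b a ≡ ⊖ form a b
form-sym (a₁ , a₂) (b₁ , b₂) = cong₃ (neg a₂ b₂) (neg b₁ a₁) (neg′ a₁ a₂ b₁ b₂)
  where
  neg : ∀ x y → y ℤ.- x ≡ ℤ.- (x ℤ.- y)
  neg = solve-∀
  neg′ : ∀ a₁ a₂ b₁ b₂ → b₁ ℤ.* a₂ ℤ.- b₂ ℤ.* a₁ ≡ ℤ.- (a₁ ℤ.* b₂ ℤ.- a₂ ℤ.* b₁)
  neg′ = solve-∀

-- The edge forms are, up to the factor `det a b c`, the basis dual to the three corners; so the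
-- coefficients of φ are its values at the corners.
cramer : ∀ a b c φ → det a b c ⊛ φ ≡
         φ · lift a ⊛ form b c ⊕ φ · lift b ⊛ form c a ⊕ φ · lift c ⊛ form a b
cramer (a₁ , a₂) (b₁ , b₂) (c₁ , c₂) (α , β , γ) =
  cong₃ (x a₁ a₂ b₁ b₂ c₁ c₂ α β γ) (y a₁ a₂ b₁ b₂ c₁ c₂ α β γ) (z a₁ a₂ b₁ b₂ c₁ c₂ α β γ)
  where
  open import Data.Integer.Base using (_+_; _*_; _-_)
  x : ∀ a₁ a₂ b₁ b₂ c₁ c₂ α β γ → ((b₁ - a₁) * (c₂ - a₂) - (b₂ - a₂) * (c₁ - a₁)) * α ≡
    (α * a₁ + β * a₂ + γ * + 1) * (b₂ - c₂) + (α * b₁ + β * b₂ + γ * + 1) * (c₂ - a₂) + (α * c₁ + β * c₂ + γ * + 1) * (a₂ - b₂)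
  x = solve-∀
  y : ∀ a₁ a₂ b₁ b₂ c₁ c₂ α β γ → ((b₁ - a₁) * (c₂ - a₂) - (b₂ - a₂) * (c₁ - a₁)) * β ≡
    (α * a₁ + β * a₂ + γ * + 1) * (c₁ - b₁) + (α * b₁ + β * b₂ + γ * + 1) * (a₁ - c₁) + (α * c₁ + β * c₂ + γ * + 1) * (b₁ - a₁)
  y = solve-∀
  z : ∀ a₁ a₂ b₁ b₂ c₁ c₂ α β γ → ((b₁ - a₁) * (c₂ - a₂) - (b₂ - a₂) * (c₁ - a₁)) * γ ≡
    (α * a₁ + β * a₂ + γ * + 1) * (b₁ * c₂ - b₂ * c₁) + (α * b₁ + β * b₂ + γ * + 1) * (c₁ * a₂ - c₂ * a₁)
      + (α * c₁ + β * c₂ + γ * + 1) * (a₁ * b₂ - a₂ * b₁)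
  z = solve-∀

·-⊕ˡ : ∀ φ ψ h → (φ ⊕ ψ) · h ≡ φ · h ℤ.+ ψ · h
·-⊕ˡ (α , β , γ) (α′ , β′ , γ′) (x , y , z) = lemma α β γ α′ β′ γ′ x y z
  where
  open import Data.Integer.Base using (_+_; _*_)
  lemma : ∀ α β γ α′ β′ γ′ x y z → (α + α′) * x + (β + β′) * y + (γ + γ′) * z ≡ α * x + β * y + γ * z + (α′ * x + β′ * y + γ′ * z)
  lemma = solve-∀

·-comm : ∀ φ h → φ · h ≡ h · φ
·-comm (α , β , γ) (x , y , z) = cong₂ ℤ._+_ (cong₂ ℤ._+_ (ℤ.*-comm α x) (ℤ.*-comm β y)) (ℤ.*-comm γ z)

·-⊛ˡ : ∀ k φ h → (k ⊛ φ) · h ≡ k ℤ.* (φ · h)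
·-⊛ˡ k (α , β , γ) (x , y , z) = lemma k α β γ x y z
  where
  open import Data.Integer.Base using (_+_; _*_)
  lemma : ∀ k α β γ x y z → k * α * x + k * β * y + k * γ * z ≡ k * (α * x + β * y + γ * z)
  lemma = solve-∀

·-⊕ʳ : ∀ φ h k → φ · (h ⊕ k) ≡ φ · h ℤ.+ φ · k
·-⊕ʳ φ h k = trans (·-comm φ (h ⊕ k)) (trans (·-⊕ˡ h k φ) (cong₂ ℤ._+_ (·-comm h φ) (·-comm k φ)))

·-⊛ʳ : ∀ φ k h → φ · (k ⊛ h) ≡ k ℤ.* (φ · h)
·-⊛ʳ φ k h = trans (·-comm φ (k ⊛ h)) (trans (·-⊛ˡ k h φ) (cong (k ℤ.*_) (·-comm h φ)))

cramer-· : ∀ a b c φ h → det a b c ℤ.* (φ · h) ≡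
           φ · lift a ℤ.* (form b c · h) ℤ.+ φ · lift b ℤ.* (form c a · h) ℤ.+ φ · lift c ℤ.* (form a b · h)
cramer-· a b c φ h = begin
  det a b c ℤ.* (φ · h)   ≡⟨ ·-⊛ˡ (det a b c) φ h ⟨
  (det a b c ⊛ φ) · h     ≡⟨ cong (_· h) (cramer a b c φ) ⟩
  (φ · lift a ⊛ form b c ⊕ φ · lift b ⊛ form c a ⊕ φ · lift c ⊛ form a b) · h
    ≡⟨ ·-⊕ˡ (φ · lift a ⊛ form b c ⊕ φ · lift b ⊛ form c a) (φ · lift c ⊛ form a b) h ⟩
  (φ · lift a ⊛ form b c ⊕ φ · lift b ⊛ form c a) · h ℤ.+ (φ · lift c ⊛ form a b) · h
    ≡⟨ cong₂ ℤ._+_ (trans (·-⊕ˡ (φ · lift a ⊛ form b c) (φ · lift b ⊛ form c a) h)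
         (cong₂ ℤ._+_ (·-⊛ˡ (φ · lift a) (form b c) h) (·-⊛ˡ (φ · lift b) (form c a) h))) (·-⊛ˡ (φ · lift c) (form a b) h) ⟩
  φ · lift a ℤ.* (form b c · h) ℤ.+ φ · lift b ℤ.* (form c a · h) ℤ.+ φ · lift c ℤ.* (form a b · h) ∎
  where open ≡-Reasoning

-- The sign of a form at a real point

ι : ℤ → ℚ
ι z = z ℚ./ 1

toℚᵘ-ι : ∀ z → ℚ.toℚᵘ (ι z) ℚᵘ.≃ mkℚᵘ z 0
toℚᵘ-ι z = ℚ.toℚᵘ-fromℚᵘ (mkℚᵘ z 0)

ι-+ : ∀ i j → ι (i ℤ.+ j) ≡ ι i ℚ.+ ι j
ι-+ i j = ℚ.toℚᵘ-injective (ℚᵘ.≃-trans (toℚᵘ-ι (i ℤ.+ j)) (ℚᵘ.≃-trans (*≡* (lemma i j))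
  (ℚᵘ.≃-sym (ℚᵘ.≃-trans (ℚ.toℚᵘ-homo-+ (ι i) (ι j)) (ℚᵘ.+-cong (toℚᵘ-ι i) (toℚᵘ-ι j))))))
  where
  lemma : ∀ i j → (i ℤ.+ j) ℤ.* + 1 ≡ (i ℤ.* + 1 ℤ.+ j ℤ.* + 1) ℤ.* + 1
  lemma = solve-∀

ι-* : ∀ i j → ι (i ℤ.* j) ≡ ι i ℚ.* ι j
ι-* i j = ℚ.toℚᵘ-injective (ℚᵘ.≃-trans (toℚᵘ-ι (i ℤ.* j))
  (ℚᵘ.≃-sym (ℚᵘ.≃-trans (ℚ.toℚᵘ-homo-* (ι i) (ι j)) (ℚᵘ.*-cong (toℚᵘ-ι i) (toℚᵘ-ι j)))))

ι-neg : ∀ i → ι (ℤ.- i) ≡ ℚ.- ι i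
ι-neg i = ℚ.toℚᵘ-injective (ℚᵘ.≃-trans (toℚᵘ-ι (ℤ.- i))
  (ℚᵘ.≃-sym (ℚᵘ.≃-trans (ℚ.toℚᵘ-homo‿- (ι i)) (ℚᵘ.-‿cong (toℚᵘ-ι i)))))

ι-minus : ∀ i j → ι (i ℤ.- j) ≡ ι i ℚ.- ι j
ι-minus i j = trans (ι-+ i (ℤ.- j)) (cong (ι i ℚ.+_) (ι-neg j))

value : ℤ³ → Point → Sequence
value (α , β , γ) (x , y) n = ι α ℚ.* seq x n ℚ.+ ι β ℚ.* seq y n ℚ.+ ι γ

side≗value : ∀ a b p → side a b p ≗ˢ value (form a b) p
side≗value (a₁ , a₂) (b₁ , b₂) (x , y) n
  rewrite ι-minus b₁ a₁ | ι-minus b₂ a₂ | ι-minus a₂ b₂ | ι-minus (a₁ ℤ.* b₂) (a₂ ℤ.* b₁) | ι-* a₁ b₂ | ι-* a₂ b₁ =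
  solve 6 (λ a₁ a₂ b₁ b₂ x y → (b₁ :- a₁) :* (y :- a₂) :- (b₂ :- a₂) :* (x :- a₁) :=
             (a₂ :- b₂) :* x :+ (b₁ :- a₁) :* y :+ (a₁ :* b₂ :- a₂ :* b₁)) refl
    (ι a₁) (ι a₂) (ι b₁) (ι b₂) (seq x n) (seq y n)

value-⊕ : ∀ φ ψ p n → value (φ ⊕ ψ) p n ≡ value φ p n ℚ.+ value ψ p n
value-⊕ (α , β , γ) (α′ , β′ , γ′) (x , y) n rewrite ι-+ α α′ | ι-+ β β′ | ι-+ γ γ′ =
  solve 8 (λ α β γ α′ β′ γ′ x y → (α :+ α′) :* x :+ (β :+ β′) :* y :+ (γ :+ γ′) :=
     (α :* x :+ β :* y :+ γ) :+ (α′ :* x :+ β′ :* y :+ γ′)) refl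
     (ι α) (ι β) (ι γ) (ι α′) (ι β′) (ι γ′) (seq x n) (seq y n)

value-⊛ : ∀ k φ p n → value (k ⊛ φ) p n ≡ ι k ℚ.* value φ p n
value-⊛ k (α , β , γ) (x , y) n rewrite ι-* k α | ι-* k β | ι-* k γ =
  solve 6 (λ k α β γ x y → k :* α :* x :+ k :* β :* y :+ k :* γ := k :* (α :* x :+ β :* y :+ γ)) refl
     (ι k) (ι α) (ι β) (ι γ) (seq x n) (seq y n)

value-⊖ : ∀ φ p n → value (⊖ φ) p n ≡ ℚ.- value φ p n
value-⊖ (α , β , γ) (x , y) n rewrite ι-neg α | ι-neg β | ι-neg γ =
  solve 5 (λ α β γ x y → (:- α) :* x :+ (:- β) :* y :+ (:- γ) := :- (α :* x :+ β :* y :+ γ)) refl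
     (ι α) (ι β) (ι γ) (seq x n) (seq y n)

value-cauchy : ∀ φ p → Cauchy (value φ p)
value-cauchy (α , β , γ) (x , y) =
  Cauchy-+ (λ n → ι α ℚ.* seq x n ℚ.+ ι β ℚ.* seq y n) (λ _ → ι γ)
    (Cauchy-+ (λ n → ι α ℚ.* seq x n) (λ n → ι β ℚ.* seq y n)
      (Cauchy-* (ι α) (seq x) (cauchy x)) (Cauchy-* (ι β) (seq y) (cauchy y)))
    (Cauchy-const (ι γ))

infix 4 0≤_at_ 0<_at_

record 0≤_at_ (φ : ℤ³) (p : Point) : Set where
  constructor ≥0
  field nonNegative : NonNegative (value φ p)

record 0<_at_ (φ : ℤ³) (p : Point) : Set where
  constructor >0
  field positive : Positive (value φ p)

ι-pos : ∀ {k} → + 0 ℤ.< k → ℚ.Positive (ι k)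
ι-pos {+ ℕ.suc n} h = ℚ.normalize-pos (ℕ.suc n) 1
ι-pos {+ 0} (ℤ.+<+ ())

module _ {p : Point} where

  0≤-⊕ : ∀ {φ ψ} → 0≤ φ at p → 0≤ ψ at p → 0≤ φ ⊕ ψ at p
  0≤-⊕ {φ} {ψ} (≥0 h) (≥0 k) = ≥0 (NonNegative-cong (λ n → sym (value-⊕ φ ψ p n)) (NonNegative-+ h k))

  0<-⊕ : ∀ {φ ψ} → 0< φ at p → 0≤ ψ at p → 0< φ ⊕ ψ at p
  0<-⊕ {φ} {ψ} (>0 h) (≥0 k) = >0 (Positive-cong (λ n → sym (value-⊕ φ ψ p n)) (Positive-+ h k))

  0≤-⊛⁻¹ : ∀ {φ k} → + 0 ℤ.< k → 0≤ k ⊛ φ at p → 0≤ φ at p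
  0≤-⊛⁻¹ {φ} {k} k>0 (≥0 h) = ≥0 (NonNegative-*⁻¹ (ι k) {{ι-pos k>0}} (NonNegative-cong (value-⊛ k φ p) h))

  0<-⊛⁻¹ : ∀ {φ k} → + 0 ℤ.< k → 0< k ⊛ φ at p → 0< φ at p
  0<-⊛⁻¹ {φ} {k} k>0 (>0 h) = >0 (Positive-*⁻¹ (ι k) {{ι-pos k>0}} (Positive-cong (value-⊛ k φ p) h))

  0<-⊛ : ∀ {φ k} → + 0 ℤ.< k → 0< φ at p → 0< k ⊛ φ at p
  0<-⊛ {φ} {k} k>0 (>0 h) = >0 (Positive-cong (λ n → sym (value-⊛ k φ p n)) (Positive-* (ι k) {{ι-pos k>0}} h))

  0≤-⊛ : ∀ {φ k} → + 0 ℤ.≤ k → 0≤ φ at p → 0≤ k ⊛ φ at p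
  0≤-⊛ {φ} {+ 0} _ _ = ≥0 (NonNegative-cong {λ _ → 0ℚ}
    (λ n → sym (trans (value-⊛ (+ 0) φ p n) (ℚ.*-zeroˡ (value φ p n)))) (λ ε ε>0 → 0 , λ _ _ → ℚ.neg-antimono-< ε>0))
  0≤-⊛ {φ} {k@(+ ℕ.suc m)} _ (≥0 h) = ≥0 (NonNegative-cong (λ n → sym (value-⊛ k φ p n))
    (NonNegative-* (ι k) {{ι-pos {k} (ℤ.+<+ (ℕ.s≤s ℕ.z≤n))}} h))

  0<⇒0≤ : ∀ {φ} → 0< φ at p → 0≤ φ at p
  0<⇒0≤ (>0 h) = ≥0 (Positive⇒NonNegative h)

  0<⇒¬0≤⊖ : ∀ {φ} → 0< φ at p → ¬ (0≤ ⊖ φ at p)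
  0<⇒¬0≤⊖ {φ} (>0 h) (≥0 k) = Positive⇒¬NonNegative h (NonNegative-cong (value-⊖ φ p) k)

  0≤-total : ∀ φ → ¬ ¬ (0≤ φ at p ⊎ 0≤ ⊖ φ at p)
  0≤-total φ k = NonNegative-total (value-cauchy φ p) λ
    { (inj₁ h) → k (inj₁ (≥0 h)) ; (inj₂ h) → k (inj₂ (≥0 (NonNegative-cong (λ n → sym (value-⊖ φ p n)) h))) }

module _ (a b : LatticePoint) (p : Point) where

  side⇒0≤ : NonNegative (side a b p) → 0≤ form a b at p
  side⇒0≤ h = ≥0 (NonNegative-cong (side≗value a b p) h)

  0≤⇒side : 0≤ form a b at p → NonNegative (side a b p)
  0≤⇒side (≥0 h) = NonNegative-cong (λ n → sym (side≗value a b p n)) h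

  side⇒0< : Positive (side a b p) → 0< form a b at p
  side⇒0< h = >0 (Positive-cong (side≗value a b p) h)

  0<⇒side : 0< form a b at p → Positive (side a b p)
  0<⇒side (>0 h) = Positive-cong (λ n → sym (side≗value a b p n)) h

-- A homogeneous triple (x , y , d) with d > 0 represents the rational point
-- (x / d , y / d).

const-ℝ : ℚ → ℝ
const-ℝ q = record { seq = λ _ → q ; cauchy = Cauchy-const q }

rational : (h : ℤ³) → + 0 ℤ.< proj₂ (proj₂ h) → Point
rational (x , y , + ℕ.suc d) _ = const-ℝ (x ℚ./ ℕ.suc d) , const-ℝ (y ℚ./ ℕ.suc d)
rational (x , y , + 0) (ℤ.+<+ ())

ι-*-/ : ∀ x d → ι (+ ℕ.suc d) ℚ.* (x ℚ./ ℕ.suc d) ≡ ι x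
ι-*-/ x d = ℚ.toℚᵘ-injective (ℚᵘ.≃-trans (ℚ.toℚᵘ-homo-* (ι (+ ℕ.suc d)) (x ℚ./ ℕ.suc d))
  (ℚᵘ.≃-trans (ℚᵘ.*-cong (toℚᵘ-ι (+ ℕ.suc d)) (ℚ.toℚᵘ-fromℚᵘ (mkℚᵘ x d)))
  (ℚᵘ.≃-trans (*≡* (trans (lemma (+ ℕ.suc d) x) (cong (λ m → x ℤ.* (+ ℕ.suc m)) (sym (ℕ.+-identityʳ d))))) (ℚᵘ.≃-sym (toℚᵘ-ι x)))))
  where
  lemma : ∀ d x → d ℤ.* x ℤ.* + 1 ≡ x ℤ.* d
  lemma = solve-∀

value-rational : ∀ φ h (d>0 : + 0 ℤ.< proj₂ (proj₂ h)) n →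
                 ι (proj₂ (proj₂ h)) ℚ.* value φ (rational h d>0) n ≡ ι (φ · h)
value-rational (α , β , γ) (x , y , + ℕ.suc d) _ n = begin
  δ ℚ.* (ι α ℚ.* (x ℚ./ ℕ.suc d) ℚ.+ ι β ℚ.* (y ℚ./ ℕ.suc d) ℚ.+ ι γ)
    ≡⟨ solve 6 (λ δ α β γ x y → δ :* (α :* x :+ β :* y :+ γ) := α :* (δ :* x) :+ β :* (δ :* y) :+ γ :* δ) refl δ (ι α) (ι β) (ι γ) (x ℚ./ ℕ.suc d) (y ℚ./ ℕ.suc d) ⟩
  ι α ℚ.* (δ ℚ.* (x ℚ./ ℕ.suc d)) ℚ.+ ι β ℚ.* (δ ℚ.* (y ℚ./ ℕ.suc d)) ℚ.+ ι γ ℚ.* δ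
    ≡⟨ cong₂ (λ u v → ι α ℚ.* u ℚ.+ ι β ℚ.* v ℚ.+ ι γ ℚ.* δ) (ι-*-/ x d) (ι-*-/ y d) ⟩
  ι α ℚ.* ι x ℚ.+ ι β ℚ.* ι y ℚ.+ ι γ ℚ.* δ
    ≡⟨ cong₂ ℚ._+_ (trans (cong₂ ℚ._+_ (sym (ι-* α x)) (sym (ι-* β y))) (sym (ι-+ (α ℤ.* x) (β ℤ.* y)))) (sym (ι-* γ (+ ℕ.suc d))) ⟩
  ι (α ℤ.* x ℤ.+ β ℤ.* y) ℚ.+ ι (γ ℤ.* + ℕ.suc d)
    ≡⟨ sym (ι-+ (α ℤ.* x ℤ.+ β ℤ.* y) (γ ℤ.* + ℕ.suc d)) ⟩
  ι (α ℤ.* x ℤ.+ β ℤ.* y ℤ.+ γ ℤ.* + ℕ.suc d) ∎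
  where
  open ≡-Reasoning
  δ = ι (+ ℕ.suc d)
value-rational _ (x , y , + 0) (ℤ.+<+ ()) _

NonNegative-ι : ∀ {z} → + 0 ℤ.≤ z → NonNegative (λ _ → ι z)
NonNegative-ι {+ 0} _ ε ε>0 = 0 , λ _ _ → ℚ.neg-antimono-< ε>0
NonNegative-ι {+ ℕ.suc n} _ = Positive⇒NonNegative (½ ℚ.* ι (+ ℕ.suc n) , half>0 pos , 0 , λ _ _ → half< pos)
  where
  pos : 0ℚ ℚ.< ι (+ ℕ.suc n)
  pos = ℚ.positive⁻¹ _ {{ι-pos {+ ℕ.suc n} (ℤ.+<+ (ℕ.s≤s ℕ.z≤n))}}

Positive-ι : ∀ {z} → + 0 ℤ.< z → Positive (λ _ → ι z)
Positive-ι {z} h = ½ ℚ.* ι z , half>0 pos , 0 , λ _ _ → half< pos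
  where
  pos : 0ℚ ℚ.< ι z
  pos = ℚ.positive⁻¹ _ {{ι-pos h}}

module _ {h : ℤ³} {d>0 : + 0 ℤ.< proj₂ (proj₂ h)} where

  0≤·⇒0≤at : ∀ {φ} → + 0 ℤ.≤ φ · h → 0≤ φ at rational h d>0
  0≤·⇒0≤at {φ} k = ≥0 (NonNegative-*⁻¹ (ι (proj₂ (proj₂ h))) {{ι-pos d>0}}
    (NonNegative-cong (λ n → sym (value-rational φ h d>0 n)) (NonNegative-ι k)))

  0<·⇒0<at : ∀ {φ} → + 0 ℤ.< φ · h → 0< φ at rational h d>0
  0<·⇒0<at {φ} k = >0 (Positive-*⁻¹ (ι (proj₂ (proj₂ h))) {{ι-pos d>0}}
    (Positive-cong (λ n → sym (value-rational φ h d>0 n)) (Positive-ι k)))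

  0≤at⇒0≤· : ∀ {φ} → 0≤ φ at rational h d>0 → + 0 ℤ.≤ φ · h
  0≤at⇒0≤· {φ} (≥0 k) with + 0 ℤ.≤? φ · h
  ... | yes le = le
  ... | no ¬le = contradiction
    (NonNegative-cong (λ n → trans (value-rational φ h d>0 n) (trans (cong ι (sym (ℤ.neg-involutive (φ · h)))) (ι-neg (ℤ.- (φ · h)))))
      (NonNegative-* (ι (proj₂ (proj₂ h))) {{ι-pos d>0}} k))
    (Positive⇒¬NonNegative (Positive-ι (ℤ.neg-mono-< (ℤ.≰⇒> ¬le))))

-- Forms of one sign on a triangle

det-rotate : ∀ a b c → det b c a ≡ det a b c
det-rotate (a₁ , a₂) (b₁ , b₂) (c₁ , c₂) = lemma a₁ a₂ b₁ b₂ c₁ c₂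
  where
  open import Data.Integer.Base using (_+_; _*_; _-_)
  lemma : ∀ a₁ a₂ b₁ b₂ c₁ c₂ → (c₁ - b₁) * (a₂ - b₂) - (c₂ - b₂) * (a₁ - b₁) ≡ (b₁ - a₁) * (c₂ - a₂) - (b₂ - a₂) * (c₁ - a₁)
  lemma = solve-∀

det-start : ∀ a b → det a b a ≡ + 0
det-start (a₁ , a₂) (b₁ , b₂) = lemma a₁ a₂ b₁ b₂
  where
  open import Data.Integer.Base using (_+_; _*_; _-_)
  lemma : ∀ a₁ a₂ b₁ b₂ → (b₁ - a₁) * (a₂ - a₂) - (b₂ - a₂) * (a₁ - a₁) ≡ + 0
  lemma = solve-∀

det-end : ∀ a b → det a b b ≡ + 0
det-end a b = trans (det-rotate b a b) (det-start b a)

infix 4 0≤_on_ 0<_on_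

0≤_on_ 0<_on_ : ℤ³ → LatticePoint → Set
0≤ φ on v = + 0 ℤ.≤ φ · lift v
0< φ on v = + 0 ℤ.< φ · lift v

0≤form : ∀ {a b c} → + 0 ℤ.≤ det a b c → 0≤ form a b on c
0≤form {a} {b} {c} = subst (+ 0 ℤ.≤_) (sym (form-lift a b c))

0<form : ∀ {a b c} → + 0 ℤ.< det a b c → 0< form a b on c
0<form {a} {b} {c} = subst (+ 0 ℤ.<_) (sym (form-lift a b c))

0≤form-start : ∀ a b → 0≤ form a b on a
0≤form-start a b = 0≤form {a} {b} {a} (ℤ.≤-reflexive (sym (det-start a b)))

0≤form-end : ∀ a b → 0≤ form a b on b
0≤form-end a b = 0≤form {a} {b} {b} (ℤ.≤-reflexive (sym (det-end a b)))

⊕-comm : ∀ x y → x ⊕ y ≡ y ⊕ x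
⊕-comm (x , y , z) (x′ , y′ , z′) = cong₃ (ℤ.+-comm x x′) (ℤ.+-comm y y′) (ℤ.+-comm z z′)

module _ (T : LatticeTriangle) (p : Point) (φ : ℤ³) where
  open LatticeTriangle T using (a; b; c; counterclockwise)

  -- `cramer` writes a positive multiple of φ as a combination of the edge forms, with the values of
  -- φ at the corners as coefficients.
  closed-nonneg : All (0≤ φ on_) (corners T) → Closed T p → 0≤ φ at p
  closed-nonneg (ha ∷ hb ∷ hc ∷ []) (ab , bc , ca) = 0≤-⊛⁻¹ counterclockwise
    (subst (0≤_at p) (sym (cramer a b c φ))
      (0≤-⊕ (0≤-⊕ (0≤-⊛ ha (side⇒0≤ b c p bc)) (0≤-⊛ hb (side⇒0≤ c a p ca))) (0≤-⊛ hc (side⇒0≤ a b p ab))))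

  -- In the interior all three edge forms are positive, so a single positive coefficient in `cramer`
  -- is enough.
  interior-pos : All (0≤ φ on_) (corners T) → Any (0< φ on_) (corners T) → Interior T p → 0< φ at p
  interior-pos (ha ∷ hb ∷ hc ∷ []) some (ab , bc , ca) = 0<-⊛⁻¹ counterclockwise
    (subst (0<_at p) (sym (cramer a b c φ)) (go some))
    where
    α = φ · lift a ⊛ form b c
    β = φ · lift b ⊛ form c a
    γ = φ · lift c ⊛ form a b
    bc> = side⇒0< b c p bc
    ca> = side⇒0< c a p ca
    ab> = side⇒0< a b p ab
    α≥ : 0≤ α at p
    α≥ = 0≤-⊛ ha (0<⇒0≤ bc>)
    β≥ : 0≤ β at p
    β≥ = 0≤-⊛ hb (0<⇒0≤ ca>)
    γ≥ : 0≤ γ at p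
    γ≥ = 0≤-⊛ hc (0<⇒0≤ ab>)
    go : Any (0< φ on_) (corners T) → 0< α ⊕ β ⊕ γ at p
    go (here h)                 = 0<-⊕ (0<-⊕ (0<-⊛ h bc>) β≥) γ≥
    go (there (here h))         = 0<-⊕ (subst (0<_at p) (⊕-comm β α) (0<-⊕ (0<-⊛ h ca>) α≥)) γ≥
    go (there (there (here h))) = subst (0<_at p) (⊕-comm γ (α ⊕ β)) (0<-⊕ (0<-⊛ h ab>) (0≤-⊕ α≥ β≥))

-- Dissections of regions and their refinement

Disjoint : LatticeTriangle → LatticeTriangle → Set
Disjoint S T = ∀ p → ¬ (Interior S p × Interior T p)

Interior⇒Closed : ∀ T p → Interior T p → Closed T p
Interior⇒Closed T p (x , y , z) = Positive⇒NonNegative x , Positive⇒NonNegative y , Positive⇒NonNegative z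

-- The line of φ separates the triangles, and since S does not lie on it, the interior of S is
-- strictly on one side. The disjointness of newly constructed triangles is always shown by such a
-- line.
separated : ∀ S T φ → All (0≤ φ on_) (corners S) → Any (0< φ on_) (corners S) →
            All (0≤ ⊖ φ on_) (corners T) → Disjoint S T
separated S T φ S≥ S> T≤ p (iS , iT) =
  0<⇒¬0≤⊖ (interior-pos S p φ S≥ S> iS) (closed-nonneg T p (⊖ φ) T≤ (Interior⇒Closed T p iT))

Disjoint-sym : ∀ S T → Disjoint S T → Disjoint T S
Disjoint-sym S T d p (x , y) = d p (y , x)

-- A common form for dissections of the polygon, where I is `Anything`, and of a triangle, where I
-- is its interior. The field `inner` makes the pieces of disjoint triangles disjoint.
record Cuts (R I : Point → Set) (Ts : List LatticeTriangle) : Set where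
  field
    cover    : ∀ p → R p → ¬ ¬ Any (λ T → Closed T p) Ts
    within   : All (λ T → ∀ p → Closed T p → R p) Ts
    inner    : All (λ T → ∀ p → Interior T p → I p) Ts
    disjoint : AllPairs Disjoint Ts

open Cuts

Anything : Point → Set
Anything p = p ≡ p

Refined : (LatticeTriangle → Set) → (R I : Point → Set) → Set
Refined Q R I = ∃ λ Ts → Cuts R I Ts × All Q Ts

module _ {Q : LatticeTriangle → Set} where

  Pieces : LatticeTriangle → Set
  Pieces S = Refined Q (Closed S) (Interior S)

  pieces : ∀ {Ss} → All Pieces Ss → List LatticeTriangle
  pieces []             = []
  pieces ((Ts , _) ∷ rs) = Ts ++ pieces rs

  pieces-cover : ∀ {Ss} p (rs : All Pieces Ss) → Any (λ S → Closed S p) Ss → ¬ ¬ Any (λ T → Closed T p) (pieces rs)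
  pieces-cover p ((_ , c , _) ∷ rs)  (here x)  k = cover c p x λ a → k (Any.++⁺ˡ a)
  pieces-cover p ((Ts , _) ∷ rs) (there x) k = pieces-cover p rs x λ a → k (Any.++⁺ʳ Ts a)

  pieces-within : ∀ (R : Point → Set) {Ss} (rs : All Pieces Ss) → All (λ S → ∀ p → Closed S p → R p) Ss →
                  All (λ T → ∀ p → Closed T p → R p) (pieces rs)
  pieces-within R [] [] = []
  pieces-within R {S ∷ Ss} ((_ , c , _) ∷ rs) (h ∷ hs) = All.++⁺ (All.map (λ {T} → compose {T}) (within c)) (pieces-within R rs hs)
    where
    compose : ∀ {T} → (∀ p → Closed T p → Closed S p) → ∀ p → Closed T p → R p
    compose k p x = h p (k p x)

  pieces-inner : ∀ (I : Point → Set) {Ss} (rs : All Pieces Ss) → All (λ S → ∀ p → Interior S p → I p) Ss →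
                 All (λ T → ∀ p → Interior T p → I p) (pieces rs)
  pieces-inner I [] [] = []
  pieces-inner I {S ∷ Ss} ((_ , c , _) ∷ rs) (h ∷ hs) = All.++⁺ (All.map (λ {T} → compose {T}) (inner c)) (pieces-inner I rs hs)
    where
    compose : ∀ {T} → (∀ p → Interior T p → Interior S p) → ∀ p → Interior T p → I p
    compose k p x = h p (k p x)

  pieces-disjoint : ∀ {Ss} (rs : All Pieces Ss) → AllPairs Disjoint Ss → AllPairs Disjoint (pieces rs)
  pieces-disjoint [] [] = []
  pieces-disjoint {S ∷ Ss} ((_ , c , _) ∷ rs) (d ∷ ds) = AllPairs.++⁺ (disjoint c) (pieces-disjoint rs ds)
    (All.map (λ {T} → outside {T}) (inner {Closed S} {Interior S} c))
    where
    Outside : Point → Set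
    Outside p = ¬ Interior S p
    avoid : ∀ {S′} → Disjoint S S′ → ∀ p → Interior S′ p → Outside p
    avoid d p y x = d p (x , y)
    far : All (λ T′ → ∀ p → Interior T′ p → Outside p) (pieces rs)
    far = pieces-inner Outside rs (All.map (λ {S′} → avoid {S′}) d)
    apart : ∀ {T} → (∀ p → Interior T p → Interior S p) → ∀ {T′} → (∀ p → Interior T′ p → Outside p) → Disjoint T T′
    apart i j p (x , y) = j p y (i p x)
    outside : ∀ {T} → (∀ p → Interior T p → Interior S p) → All (Disjoint T) (pieces rs)
    outside {T} i = All.map (λ {T′} → apart {T} i {T′}) far

  pieces-Q : ∀ {Ss} (rs : All Pieces Ss) → All Q (pieces rs)
  pieces-Q []                 = []
  pieces-Q ((_ , _ , q) ∷ rs) = All.++⁺ q (pieces-Q rs)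

  cuts-refine : ∀ {R I Ss} → Cuts R I Ss → All Pieces Ss → Refined Q R I
  cuts-refine {R} {I} c rs = pieces rs , record
    { cover    = λ p r k → cover c p r λ any → pieces-cover p rs any k
    ; within   = pieces-within R rs (within c)
    ; inner    = pieces-inner I rs (inner c)
    ; disjoint = pieces-disjoint rs (disjoint c)
    } , pieces-Q rs

-- Nonnegativity is the negation of positivity of the opposite sequence. This is what leads from the
-- doubly negated cover back to `Region`.
0≤-stable : ∀ {φ p} → ¬ ¬ (0≤ φ at p) → 0≤ φ at p
0≤-stable {φ} {p} h = ≥0 (¬Positive⇒NonNegative (value-cauchy φ p) λ pos → h λ (≥0 n) →
  Positive⇒¬NonNegative pos (NonNegative-cong (λ m → sym (lemma (value φ p m))) n))
  where
  lemma : ∀ x → ℚ.- (ℚ.- x) ≡ x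
  lemma = solve 1 (λ x → :- (:- x) := x) refl

module _ {P : ConvexLatticePolygon} where

  dissects⇒cuts : ∀ {Ts} → Dissects P Ts → Cuts (Region P) Anything Ts
  dissects⇒cuts d = record
    { cover    = λ p → Equivalence.to (union p)
    ; within   = All.tabulate λ T∈ p x → Equivalence.from (union p) λ k → k (Any.map (λ { refl → x }) T∈)
    ; inner    = All.tabulate λ _ _ _ → refl
    ; disjoint = nonoverlapping
    }
    where open Dissects d

  cuts⇒dissects : ∀ {I Ts} → Cuts (Region P) I Ts → Dissects P Ts
  cuts⇒dissects c = record
    { union = λ p → mk⇔ (cover c p) λ h i → 0≤⇒side (vertex P i) (vertex P (next i)) p (0≤-stable λ k → h λ any →
        let (w , x) = All.lookupAny (within c) any in k (side⇒0≤ (vertex P i) (vertex P (next i)) p (w p x i)))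
    ; nonoverlapping = disjoint c
    }

-- Convex chains

-- The condition is imposed on all triples in list order, so that it passes to sublists and hence to
-- the two chains on either side of a triangle.
data Counterclockwise : List LatticePoint → Set where
  []  : Counterclockwise []
  _∷_ : ∀ {v vs} → AllPairs (λ x y → + 0 ℤ.< det v x y) vs → Counterclockwise vs → Counterclockwise (v ∷ vs)

ccw-lookup : ∀ {x y z vs} → Counterclockwise vs → x ∷ y ∷ z ∷ [] ⊆ vs → + 0 ℤ.< det x y z
ccw-lookup (_ ∷ c) (omit _ s) = ccw-lookup c s
ccw-lookup (ps ∷ _) (refl ∷ s) = pair ps s
  where
  pair : ∀ {A : Set} {R : A → A → Set} {x y zs} → AllPairs R zs → x ∷ y ∷ [] ⊆ zs → R x y
  pair (_ ∷ ps) (omit _ s) = pair ps s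
  pair (p ∷ _) (refl ∷ s) = All.lookup p (to∈ s)

ccw-⊆ : ∀ {us vs} → us ⊆ vs → Counterclockwise vs → Counterclockwise us
ccw-⊆ []         c        = c
ccw-⊆ (omit _ s)   (_ ∷ c)  = ccw-⊆ s c
ccw-⊆ (refl ∷ s) (ps ∷ c) = pairs s ps ∷ ccw-⊆ s c
  where
  pairs : ∀ {A : Set} {R : A → A → Set} {us vs} → us ⊆ vs → AllPairs R vs → AllPairs R us
  pairs []         ps       = ps
  pairs (omit _ s)   (_ ∷ ps) = pairs s ps
  pairs (refl ∷ s) (p ∷ ps) = All-resp-⊆ s p ∷ pairs s ps

module _ {a b z : LatticePoint} {ms ns : List LatticePoint} where

  private
    ws : List LatticePoint
    ws = a ∷ ((ms ++ b ∷ ns) ∷ʳ z)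
    e : ws ≡ a ∷ (ms ++ (b ∷ ns ++ z ∷ []))
    e = cong (a ∷_) (++-assoc ms (b ∷ ns) (z ∷ []))

  left-chain : a ∷ ms ∷ʳ b ⊆ a ∷ (ms ++ b ∷ ns) ∷ʳ z
  left-chain = subst (a ∷ ms ∷ʳ b ⊆_) (sym e) (refl ∷ ++⁺ (⊆-refl {x = ms}) (refl ∷ minimum (ns ++ z ∷ [])))

  right-chain : b ∷ ns ∷ʳ z ⊆ a ∷ (ms ++ b ∷ ns) ∷ʳ z
  right-chain = subst (b ∷ ns ∷ʳ z ⊆_) (sym e) (omit a (++⁺ (minimum ms) (⊆-refl {x = b ∷ ns ∷ʳ z})))

  apex : a ∷ b ∷ z ∷ [] ⊆ a ∷ (ms ++ b ∷ ns) ∷ʳ z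
  apex = subst (a ∷ b ∷ z ∷ [] ⊆_) (sym e) (refl ∷ ++⁺ (minimum ms) (refl ∷ ++⁺ (minimum ns) (⊆-refl {x = z ∷ []})))

  left-triple : ∀ {x} → x ∈ ms → a ∷ x ∷ b ∷ [] ⊆ a ∷ ms ∷ʳ b
  left-triple x∈ = refl ∷ ++⁺ (from∈ x∈) (⊆-refl {x = b ∷ []})

  right-triple : ∀ {y} → y ∈ ns ∷ʳ z → a ∷ b ∷ y ∷ [] ⊆ a ∷ (ms ++ b ∷ ns) ∷ʳ z
  right-triple {y} y∈ = subst (a ∷ b ∷ y ∷ [] ⊆_) (sym e) (refl ∷ ++⁺ (minimum ms) (refl ∷ from∈ y∈))

*-positive : ∀ {i j} → + 0 ℤ.< i → + 0 ℤ.< j → + 0 ℤ.< i ℤ.* j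
*-positive {+ suc m} {+ suc n} _ _ = ℤ.+<+ z<s
*-positive {+ 0} (ℤ.+<+ ()) _
*-positive {+ suc _} {+ 0} _ (ℤ.+<+ ())

*-nonneg : ∀ {i j} → + 0 ℤ.≤ i → + 0 ℤ.≤ j → + 0 ℤ.≤ i ℤ.* j
*-nonneg {+ m} {+ n} _ _ = subst (+ 0 ℤ.≤_) (ℤ.pos-* m n) (ℤ.+≤+ z≤n)

positive-cancel : ∀ {i j} → + 0 ℤ.< i → + 0 ℤ.< i ℤ.* j → + 0 ℤ.< j
positive-cancel {i@(+ suc _)} {j} _ h = ℤ.*-cancelˡ-<-nonNeg i (subst (ℤ._< i ℤ.* j) (sym (ℤ.*-zeroʳ i)) h)
positive-cancel {+ 0} (ℤ.+<+ ()) _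

module _ {V : Set} {R : V → V → Set} where

  Linked-left : ∀ {a} ms {b ns} → Linked R (a ∷ ms ++ b ∷ ns) → Linked R (a ∷ ms ∷ʳ b)
  Linked-left []       (r ∷ _)  = r ∷ [-]
  Linked-left (m ∷ ms) (r ∷ rs) = r ∷ Linked-left ms rs

  Linked-right : ∀ {a} ms {b ns} → Linked R (a ∷ ms ++ b ∷ ns) → Linked R (b ∷ ns)
  Linked-right []       (_ ∷ rs) = rs
  Linked-right (m ∷ ms) (_ ∷ rs) = Linked-right ms rs

  Linked-tabulate : ∀ {n} (f : Fin n → V) → (∀ i j → toℕ j ≡ suc (toℕ i) → R (f i) (f j)) → Linked R (tabulate f)
  Linked-tabulate {0} f h = []
  Linked-tabulate {1} f h = [-]
  Linked-tabulate {suc (suc n)} f h = h zero (suc zero) refl ∷ Linked-tabulate (f ∘ suc) λ i j e → h (suc i) (suc j) (cong suc e)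

ccwTriangle : ∀ a b c → + 0 ℤ.< det a b c → LatticeTriangle
ccwTriangle a b c h = record { a = a ; b = b ; c = c ; counterclockwise = h }

repeats⇒HasIntegerArea : ∀ a b c h → Repeats (colour a) (colour b) (colour c) → HasIntegerArea (ccwTriangle a b c h)
repeats⇒HasIntegerArea a b c h rep with repeats⇒even-det a b c rep
... | k , e = k , half≡integer _ k e

Triangles : ∀ {a ms z} → Triangulation colour a ms z → Counterclockwise (a ∷ ms ∷ʳ z) → List LatticeTriangle
Triangles edge _ = []
Triangles {a} (triangle {ms} {b} {ns} {z} s t _) c =
  ccwTriangle a b z (ccw-lookup c (apex {ms = ms})) ∷
  Triangles s (ccw-⊆ (left-chain {ms = ms}) c) ++ Triangles t (ccw-⊆ (right-chain {ms = ms}) c)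

Triangles-integer : ∀ {a ms z} (t : Triangulation colour a ms z) c → All HasIntegerArea (Triangles t c)
Triangles-integer edge c = []
Triangles-integer {a} (triangle {ms} {b} {ns} {z} s t rep) c =
  repeats⇒HasIntegerArea a b z (ccw-lookup c (apex {ms = ms})) rep ∷ All.++⁺ (Triangles-integer s _) (Triangles-integer t _)

Triangles-corners : ∀ {a ms z} (t : Triangulation colour a ms z) c →
                    All (λ T → All (_∈ a ∷ ms ∷ʳ z) (corners T)) (Triangles t c)
Triangles-corners edge c = []
Triangles-corners {a} (triangle {ms} {b} {ns} {z} s t _) c =
  All.tabulate (⊆-lookup (apex {ms = ms} {ns = ns})) ∷
  All.++⁺ (All.map (All.map (⊆-lookup (left-chain {ms = ms} {ns = ns}))) (Triangles-corners s _))
          (All.map (All.map (⊆-lookup (right-chain {a = a} {ms = ms} {ns = ns}))) (Triangles-corners t _))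

-- A middle vertex lies strictly off the base, which provides the strict inequality that `separated`
-- asks for.
Triangles-apex : ∀ {a ms z} (t : Triangulation colour a ms z) c →
                 All (λ T → LatticeTriangle.b T ∈ ms) (Triangles t c)
Triangles-apex edge c = []
Triangles-apex (triangle {ms = ms} s t _) c = ∈-++⁺ʳ ms (here refl) ∷
  All.++⁺ (All.map ∈-++⁺ˡ (Triangles-apex s _)) (All.map (λ h → ∈-++⁺ʳ ms (there h)) (Triangles-apex t _))

module _ {p : Point} where

  Beyond : LatticePoint → LatticePoint → Set
  Beyond x y = 0≤ form x y at p

  beyond-total : ∀ x y → ¬ ¬ (Beyond x y ⊎ Beyond y x)
  beyond-total x y k = 0≤-total (form x y) λ
    { (inj₁ h) → k (inj₁ h) ; (inj₂ h) → k (inj₂ (subst (0≤_at p) (sym (form-sym x y)) h)) }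

  Linked-split : ∀ {a} ms {b ns z} → Linked Beyond (a ∷ (ms ++ b ∷ ns) ∷ʳ z) →
                 Linked Beyond (a ∷ ms ∷ʳ b) × Linked Beyond (b ∷ ns ∷ʳ z)
  Linked-split {a} ms {b} {ns} {z} l = Linked-left ms l′ , Linked-right ms l′
    where l′ = subst (λ xs → Linked Beyond (a ∷ xs)) (++-assoc ms (b ∷ ns) (z ∷ [])) l

  -- A point to the left of all edges of the chain that both subchains miss is to the left of the
  -- chords a b and b z; its side of the base then decides whether it lies in the root triangle or
  -- leaves through the base.
  cover-or-beyond : ∀ {a ms z} (t : Triangulation colour a ms z) c → Linked Beyond (a ∷ ms ∷ʳ z) →
                    ¬ ¬ (Any (λ T → Closed T p) (Triangles t c) ⊎ Beyond a z)
  cover-or-beyond edge c (r ∷ _) k = k (inj₂ r)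
  cover-or-beyond {a} (triangle {ms} {b} {ns} {z} s t _) c l k with Linked-split ms l
  ... | ls , lt = cover-or-beyond s _ ls λ
    { (inj₁ h)  → k (inj₁ (there (Any.++⁺ˡ h)))
    ; (inj₂ ab) → cover-or-beyond t _ lt λ
      { (inj₁ h)  → k (inj₁ (there (Any.++⁺ʳ (Triangles s _) h)))
      ; (inj₂ bz) → beyond-total z a λ
        { (inj₁ za) → k (inj₁ (here (0≤⇒side a b p ab , 0≤⇒side b z p bz , 0≤⇒side z a p za)))
        ; (inj₂ az) → k (inj₂ az) } } }

  Triangles-cover : ∀ {a ms z} (t : Triangulation colour a ms z) c → ms ≢ [] →
                    Linked Beyond (a ∷ ms ∷ʳ z) → Beyond z a → ¬ ¬ Any (λ T → Closed T p) (Triangles t c)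
  Triangles-cover edge c ne _ _ _ = ne refl
  Triangles-cover {a} (triangle {ms} {b} {ns} {z} s t _) c _ l za k with Linked-split ms l
  ... | ls , lt = cover-or-beyond s _ ls λ
    { (inj₁ h)  → k (there (Any.++⁺ˡ h))
    ; (inj₂ ab) → cover-or-beyond t _ lt λ
      { (inj₁ h)  → k (there (Any.++⁺ʳ (Triangles s _) h))
      ; (inj₂ bz) → k (here (0≤⇒side a b p ab , 0≤⇒side b z p bz , 0≤⇒side z a p za)) } }

chain-above : ∀ {a ms z} → Counterclockwise (a ∷ ms ∷ʳ z) → ∀ {x} → x ∈ ms → 0< form z a on x
chain-above {a} {ms} {z} c {x} x∈ = 0<form {z} {a} {x}
  (subst (+ 0 ℤ.<_) (det-rotate z a x) (ccw-lookup c (left-triple {z = z} {ns = []} x∈)))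

chain-above-all : ∀ {a ms z} → Counterclockwise (a ∷ ms ∷ʳ z) → ∀ {x} → x ∈ a ∷ ms ∷ʳ z → 0≤ form z a on x
chain-above-all {a} {ms} {z} c (here refl) = 0≤form-end z a
chain-above-all {a} {ms} {z} c (there x∈) with ∈-++⁻ ms x∈
... | inj₁ h           = ℤ.<⇒≤ (chain-above c h)
... | inj₂ (here refl) = 0≤form-start z a

Triangles-above : ∀ {a ms z} (t : Triangulation colour a ms z) c →
                  All (λ T → All (0≤ form z a on_) (corners T) × Any (0< form z a on_) (corners T)) (Triangles t c)
Triangles-above t c = All.zipWith
  (λ (cs , b∈) → All.map (chain-above-all c) cs , there (here (chain-above c b∈)))
  (Triangles-corners t c , Triangles-apex t c)

-- The chord a b separates the left subchain from the root triangle and from the right subchain; the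
-- chord b z separates the right subchain from the root.
Triangles-disjoint : ∀ {a ms z} (t : Triangulation colour a ms z) c → AllPairs Disjoint (Triangles t c)
Triangles-disjoint edge c = []
Triangles-disjoint {a} (triangle {ms} {b} {ns} {z} s t _) c =
  All.++⁺ (All.map (λ {S} (S≥ , S>) → Disjoint-sym S T (separated S T (form b a) S≥ S> T≤ab)) (Triangles-above s cs))
          (All.map (λ {S} (S≥ , S>) → Disjoint-sym S T (separated S T (form z b) S≥ S> T≤bz)) (Triangles-above t ct)) ∷
  AllPairs.++⁺ (Triangles-disjoint s cs) (Triangles-disjoint t ct)
    (All.map (λ {S} (S≥ , S>) → All.map (λ {S′} S′∈ → separated S S′ (form b a) S≥ S> (All.map beyond-ab S′∈))
       (Triangles-corners t ct)) (Triangles-above s cs))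
  where
  cs = ccw-⊆ (left-chain {ms = ms}) c
  ct = ccw-⊆ (right-chain {ms = ms}) c
  abz : + 0 ℤ.< det a b z
  abz = ccw-lookup c (apex {ms = ms})
  T : LatticeTriangle
  T = ccwTriangle a b z abz
  opposite : ∀ x y {v} → 0≤ form x y on v → 0≤ ⊖ form y x on v
  opposite x y {v} = subst (λ φ → 0≤ φ on v) (form-sym y x)
  T≤ab : All (0≤ ⊖ form b a on_) (corners T)
  T≤ab = opposite a b (0≤form-start a b) ∷ opposite a b (0≤form-end a b) ∷
         opposite a b (ℤ.<⇒≤ (0<form {a} {b} {z} abz)) ∷ []
  T≤bz : All (0≤ ⊖ form z b on_) (corners T)
  T≤bz = opposite b z (ℤ.<⇒≤ (0<form {b} {z} {a} (subst (+ 0 ℤ.<_) (sym (det-rotate a b z)) abz))) ∷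
         opposite b z (0≤form-start b z) ∷ opposite b z (0≤form-end b z) ∷ []
  beyond-ab : ∀ {y} → y ∈ b ∷ ns ∷ʳ z → 0≤ ⊖ form b a on y
  beyond-ab (here refl) = opposite a b (0≤form-end a b)
  beyond-ab {y} (there y∈) = opposite a b (ℤ.<⇒≤ (0<form {a} {b} {y} (ccw-lookup c (right-triple {ms = ms} y∈))))

-- Convex polygons

-- The Plücker relation between the 2 × 2 minors of the vectors from o to e, x, y and z.
plücker : ∀ o e x y z → det o e y ℤ.* det o x z ≡ det o e x ℤ.* det o y z ℤ.+ det o e z ℤ.* det o x y
plücker (o₁ , o₂) (e₁ , e₂) (x₁ , x₂) (y₁ , y₂) (z₁ , z₂) =
  lemma (e₁ ℤ.- o₁) (e₂ ℤ.- o₂) (x₁ ℤ.- o₁) (x₂ ℤ.- o₂) (y₁ ℤ.- o₁) (y₂ ℤ.- o₂) (z₁ ℤ.- o₁) (z₂ ℤ.- o₂)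
  where
  open import Data.Integer.Base using (_+_; _*_; _-_)
  lemma : ∀ e₁ e₂ x₁ x₂ y₁ y₂ z₁ z₂ → (e₁ * y₂ - e₂ * y₁) * (x₁ * z₂ - x₂ * z₁) ≡
    (e₁ * x₂ - e₂ * x₁) * (y₁ * z₂ - y₂ * z₁) + (e₁ * z₂ - e₂ * z₁) * (x₁ * y₂ - x₂ * y₁)
  lemma = solve-∀

module _ (P : ConvexLatticePolygon) where

  private
    n = size P
    v = vertex P

    0<rotate : ∀ {a b c} → + 0 ℤ.< det a b c → + 0 ℤ.< det c a b
    0<rotate {a} {b} {c} = subst (+ 0 ℤ.<_) (det-rotate c a b)

  -- The field `convex` speaks only of triples that contain an edge. The induction is on the number
  -- d of vertices between j and k: with the predecessor k′ of k and e = `next i`, `plücker` reduces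
  -- the triple i j k to i k′ k, which contains an edge, and to i j k′.
  vertices-ccw′ : ∀ d (i j k : Fin n) → toℕ i ℕ.< toℕ j → toℕ k ≡ suc (d ℕ.+ toℕ j) → + 0 ℤ.< det (v i) (v j) (v k)
  vertices-ccw′ zero i j k i<j e = 0<rotate {v j} {v k} {v i} (subst (λ m → + 0 ℤ.< det (v j) (v m) (v i)) next≡
    (convex P j i (λ { refl → ℕ.<-irrefl refl i<j })
                  (λ e′ → ℕ.<-asym i<j (subst (toℕ j ℕ.<_) (sym (trans (cong toℕ (trans e′ next≡)) e)) (ℕ.n<1+n _)))))
    where
    next≡ : next j ≡ k
    next≡ = toℕ-injective (trans (toℕ-next j (subst (ℕ._< n) e (toℕ<n k))) (sym e))
  vertices-ccw′ (suc d) i j k i<j e = positive-cancel (edge-pos k′ i<k′)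
    (subst (+ 0 ℤ.<_) (sym (plücker (v i) (v (next i)) (v j) (v k′) (v k)))
      (ℤ.+-mono-≤-< (*-nonneg edge-j (ℤ.<⇒≤ (vertices-ccw′ zero i k′ k (ℕ.<-trans (ℕ.n<1+n _) i<k′) k≡)))
                    (*-positive (edge-pos k (ℕ.<-trans i<k′ k′<k)) (vertices-ccw′ d i j k′ i<j k′≡))))
    where
    k′ : Fin n
    k′ = fromℕ< (ℕ.<-trans (ℕ.n<1+n _) (subst (ℕ._< n) e (toℕ<n k)))
    k′≡ : toℕ k′ ≡ suc (d ℕ.+ toℕ j)
    k′≡ = toℕ-fromℕ< _
    k≡ : toℕ k ≡ suc (toℕ k′)
    k≡ = trans e (cong suc (sym k′≡))
    k′<k : toℕ k′ ℕ.< toℕ k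
    k′<k = subst (toℕ k′ ℕ.<_) (sym k≡) (ℕ.n<1+n _)
    i<k′ : suc (toℕ i) ℕ.< toℕ k′
    i<k′ = subst (suc (toℕ i) ℕ.<_) (sym k′≡) (s≤s (ℕ.≤-trans i<j (ℕ.m≤n+m (toℕ j) d)))
    next-i : toℕ (next i) ≡ suc (toℕ i)
    next-i = toℕ-next i (ℕ.≤-<-trans i<j (toℕ<n j))
    edge-pos : ∀ m → suc (toℕ i) ℕ.< toℕ m → + 0 ℤ.< det (v i) (v (next i)) (v m)
    edge-pos m h = convex P i m (λ { refl → ℕ.<-irrefl refl (ℕ.<-trans (ℕ.n<1+n _) h) })
      (λ e′ → ℕ.<-irrefl (sym (trans (cong toℕ e′) next-i)) h)
    -- If j is `next i` this determinant vanishes, hence the weak inequality; the other summand is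
    -- the positive one.
    edge-j : + 0 ℤ.≤ det (v i) (v (next i)) (v j)
    edge-j with ℕ.m≤n⇒m<n∨m≡n i<j
    ... | inj₁ h = ℤ.<⇒≤ (edge-pos j h)
    ... | inj₂ h = ℤ.≤-reflexive (sym (subst (λ m → det (v i) (v m) (v j) ≡ + 0)
                     (toℕ-injective (trans (sym h) (sym next-i))) (det-end (v i) (v j))))

  vertices-ccw : ∀ (i j k : Fin n) → toℕ i ℕ.< toℕ j → toℕ j ℕ.< toℕ k → + 0 ℤ.< det (v i) (v j) (v k)
  vertices-ccw i j k i<j j<k = vertices-ccw′ (toℕ k ℕ.∸ suc (toℕ j)) i j k i<j
    (sym (trans (sym (ℕ.+-suc _ (toℕ j))) (ℕ.m∸n+n≡m j<k)))

ccw-tabulate : ∀ {n} (f : Fin n → LatticePoint) →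
               (∀ i j k → toℕ i ℕ.< toℕ j → toℕ j ℕ.< toℕ k → + 0 ℤ.< det (f i) (f j) (f k)) →
               Counterclockwise (tabulate f)
ccw-tabulate {zero}  f h = []
ccw-tabulate {suc n} f h = AllPairs.tabulate⁺-< (λ {i} {j} i<j → h zero (suc i) (suc j) z<s (s≤s i<j)) ∷
  ccw-tabulate (f ∘ suc) λ i j k i<j j<k → h (suc i) (suc j) (suc k) (s≤s i<j) (s≤s j<k)

tabulate-last : ∀ {A : Set} {n} (f : Fin (suc n) → A) {xs z} → tabulate f ≡ xs ∷ʳ z → z ≡ f (fromℕ n)
tabulate-last {n = zero}  f {[]} refl = refl
tabulate-last {n = zero}  f {_ ∷ []} ()
tabulate-last {n = zero}  f {_ ∷ _ ∷ _} ()
tabulate-last {n = suc n} f {[]} ()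
tabulate-last {n = suc n} f {x ∷ xs} e = tabulate-last (f ∘ suc) (proj₂ (∷-injective e))

vertex-nonneg : ∀ P i {x} → x ∈ vertices P → 0≤ form (vertex P i) (vertex P (next i)) on x
vertex-nonneg P i x∈ with ∈-tabulate⁻ x∈
... | j , refl with j Fin.≟ i | j Fin.≟ next i
... | yes refl | _        = 0≤form-start (vertex P j) (vertex P (next j))
... | no _     | yes refl = 0≤form-end (vertex P i) (vertex P (next i))
... | no p     | no q     = ℤ.<⇒≤ (0<form {vertex P i} {vertex P (next i)} {vertex P j} (convex P i j p q))

triangulated⇒dissectable : ∀ P → Triangulated {f = colour} (vertices P) → DiagonallyDissectableInto HasIntegerArea P
triangulated⇒dissectable P T = go T refl
  where
  c = ccw-tabulate (vertex P) (vertices-ccw P)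
  length≥3 : ∀ {n} (f : Fin n → LatticePoint) {xs} → 3 ℕ.≤ n → xs ≡ tabulate f → 3 ℕ.≤ length xs
  length≥3 f 3≤n refl = subst (3 ℕ.≤_) (sym (length-tabulate f)) 3≤n
    where open import Data.List.Properties using (length-tabulate)
  go : ∀ {xs} → Triangulated {f = colour} xs → xs ≡ vertices P → DiagonallyDissectableInto HasIntegerArea P
  go point e with length≥3 (vertex P) (3≤size P) e
  ... | s≤s ()
  go (chain {a} {ms} {z} t) e =
    Triangles t c′ , cuts⇒dissects {P} {Anything} cuts ,
    subst (λ xs → All (λ T → All (_∈ xs) (corners T)) (Triangles t c′)) e (Triangles-corners t c′) ,
    Triangles-integer t c′
    where
    c′ : Counterclockwise (a ∷ ms ∷ʳ z)
    c′ = subst Counterclockwise (sym e) c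
    ms≢[] : ms ≢ []
    ms≢[] refl with length≥3 (vertex P) (3≤size P) e
    ... | s≤s (s≤s ())
    edges : ∀ {n} (f : Fin n → LatticePoint) p → (∀ i → 0≤ form (f i) (f (next i)) at p) →
            a ∷ ms ∷ʳ z ≡ tabulate f → Linked (λ x y → 0≤ form x y at p) (a ∷ ms ∷ʳ z) × 0≤ form z a at p
    edges {suc n} f p h e′ =
      subst (Linked _) (sym e′) (Linked-tabulate f λ i j j≡ →
        subst (λ k → 0≤ form (f i) (f k) at p) (toℕ-injective (trans (toℕ-next i (subst (ℕ._< suc n) j≡ (toℕ<n j))) (sym j≡))) (h i)) ,
      subst₂ (λ x y → 0≤ form x y at p) (sym (tabulate-last f {a ∷ ms} (sym e′)))
        (trans (cong f (toℕ-injective (toℕ-next-last (fromℕ n) (cong suc (toℕ-fromℕ n))))) (sym (proj₁ (∷-injective e′))))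
        (h (fromℕ n))
    cuts : Cuts (Region P) Anything (Triangles t c′)
    cuts = record
      { cover    = λ p r → let (l , za) = edges (vertex P) p (λ i → side⇒0≤ (vertex P i) (vertex P (next i)) p (r i)) e
                           in Triangles-cover t c′ ms≢[] l za
      ; within   = All.map (λ {T} cs p x i → 0≤⇒side (vertex P i) (vertex P (next i)) p
                     (closed-nonneg T p _ (All.map (λ x∈ → vertex-nonneg P i (subst (_ ∈_) e x∈)) cs) x)) (Triangles-corners t c′)
      ; inner    = All.tabulate λ _ _ _ → refl
      ; disjoint = Triangles-disjoint t c′
      }

-- Subdividing a triangle at a lattice point

-- The doubled signed areas of the three triangles at z are barycentric coordinates
-- of z, and form x y is linear in x and in y.

barycentric : ∀ a b c x z → det a b c ⊛ form z x ≡
              det b c z ⊛ form a x ⊕ det c a z ⊛ form b x ⊕ det a b z ⊛ form c x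
barycentric (a₁ , a₂) (b₁ , b₂) (c₁ , c₂) (x₁ , x₂) (z₁ , z₂) =
  cong₃ (p a₁ a₂ b₁ b₂ c₁ c₂ x₁ x₂ z₁ z₂) (q a₁ a₂ b₁ b₂ c₁ c₂ x₁ x₂ z₁ z₂) (r a₁ a₂ b₁ b₂ c₁ c₂ x₁ x₂ z₁ z₂)
  where
  open import Data.Integer.Base using (_+_; _*_; _-_)
  p : ∀ a₁ a₂ b₁ b₂ c₁ c₂ x₁ x₂ z₁ z₂ → ((b₁ - a₁) * (c₂ - a₂) - (b₂ - a₂) * (c₁ - a₁)) * (z₂ - x₂) ≡
      ((c₁ - b₁) * (z₂ - b₂) - (c₂ - b₂) * (z₁ - b₁)) * (a₂ - x₂) +
      ((a₁ - c₁) * (z₂ - c₂) - (a₂ - c₂) * (z₁ - c₁)) * (b₂ - x₂) +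
      ((b₁ - a₁) * (z₂ - a₂) - (b₂ - a₂) * (z₁ - a₁)) * (c₂ - x₂)
  p = solve-∀
  q : ∀ a₁ a₂ b₁ b₂ c₁ c₂ x₁ x₂ z₁ z₂ → ((b₁ - a₁) * (c₂ - a₂) - (b₂ - a₂) * (c₁ - a₁)) * (x₁ - z₁) ≡
      ((c₁ - b₁) * (z₂ - b₂) - (c₂ - b₂) * (z₁ - b₁)) * (x₁ - a₁) +
      ((a₁ - c₁) * (z₂ - c₂) - (a₂ - c₂) * (z₁ - c₁)) * (x₁ - b₁) +
      ((b₁ - a₁) * (z₂ - a₂) - (b₂ - a₂) * (z₁ - a₁)) * (x₁ - c₁)
  q = solve-∀
  r : ∀ a₁ a₂ b₁ b₂ c₁ c₂ x₁ x₂ z₁ z₂ → ((b₁ - a₁) * (c₂ - a₂) - (b₂ - a₂) * (c₁ - a₁)) * (z₁ * x₂ - z₂ * x₁) ≡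
      ((c₁ - b₁) * (z₂ - b₂) - (c₂ - b₂) * (z₁ - b₁)) * (a₁ * x₂ - a₂ * x₁) +
      ((a₁ - c₁) * (z₂ - c₂) - (a₂ - c₂) * (z₁ - c₁)) * (b₁ * x₂ - b₂ * x₁) +
      ((b₁ - a₁) * (z₂ - a₂) - (b₂ - a₂) * (z₁ - a₁)) * (c₁ * x₂ - c₂ * x₁)
  r = solve-∀

-- The relation `barycentric` at x = z, where its left side vanishes. If z is inside the triangle,
-- the sides of p at two of the spokes through z can thus determine its side at the third.
balanced : ∀ a b c z → det b c z ⊛ form a z ≡ det c a z ⊛ form z b ⊕ det a b z ⊛ form z c
balanced (a₁ , a₂) (b₁ , b₂) (c₁ , c₂) (z₁ , z₂) =
  cong₃ (p a₁ a₂ b₁ b₂ c₁ c₂ z₁ z₂) (q a₁ a₂ b₁ b₂ c₁ c₂ z₁ z₂) (r a₁ a₂ b₁ b₂ c₁ c₂ z₁ z₂)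
  where
  open import Data.Integer.Base using (_+_; _*_; _-_)
  p : ∀ a₁ a₂ b₁ b₂ c₁ c₂ z₁ z₂ → ((c₁ - b₁) * (z₂ - b₂) - (c₂ - b₂) * (z₁ - b₁)) * (a₂ - z₂) ≡
      ((a₁ - c₁) * (z₂ - c₂) - (a₂ - c₂) * (z₁ - c₁)) * (z₂ - b₂) +
      ((b₁ - a₁) * (z₂ - a₂) - (b₂ - a₂) * (z₁ - a₁)) * (z₂ - c₂)
  p = solve-∀
  q : ∀ a₁ a₂ b₁ b₂ c₁ c₂ z₁ z₂ → ((c₁ - b₁) * (z₂ - b₂) - (c₂ - b₂) * (z₁ - b₁)) * (z₁ - a₁) ≡
      ((a₁ - c₁) * (z₂ - c₂) - (a₂ - c₂) * (z₁ - c₁)) * (b₁ - z₁) +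
      ((b₁ - a₁) * (z₂ - a₂) - (b₂ - a₂) * (z₁ - a₁)) * (c₁ - z₁)
  q = solve-∀
  r : ∀ a₁ a₂ b₁ b₂ c₁ c₂ z₁ z₂ → ((c₁ - b₁) * (z₂ - b₂) - (c₂ - b₂) * (z₁ - b₁)) * (a₁ * z₂ - a₂ * z₁) ≡
      ((a₁ - c₁) * (z₂ - c₂) - (a₂ - c₂) * (z₁ - c₁)) * (z₁ * b₂ - z₂ * b₁) +
      ((b₁ - a₁) * (z₂ - a₂) - (b₂ - a₂) * (z₁ - a₁)) * (z₁ * c₂ - z₂ * c₁)
  r = solve-∀

balanced′ : ∀ a b c z → det b c z ⊛ form z a ≡ det c a z ⊛ form b z ⊕ det a b z ⊛ form c z
balanced′ a b c z = begin
  det b c z ⊛ form z a           ≡⟨ cong (det b c z ⊛_) (form-sym a z) ⟩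
  det b c z ⊛ (⊖ form a z)       ≡⟨ ⊛-⊖ (det b c z) (form a z) ⟩
  ⊖ (det b c z ⊛ form a z)       ≡⟨ cong ⊖_ (balanced a b c z) ⟩
  ⊖ (det c a z ⊛ form z b ⊕ det a b z ⊛ form z c)
    ≡⟨ ⊖-⊕ (det c a z ⊛ form z b) (det a b z ⊛ form z c) ⟩
  ⊖ (det c a z ⊛ form z b) ⊕ ⊖ (det a b z ⊛ form z c)
    ≡⟨ cong₂ _⊕_ (sym (trans (cong (det c a z ⊛_) (form-sym z b)) (⊛-⊖ (det c a z) (form z b))))
                 (sym (trans (cong (det a b z ⊛_) (form-sym z c)) (⊛-⊖ (det a b z) (form z c)))) ⟩
  det c a z ⊛ form b z ⊕ det a b z ⊛ form c z ∎
  where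
  open ≡-Reasoning
  ⊛-⊖ : ∀ k φ → k ⊛ (⊖ φ) ≡ ⊖ (k ⊛ φ)
  ⊛-⊖ k (x , y , z) = cong₃ (sym (ℤ.neg-distribʳ-* k x)) (sym (ℤ.neg-distribʳ-* k y)) (sym (ℤ.neg-distribʳ-* k z))
  ⊖-⊕ : ∀ φ ψ → ⊖ (φ ⊕ ψ) ≡ ⊖ φ ⊕ ⊖ ψ
  ⊖-⊕ (x , y , z) (x′ , y′ , z′) = cong₃ (ℤ.neg-distrib-+ x x′) (ℤ.neg-distrib-+ y y′) (ℤ.neg-distrib-+ z z′)

form-refl : ∀ b → form b b ≡ + 0 ⊛ form b b
form-refl (x , y) = cong₃ (ℤ.+-inverseʳ y) (ℤ.+-inverseʳ x) (trans (cong (λ m → x ℤ.* y ℤ.- m) (ℤ.*-comm y x)) (ℤ.+-inverseʳ (x ℤ.* y)))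

det-total : ∀ a b c z → det b c z ℤ.+ det c a z ℤ.+ det a b z ≡ det a b c
det-total (a₁ , a₂) (b₁ , b₂) (c₁ , c₂) (z₁ , z₂) = lemma a₁ a₂ b₁ b₂ c₁ c₂ z₁ z₂
  where
  open import Data.Integer.Base using (_+_; _*_; _-_)
  lemma : ∀ a₁ a₂ b₁ b₂ c₁ c₂ z₁ z₂ →
      ((c₁ - b₁) * (z₂ - b₂) - (c₂ - b₂) * (z₁ - b₁)) +
      ((a₁ - c₁) * (z₂ - c₂) - (a₂ - c₂) * (z₁ - c₁)) +
      ((b₁ - a₁) * (z₂ - a₂) - (b₂ - a₂) * (z₁ - a₁)) ≡ (b₁ - a₁) * (c₂ - a₂) - (b₂ - a₂) * (c₁ - a₁)
  lemma = solve-∀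

0<-rotate : ∀ a b c → + 0 ℤ.< det a b c → + 0 ℤ.< det b c a
0<-rotate a b c = subst (+ 0 ℤ.<_) (sym (det-rotate a b c))

module _ (a b c : LatticePoint) (abc : + 0 ℤ.< det a b c) where

  private
    T = ccwTriangle a b c abc

    T′ = ccwTriangle b c a (0<-rotate a b c abc)

    unrotate : ∀ p → Closed T′ p → Closed T p
    unrotate p (bc , ca , ab) = ab , bc , ca
    unrotate° : ∀ p → Interior T′ p → Interior T p
    unrotate° p (bc , ca , ab) = ab , bc , ca

  cuts-rotate : ∀ {Ts} → Cuts (Closed T′) (Interior T′) Ts → Cuts (Closed T) (Interior T) Ts
  cuts-rotate cs = record
    { cover    = λ p (ab , bc , ca) → cover cs p (bc , ca , ab)
    ; within   = All.map (λ h p x → unrotate p (h p x)) (within {Closed T′} {Interior T′} cs)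
    ; inner    = All.map (λ h p x → unrotate° p (h p x)) (inner {Closed T′} {Interior T′} cs)
    ; disjoint = disjoint cs
    }

  module _ (z : LatticePoint) (bcz : + 0 ℤ.≤ det b c z) (caz : + 0 ℤ.≤ det c a z) (abz : + 0 ℤ.< det a b z) where

    private
      S = ccwTriangle a b z abz
      on-ab : All (0≤ form a b on_) (corners S)
      on-ab = 0≤form-start a b ∷ 0≤form-end a b ∷ 0≤form {a} {b} {z} (ℤ.<⇒≤ abz) ∷ []
      on-bc : All (0≤ form b c on_) (corners S)
      on-bc = 0≤form {b} {c} {a} (ℤ.<⇒≤ (0<-rotate a b c abc)) ∷ 0≤form-start b c ∷ 0≤form {b} {c} {z} bcz ∷ []
      on-ca : All (0≤ form c a on_) (corners S)
      on-ca = 0≤form-end c a ∷ 0≤form {c} {a} {b} (ℤ.<⇒≤ (0<-rotate b c a (0<-rotate a b c abc))) ∷ 0≤form {c} {a} {z} caz ∷ []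

    piece-closed : ∀ p → Closed S p → Closed T p
    piece-closed p x = 0≤⇒side a b p (closed-nonneg S p (form a b) on-ab x) ,
                       0≤⇒side b c p (closed-nonneg S p (form b c) on-bc x) ,
                       0≤⇒side c a p (closed-nonneg S p (form c a) on-ca x)

    piece-interior : ∀ p → Interior S p → Interior T p
    piece-interior p x =
      0<⇒side a b p (interior-pos S p (form a b) on-ab (there (there (here (0<form {a} {b} {z} abz)))) x) ,
      0<⇒side b c p (interior-pos S p (form b c) on-bc (here (0<form {b} {c} {a} (0<-rotate a b c abc))) x) ,
      0<⇒side c a p (interior-pos S p (form c a) on-ca (there (here (0<form {c} {a} {b} (0<-rotate b c a (0<-rotate a b c abc))))) x)

adjacent-disjoint : ∀ a b c z abz bcz → Disjoint (ccwTriangle a b z abz) (ccwTriangle b c z bcz)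
adjacent-disjoint a b c z abz bcz = separated S T (form b z)
  (0≤form {b} {z} {a} (ℤ.<⇒≤ bza) ∷ 0≤form-start b z ∷ 0≤form-end b z ∷ []) (here (0<form {b} {z} {a} bza))
  (flip (0≤form-end z b) ∷ flip {c} (0≤form {z} {b} {c} (ℤ.<⇒≤ (0<-rotate c z b (0<-rotate b c z bcz)))) ∷ flip (0≤form-start z b) ∷ [])
  where
  S = ccwTriangle a b z abz
  T = ccwTriangle b c z bcz
  bza = 0<-rotate a b z abz
  flip : ∀ {v} → 0≤ form z b on v → 0≤ ⊖ form b z on v
  flip {v} = subst (λ φ → 0≤ φ on v) (form-sym b z)

private
  0≤-zero : ∀ {p} φ → 0≤ + 0 ⊛ φ at p
  0≤-zero {p} φ = 0≤-stable λ k → 0≤-total φ λ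
    { (inj₁ h) → k (0≤-⊛ {k = + 0} (ℤ.+≤+ z≤n) h)
    ; (inj₂ h) → k (subst (0≤_at p) (zero-⊖ φ) (0≤-⊛ {k = + 0} (ℤ.+≤+ z≤n) h)) }
    where
    zero-⊖ : ∀ φ → + 0 ⊛ (⊖ φ) ≡ + 0 ⊛ φ
    zero-⊖ (x , y , z) = refl

module _ (a b c z : LatticePoint) (abc : + 0 ℤ.< det a b c)
         (bcz : + 0 ℤ.< det b c z) (caz : + 0 ℤ.< det c a z) where

  private
    T = ccwTriangle a b c abc
    bca = 0<-rotate a b c abc
    cab = 0<-rotate b c a bca
    T₁ = ccwTriangle b c z bcz
    T₂ = ccwTriangle c a z caz

  -- Here z lies between a and b, so `form z b` and `form a z` are, up to positive factors,
  -- `form a b`; the side of p at the spoke c z chooses the piece.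
  split₂ : det a b z ≡ + 0 → Cuts (Closed T) (Interior T) (T₁ ∷ T₂ ∷ [])
  split₂ abz = record
    { cover = λ p (ab , bc , ca) k → beyond-total c z λ
      { (inj₁ cz) → k (here (bc , 0≤⇒side c z p cz , 0≤⇒side z b p (zb p (side⇒0≤ a b p ab))))
      ; (inj₂ zc) → k (there (here (ca , 0≤⇒side a z p (az p (side⇒0≤ a b p ab)) , 0≤⇒side z c p zc))) }
    ; within = (λ p x → let (bc , ca , ab) = piece-closed b c a bca z (ℤ.<⇒≤ caz) abz≥0 bcz p x in ab , bc , ca) ∷
               (λ p x → let (ca , ab , bc) = piece-closed c a b cab z abz≥0 (ℤ.<⇒≤ bcz) caz p x in ab , bc , ca) ∷ []
    ; inner  = (λ p x → let (bc , ca , ab) = piece-interior b c a bca z (ℤ.<⇒≤ caz) abz≥0 bcz p x in ab , bc , ca) ∷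
               (λ p x → let (ca , ab , bc) = piece-interior c a b cab z abz≥0 (ℤ.<⇒≤ bcz) caz p x in ab , bc , ca) ∷ []
    ; disjoint = (adjacent-disjoint b c a z bcz caz ∷ []) ∷ [] ∷ []
    }
    where
    abz≥0 : + 0 ℤ.≤ det a b z
    abz≥0 = ℤ.≤-reflexive (sym abz)
    zb : ∀ p → 0≤ form a b at p → 0≤ form z b at p
    zb p ab = 0≤-⊛⁻¹ abc (subst (0≤_at p) (sym (barycentric a b c b z))
      (0≤-⊕ (0≤-⊕ (0≤-⊛ (ℤ.<⇒≤ bcz) ab) (0≤-⊛ (ℤ.<⇒≤ caz) (subst (0≤_at p) (sym (form-refl b)) (0≤-zero (form b b)))))
            (subst (λ m → 0≤ m ⊛ form c b at p) (sym abz) (0≤-zero (form c b)))))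
    az : ∀ p → 0≤ form a b at p → 0≤ form a z at p
    az p ab = 0≤-⊛⁻¹ bcz (subst (0≤_at p) (sym (balanced a b c z))
      (0≤-⊕ (0≤-⊛ (ℤ.<⇒≤ caz) (zb p ab)) (subst (λ m → 0≤ m ⊛ form z c at p) (sym abz) (0≤-zero (form z c)))))

  -- If p is on different sides of two spokes, some pair of neighbouring spokes encloses it. If it
  -- is on the same side of all three, `balanced` or `balanced′` shows that it is also on the other
  -- side of the spoke at a.
  split₃ : (abz : + 0 ℤ.< det a b z) → Cuts (Closed T) (Interior T) (ccwTriangle a b z abz ∷ T₁ ∷ T₂ ∷ [])
  split₃ abz = record
    { cover = λ p (ab , bc , ca) k →
        let in₀ = λ bz za → k (here (ab , 0≤⇒side b z p bz , 0≤⇒side z a p za))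
            in₁ = λ cz zb → k (there (here (bc , 0≤⇒side c z p cz , 0≤⇒side z b p zb)))
            in₂ = λ az zc → k (there (there (here (ca , 0≤⇒side a z p az , 0≤⇒side z c p zc))))
        in beyond-total a z λ
          { (inj₁ az) → beyond-total c z λ
            { (inj₁ cz) → beyond-total b z λ
              { (inj₁ bz) → in₀ bz (0≤-⊛⁻¹ bcz (subst (0≤_at p) (sym (balanced′ a b c z))
                  (0≤-⊕ (0≤-⊛ (ℤ.<⇒≤ caz) bz) (0≤-⊛ (ℤ.<⇒≤ abz) cz))))
              ; (inj₂ zb) → in₁ cz zb }
            ; (inj₂ zc) → in₂ az zc }
          ; (inj₂ za) → beyond-total b z λ
            { (inj₁ bz) → in₀ bz za
            ; (inj₂ zb) → beyond-total c z λ
              { (inj₁ cz) → in₁ cz zb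
              ; (inj₂ zc) → in₂ (0≤-⊛⁻¹ bcz (subst (0≤_at p) (sym (balanced a b c z))
                  (0≤-⊕ (0≤-⊛ (ℤ.<⇒≤ caz) zb) (0≤-⊛ (ℤ.<⇒≤ abz) zc)))) zc } } }
    ; within = piece-closed a b c abc z (ℤ.<⇒≤ bcz) (ℤ.<⇒≤ caz) abz ∷
               (λ p x → let (bc , ca , ab) = piece-closed b c a bca z (ℤ.<⇒≤ caz) (ℤ.<⇒≤ abz) bcz p x in ab , bc , ca) ∷
               (λ p x → let (ca , ab , bc) = piece-closed c a b cab z (ℤ.<⇒≤ abz) (ℤ.<⇒≤ bcz) caz p x in ab , bc , ca) ∷ []
    ; inner  = piece-interior a b c abc z (ℤ.<⇒≤ bcz) (ℤ.<⇒≤ caz) abz ∷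
               (λ p x → let (bc , ca , ab) = piece-interior b c a bca z (ℤ.<⇒≤ caz) (ℤ.<⇒≤ abz) bcz p x in ab , bc , ca) ∷
               (λ p x → let (ca , ab , bc) = piece-interior c a b cab z (ℤ.<⇒≤ abz) (ℤ.<⇒≤ bcz) caz p x in ab , bc , ca) ∷ []
    ; disjoint = (adjacent-disjoint a b c z abz bcz ∷
                  Disjoint-sym T₂ (ccwTriangle a b z abz) (adjacent-disjoint c a b z caz abz) ∷ []) ∷
                 (adjacent-disjoint b c a z bcz caz ∷ []) ∷ [] ∷ []
    }

-- The numbers α, β, γ are the areas of the triangles at z, and k is the area of a b c. As they add
-- up to k, the three bounds say that z is not a corner, and they make the recursion on the area
-- terminate.
record EvenPoint (a b c : LatticePoint) (k : ℕ) : Set where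
  field
    z       : LatticePoint
    α β γ   : ℕ
    bcz     : det b c z ≡ + α ℤ.* + 2
    caz     : det c a z ≡ + β ℤ.* + 2
    abz     : det a b z ≡ + γ ℤ.* + 2
    α<k     : α ℕ.< k
    β<k     : β ℕ.< k
    γ<k     : γ ℕ.< k
    total   : α ℕ.+ β ℕ.+ γ ≡ k

cross : LatticePoint → LatticePoint → ℤ
cross (x₁ , x₂) (y₁ , y₂) = x₁ ℤ.* y₂ ℤ.- x₂ ℤ.* y₁

module _ (a b c : LatticePoint) (k : ℕ) (D : det a b c ≡ + k ℤ.* + 2) where

  private
    u v : LatticePoint
    u = proj₁ a ℤ.- proj₁ c , proj₂ a ℤ.- proj₂ c
    v = proj₁ b ℤ.- proj₁ c , proj₂ b ℤ.- proj₂ c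

    u×v : cross u v ≡ + k ℤ.* + 2
    u×v = trans (lemma (proj₁ a) (proj₂ a) (proj₁ b) (proj₂ b) (proj₁ c) (proj₂ c)) D
      where
      open import Data.Integer.Base using (_+_; _*_; _-_)
      lemma : ∀ a₁ a₂ b₁ b₂ c₁ c₂ → (a₁ - c₁) * (b₂ - c₂) - (a₂ - c₂) * (b₁ - c₁) ≡
              (b₁ - a₁) * (c₂ - a₂) - (b₂ - a₂) * (c₁ - a₁)
      lemma = solve-∀

  from-weights : ∀ z α β → det b c z ≡ + α ℤ.* + 2 → det c a z ≡ + β ℤ.* + 2 →
                 α ℕ.< k → β ℕ.< k → 0 ℕ.< α ℕ.+ β → α ℕ.+ β ℕ.≤ k → EvenPoint a b c k
  from-weights z α β bcz caz α<k β<k pos le = record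
    { z = z ; α = α ; β = β ; γ = k ℕ.∸ (α ℕ.+ β) ; bcz = bcz ; caz = caz ; abz = abz
    ; α<k = α<k ; β<k = β<k ; γ<k = ℕ.∸-monoʳ-< pos le ; total = total }
    where
    total : α ℕ.+ β ℕ.+ (k ℕ.∸ (α ℕ.+ β)) ≡ k
    total = ℕ.m+[n∸m]≡n le
    abz : det a b z ≡ + (k ℕ.∸ (α ℕ.+ β)) ℤ.* + 2
    abz = begin
      det a b z                                                  ≡⟨ lemma (det b c z) (det c a z) (det a b z) ⟩
      det b c z ℤ.+ det c a z ℤ.+ det a b z ℤ.- det b c z ℤ.- det c a z
        ≡⟨ cong (λ d → d ℤ.- det b c z ℤ.- det c a z) (trans (det-total a b c z) D) ⟩
      + k ℤ.* + 2 ℤ.- det b c z ℤ.- det c a z                    ≡⟨ cong₂ (λ x y → + k ℤ.* + 2 ℤ.- x ℤ.- y) bcz caz ⟩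
      + k ℤ.* + 2 ℤ.- + α ℤ.* + 2 ℤ.- + β ℤ.* + 2                ≡⟨ cong (λ m → + m ℤ.* + 2 ℤ.- + α ℤ.* + 2 ℤ.- + β ℤ.* + 2) (sym total) ⟩
      + (α ℕ.+ β ℕ.+ (k ℕ.∸ (α ℕ.+ β))) ℤ.* + 2 ℤ.- + α ℤ.* + 2 ℤ.- + β ℤ.* + 2  ≡⟨ lemma′ (+ α) (+ β) (+ (k ℕ.∸ (α ℕ.+ β))) ⟩
      + (k ℕ.∸ (α ℕ.+ β)) ℤ.* + 2                                ∎
      where
      open ≡-Reasoning
      lemma : ∀ x y z → z ≡ x ℤ.+ y ℤ.+ z ℤ.- x ℤ.- y
      lemma = solve-∀
      lemma′ : ∀ x y z → (x ℤ.+ y ℤ.+ z) ℤ.* + 2 ℤ.- x ℤ.* + 2 ℤ.- y ℤ.* + 2 ≡ z ℤ.* + 2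
      lemma′ = solve-∀

  -- The vector w is reduced modulo the lattice spanned by u and v to a vector with
  -- coordinates in [0, 1), and the result, if it lies beyond the edge ab, is reflected in the
  -- midpoint of that edge.

  reduce : .{{_ : ℕ.NonZero k}} → ∀ w x y → cross w v ≡ x ℤ.* + 2 → cross u w ≡ y ℤ.* + 2 →
           (x ℤ.%ℕ k ≢ 0) ⊎ (y ℤ.%ℕ k ≢ 0) → EvenPoint a b c k
  reduce w x y w×v u×w nz = go (ℕ.≤-total (α ℕ.+ β) k)
    where
    α β : ℕ
    α = x ℤ.%ℕ k
    β = y ℤ.%ℕ k
    i j : ℤ
    i = x ℤ./ℕ k
    j = y ℤ./ℕ k
    α<k : α ℕ.< k
    α<k = ℤ.n%ℕd<d x k
    β<k : β ℕ.< k
    β<k = ℤ.n%ℕd<d y k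
    pos : 0 ℕ.< α ℕ.+ β
    pos = [ (λ p → ℕ.<-≤-trans (ℕ.n≢0⇒n>0 p) (ℕ.m≤m+n α β)) , (λ p → ℕ.<-≤-trans (ℕ.n≢0⇒n>0 p) (ℕ.m≤n+m β α)) ]′ nz
    w₁ w₂ : ℤ
    w₁ = proj₁ w ℤ.- i ℤ.* proj₁ u ℤ.- j ℤ.* proj₁ v
    w₂ = proj₂ w ℤ.- i ℤ.* proj₂ u ℤ.- j ℤ.* proj₂ v
    open import Data.Integer.Base using (_+_; _*_; _-_)
    w×v′ : w₁ * proj₂ v - w₂ * proj₁ v ≡ + α * + 2
    w×v′ = begin
      w₁ * proj₂ v - w₂ * proj₁ v  ≡⟨ lemma (proj₁ u) (proj₂ u) (proj₁ v) (proj₂ v) (proj₁ w) (proj₂ w) i j ⟩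
      cross w v - i * cross u v    ≡⟨ cong₂ (λ s t → s - i * t) w×v u×v ⟩
      x * + 2 - i * (+ k * + 2)    ≡⟨ cong (λ t → t * + 2 - i * (+ k * + 2)) (ℤ.a≡a%ℕn+[a/ℕn]*n x k) ⟩
      (+ α + i * + k) * + 2 - i * (+ k * + 2)  ≡⟨ lemma′ (+ α) i (+ k) ⟩
      + α * + 2 ∎
      where
      open ≡-Reasoning
      lemma : ∀ u₁ u₂ v₁ v₂ w₁ w₂ i j → (w₁ - i * u₁ - j * v₁) * v₂ - (w₂ - i * u₂ - j * v₂) * v₁ ≡
              (w₁ * v₂ - w₂ * v₁) - i * (u₁ * v₂ - u₂ * v₁)
      lemma = solve-∀
      lemma′ : ∀ α i k → (α + i * k) * + 2 - i * (k * + 2) ≡ α * + 2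
      lemma′ = solve-∀
    u×w′ : proj₁ u * w₂ - proj₂ u * w₁ ≡ + β * + 2
    u×w′ = begin
      proj₁ u * w₂ - proj₂ u * w₁  ≡⟨ lemma (proj₁ u) (proj₂ u) (proj₁ v) (proj₂ v) (proj₁ w) (proj₂ w) i j ⟩
      cross u w - j * cross u v    ≡⟨ cong₂ (λ s t → s - j * t) u×w u×v ⟩
      y * + 2 - j * (+ k * + 2)    ≡⟨ cong (λ t → t * + 2 - j * (+ k * + 2)) (ℤ.a≡a%ℕn+[a/ℕn]*n y k) ⟩
      (+ β + j * + k) * + 2 - j * (+ k * + 2)  ≡⟨ lemma′ (+ β) j (+ k) ⟩
      + β * + 2 ∎
      where
      open ≡-Reasoning
      lemma : ∀ u₁ u₂ v₁ v₂ w₁ w₂ i j → u₁ * (w₂ - i * u₂ - j * v₂) - u₂ * (w₁ - i * u₁ - j * v₁) ≡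
              (u₁ * w₂ - u₂ * w₁) - j * (u₁ * v₂ - u₂ * v₁)
      lemma = solve-∀
      lemma′ : ∀ α i k → (α + i * k) * + 2 - i * (k * + 2) ≡ α * + 2
      lemma′ = solve-∀
    at-c at-ab : LatticePoint
    at-c  = proj₁ c + w₁ , proj₂ c + w₂
    at-ab = proj₁ a + proj₁ b - proj₁ c - w₁ , proj₂ a + proj₂ b - proj₂ c - w₂
    complement : ∀ m → m ℕ.≤ k → + k * + 2 - + m * + 2 ≡ + (k ℕ.∸ m) * + 2
    complement m m≤k = trans (cong (λ t → + t * + 2 - + m * + 2) (sym (ℕ.m+[n∸m]≡n m≤k))) (lemma (+ m) (+ (k ℕ.∸ m)))
      where
      lemma : ∀ x y → (x + y) * + 2 - x * + 2 ≡ y * + 2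
      lemma = solve-∀
    go : α ℕ.+ β ℕ.≤ k ⊎ k ℕ.≤ α ℕ.+ β → EvenPoint a b c k
    go (inj₁ le) = from-weights at-c α β (trans (bcz (proj₁ b) (proj₂ b) (proj₁ c) (proj₂ c) w₁ w₂) w×v′)
      (trans (caz (proj₁ a) (proj₂ a) (proj₁ c) (proj₂ c) w₁ w₂) u×w′) α<k β<k pos le
      where
      bcz : ∀ b₁ b₂ c₁ c₂ w₁ w₂ → (c₁ - b₁) * (c₂ + w₂ - b₂) - (c₂ - b₂) * (c₁ + w₁ - b₁) ≡ w₁ * (b₂ - c₂) - w₂ * (b₁ - c₁)
      bcz = solve-∀
      caz : ∀ a₁ a₂ c₁ c₂ w₁ w₂ → (a₁ - c₁) * (c₂ + w₂ - c₂) - (a₂ - c₂) * (c₁ + w₁ - c₁) ≡ (a₁ - c₁) * w₂ - (a₂ - c₂) * w₁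
      caz = solve-∀
    go (inj₂ ge) = from-weights at-ab (k ℕ.∸ α) (k ℕ.∸ β)
      (trans (bcz (proj₁ a) (proj₂ a) (proj₁ b) (proj₂ b) (proj₁ c) (proj₂ c) w₁ w₂)
        (trans (cong₂ _-_ u×v w×v′) (complement α (ℕ.<⇒≤ α<k))))
      (trans (caz (proj₁ a) (proj₂ a) (proj₁ b) (proj₂ b) (proj₁ c) (proj₂ c) w₁ w₂)
        (trans (cong₂ _-_ u×v u×w′) (complement β (ℕ.<⇒≤ β<k))))
      (ℕ.∸-monoʳ-< α>0 (ℕ.<⇒≤ α<k)) (ℕ.∸-monoʳ-< β>0 (ℕ.<⇒≤ β<k))
      (ℕ.<-≤-trans (ℕ.m<n⇒0<n∸m α<k) (ℕ.m≤m+n (k ℕ.∸ α) (k ℕ.∸ β)))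
      (subst (k ℕ.∸ α ℕ.+ (k ℕ.∸ β) ℕ.≤_) (ℕ.m+[n∸m]≡n (ℕ.<⇒≤ β<k)) (ℕ.+-monoˡ-≤ (k ℕ.∸ β) (ℕ.m≤n+o⇒m∸n≤o k α ge)))
      where
      bcz : ∀ a₁ a₂ b₁ b₂ c₁ c₂ w₁ w₂ → (c₁ - b₁) * (a₂ + b₂ - c₂ - w₂ - b₂) - (c₂ - b₂) * (a₁ + b₁ - c₁ - w₁ - b₁) ≡
            ((a₁ - c₁) * (b₂ - c₂) - (a₂ - c₂) * (b₁ - c₁)) - (w₁ * (b₂ - c₂) - w₂ * (b₁ - c₁))
      bcz = solve-∀
      caz : ∀ a₁ a₂ b₁ b₂ c₁ c₂ w₁ w₂ → (a₁ - c₁) * (a₂ + b₂ - c₂ - w₂ - c₂) - (a₂ - c₂) * (a₁ + b₁ - c₁ - w₁ - c₁) ≡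
            ((a₁ - c₁) * (b₂ - c₂) - (a₂ - c₂) * (b₁ - c₁)) - ((a₁ - c₁) * w₂ - (a₂ - c₂) * w₁)
      caz = solve-∀
      α>0 : 0 ℕ.< α
      α>0 = ℕ.+-cancelʳ-< β 0 α (ℕ.<-≤-trans β<k ge)
      β>0 : 0 ℕ.< β
      β>0 = ℕ.+-cancelˡ-< α 0 β (ℕ.<-≤-trans (subst (ℕ._< k) (sym (ℕ.+-identityʳ α)) α<k) ge)

  -- The vectors (2, 0) and (0, 2) have even determinants against every lattice vector. Half of
  -- these determinants are, up to sign, the coordinates of u and v, so both vectors reduce to zero
  -- only if k divides u and v.
  evenPoint : 2 ℕ.≤ k → EvenPoint a b c k
  evenPoint 2≤k = go (proj₂ v ℤ.%ℕ k ℕ.≟ 0) ((ℤ.- proj₂ u) ℤ.%ℕ k ℕ.≟ 0) ((ℤ.- proj₁ v) ℤ.%ℕ k ℕ.≟ 0) (proj₁ u ℤ.%ℕ k ℕ.≟ 0)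
    where
    open import Data.Integer.Base using (_+_; _*_; _-_; -_)
    instance
      k≢0 : ℕ.NonZero k
      k≢0 = ℕ.>-nonZero (ℕ.<-≤-trans z<s 2≤k)
    multiple : ∀ z → z ℤ.%ℕ k ≡ 0 → z ≡ (z ℤ./ℕ k) * + k
    multiple z e = trans (ℤ.a≡a%ℕn+[a/ℕn]*n z k)
      (trans (cong (λ m → + m + (z ℤ./ℕ k) * + k) e) (ℤ.+-identityˡ _))
    horizontal₁ : ∀ v₁ v₂ → + 2 * v₂ - + 0 * v₁ ≡ v₂ * + 2
    horizontal₁ = solve-∀
    horizontal₂ : ∀ u₁ u₂ → u₁ * + 0 - u₂ * + 2 ≡ - u₂ * + 2
    horizontal₂ = solve-∀
    vertical₁ : ∀ v₁ v₂ → + 0 * v₂ - + 2 * v₁ ≡ - v₁ * + 2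
    vertical₁ = solve-∀
    vertical₂ : ∀ u₁ u₂ → u₁ * + 2 - u₂ * + 0 ≡ u₁ * + 2
    vertical₂ = solve-∀
    horizontal : (proj₂ v ℤ.%ℕ k ≢ 0) ⊎ ((- proj₂ u) ℤ.%ℕ k ≢ 0) → EvenPoint a b c k
    horizontal = reduce (+ 2 , + 0) (proj₂ v) (- proj₂ u) (horizontal₁ (proj₁ v) (proj₂ v)) (horizontal₂ (proj₁ u) (proj₂ u))
    vertical : ((- proj₁ v) ℤ.%ℕ k ≢ 0) ⊎ (proj₁ u ℤ.%ℕ k ≢ 0) → EvenPoint a b c k
    vertical = reduce (+ 0 , + 2) (- proj₁ v) (proj₁ u) (vertical₁ (proj₁ v) (proj₂ v)) (vertical₂ (proj₁ u) (proj₂ u))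
    -- If k divides u and v then w = u / k is a lattice vector with det (w , v) = 2.
    divisible : proj₂ v ≡ (proj₂ v ℤ./ℕ k) * + k → - proj₂ u ≡ ((- proj₂ u) ℤ./ℕ k) * + k →
                - proj₁ v ≡ ((- proj₁ v) ℤ./ℕ k) * + k → proj₁ u ≡ (proj₁ u ℤ./ℕ k) * + k → EvenPoint a b c k
    divisible e₁ e₂ e₃ e₄ = reduce (q₄ , - q₂) (+ 1) (+ 0)
      (trans (w×v (proj₁ v) (proj₂ v) q₂ q₄)
        (trans (cong₂ (λ s t → q₄ * s - q₂ * t) e₁ e₃) (trans (factor q₁ q₂ q₃ q₄ (+ k)) kE≡2)))
      (trans (u×w (proj₁ u) (proj₂ u) q₂ q₄) (trans (cong₂ (λ s t → t * q₄ - s * q₂) e₄ e₂) (cancel q₂ q₄ (+ k))))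
      (inj₁ λ e → contradiction (trans (sym (m<n⇒m%n≡m 2≤k)) e) λ ())
      where
      open import Data.Nat.DivMod using (m<n⇒m%n≡m)
      q₁ q₂ q₃ q₄ : ℤ
      q₁ = proj₂ v ℤ./ℕ k
      q₂ = (- proj₂ u) ℤ./ℕ k
      q₃ = (- proj₁ v) ℤ./ℕ k
      q₄ = proj₁ u ℤ./ℕ k
      w×v : ∀ v₁ v₂ q₂ q₄ → q₄ * v₂ - - q₂ * v₁ ≡ q₄ * v₂ - q₂ * - v₁
      w×v = solve-∀
      factor : ∀ q₁ q₂ q₃ q₄ k → q₄ * (q₁ * k) - q₂ * (q₃ * k) ≡ k * (q₄ * q₁ - q₂ * q₃)
      factor = solve-∀
      u×w : ∀ u₁ u₂ q₂ q₄ → u₁ * - q₂ - u₂ * q₄ ≡ - u₂ * q₄ - u₁ * q₂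
      u×w = solve-∀
      cancel : ∀ q₂ q₄ k → q₂ * k * q₄ - q₄ * k * q₂ ≡ + 0
      cancel = solve-∀
      expand : ∀ u₁ u₂ v₁ v₂ → u₁ * v₂ - u₂ * v₁ ≡ u₁ * v₂ - (- u₂) * (- v₁)
      expand = solve-∀
      factor² : ∀ q₁ q₂ q₃ q₄ k → (q₄ * k) * (q₁ * k) - (q₂ * k) * (q₃ * k) ≡ k * (k * (q₄ * q₁ - q₂ * q₃))
      factor² = solve-∀
      -- The equation `u×v` reads k² E = 2 k, where E is the determinant of u / k and v / k.
      kE≡2 : + k * (q₄ * q₁ - q₂ * q₃) ≡ + 2
      kE≡2 = ℤ.*-cancelˡ-≡ (+ k) _ _ (trans (sym (trans (expand (proj₁ u) (proj₂ u) (proj₁ v) (proj₂ v))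
        (trans (cong₂ _-_ (cong₂ _*_ e₄ e₁) (cong₂ _*_ e₂ e₃)) (factor² q₁ q₂ q₃ q₄ (+ k))))) u×v)
    go : Dec (proj₂ v ℤ.%ℕ k ≡ 0) → Dec ((- proj₂ u) ℤ.%ℕ k ≡ 0) → Dec ((- proj₁ v) ℤ.%ℕ k ≡ 0) →
         Dec (proj₁ u ℤ.%ℕ k ≡ 0) → EvenPoint a b c k
    go (no p)   _        _        _        = horizontal (inj₁ p)
    go (yes _)  (no p)   _        _        = horizontal (inj₂ p)
    go (yes _)  (yes _)  (no p)   _        = vertical (inj₁ p)
    go (yes _)  (yes _)  (yes _)  (no p)   = vertical (inj₂ p)
    go (yes e₁) (yes e₂) (yes e₃) (yes e₄) = divisible (multiple _ e₁) (multiple _ e₂) (multiple _ e₃) (multiple _ e₄)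

-- Dissections into triangles of area 1

halves-positive : ∀ {d} k → d ≡ + k ℤ.* + 2 → 0 ℕ.< k → + 0 ℤ.< d
halves-positive (suc k) refl _ = ℤ.+<+ z<s

det-half-one : ∀ {d} → d ≡ + 1 ℤ.* + 2 → d ℚ./ 2 ≡ 1ℚ
det-half-one e = half≡integer _ (+ 1) e

-- The recursion is on the bound n for the area k. A weight 0 means that z lies on an edge; two
-- weights cannot vanish, since the third would then be k.
unitPieces : ∀ n k → k ℕ.≤ n → ∀ a b c (h : + 0 ℤ.< det a b c) → det a b c ≡ + k ℤ.* + 2 →
             Refined HasArea1 (Closed (ccwTriangle a b c h)) (Interior (ccwTriangle a b c h))
unitPieces n zero _ a b c h e = contradiction (subst (+ 0 ℤ.<_) e h) λ { (ℤ.+<+ ()) }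
unitPieces n (suc zero) _ a b c h e = ccwTriangle a b c h ∷ [] , record
  { cover    = λ p x k → k (here x)
  ; within   = (λ p x → x) ∷ []
  ; inner    = (λ p x → x) ∷ []
  ; disjoint = [] ∷ []
  } , det-half-one e ∷ []
unitPieces (suc n) (suc (suc m)) k≤n a b c h e = go (evenPoint a b c k e (s≤s (s≤s z≤n)))
  where
  k = suc (suc m)
  smaller : ∀ {α} → α ℕ.< k → α ℕ.≤ n
  smaller α<k = ℕ.≤-pred (ℕ.<-≤-trans α<k k≤n)
  rest>0 : ∀ {x y} → x ℕ.+ y ≡ k → x ℕ.< k → 0 ℕ.< y
  rest>0 {x} {zero}  e lt = contradiction (subst (ℕ._< k) (trans (sym (ℕ.+-identityʳ x)) e) lt) (ℕ.<-irrefl refl)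
  rest>0 {x} {suc y} e lt = z<s
  go : EvenPoint a b c k → Refined HasArea1 (Closed (ccwTriangle a b c h)) (Interior (ccwTriangle a b c h))
  go w = by-weights α β γ refl refl refl
    where
    open EvenPoint w
    piece : ∀ x y {ω} (h : + 0 ℤ.< det x y z) → det x y z ≡ + ω ℤ.* + 2 → ω ℕ.< k →
            Refined HasArea1 (Closed (ccwTriangle x y z h)) (Interior (ccwTriangle x y z h))
    piece x y {ω} h e ω<k = unitPieces n ω (smaller ω<k) x y z h e
    by-weights : ∀ α′ β′ γ′ → α ≡ α′ → β ≡ β′ → γ ≡ γ′ →
                 Refined HasArea1 (Closed (ccwTriangle a b c h)) (Interior (ccwTriangle a b c h))
    by-weights α′ β′ zero refl refl refl = cuts-refine (split₂ a b c z h bcz>0 caz>0 abz)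
      (piece b c bcz>0 bcz α<k ∷ piece c a caz>0 caz β<k ∷ [])
      where
      α+β : α′ ℕ.+ β′ ≡ k
      α+β = trans (sym (ℕ.+-identityʳ _)) total
      bcz>0 = halves-positive α′ bcz (rest>0 (trans (ℕ.+-comm β′ α′) α+β) β<k)
      caz>0 = halves-positive β′ caz (rest>0 α+β α<k)
    by-weights zero β′ γ′@(suc _) refl refl refl = cuts-refine
      (cuts-rotate a b c h (split₂ b c a z (0<-rotate a b c h) caz>0 abz>0 bcz))
      (piece c a caz>0 caz β<k ∷ piece a b abz>0 abz γ<k ∷ [])
      where
      abz>0 = halves-positive γ′ abz z<s
      caz>0 = halves-positive β′ caz (rest>0 (trans (ℕ.+-comm γ′ β′) total) γ<k)
    by-weights α′@(suc _) zero γ′@(suc _) refl refl refl = cuts-refine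
      (cuts-rotate a b c h (cuts-rotate b c a bca (split₂ c a b z (0<-rotate b c a bca) abz>0 bcz>0 caz)))
      (piece a b abz>0 abz γ<k ∷ piece b c bcz>0 bcz α<k ∷ [])
      where
      bca = 0<-rotate a b c h
      abz>0 = halves-positive γ′ abz z<s
      bcz>0 = halves-positive α′ bcz z<s
    by-weights α′@(suc _) β′@(suc _) γ′@(suc _) refl refl refl = cuts-refine (split₃ a b c z h bcz>0 caz>0 abz>0)
      (piece a b abz>0 abz γ<k ∷ piece b c bcz>0 bcz α<k ∷ piece c a caz>0 caz β<k ∷ [])
      where
      abz>0 = halves-positive γ′ abz z<s
      bcz>0 = halves-positive α′ bcz z<s
      caz>0 = halves-positive β′ caz z<s

integer⇒unit : ∀ P → DissectableInto HasIntegerArea P → DissectableInto HasArea1 P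
integer⇒unit P (Ts , d , hs) with cuts-refine (dissects⇒cuts d) (All.map (λ {T} → unit T) hs)
  where
  unit : ∀ T → HasIntegerArea T → Refined HasArea1 (Closed T) (Interior T)
  unit T (+ k , e) = unitPieces k k ℕ.≤-refl a b c counterclockwise (half≡integer⇒ (det a b c) (+ k) e)
    where open LatticeTriangle T using (a; b; c; counterclockwise)
  unit T (ℤ.-[1+ k ] , e) = contradiction (subst (+ 0 ℤ.<_) (half≡integer⇒ (det a b c) ℤ.-[1+ k ] e) counterclockwise) λ ()
    where open LatticeTriangle T using (a; b; c; counterclockwise)
... | Us , c , units = Us , cuts⇒dissects c , units

unit⇒integer : ∀ P → DissectableInto HasArea1 P → DissectableInto HasIntegerArea P
unit⇒integer P (Ts , d , hs) = Ts , d , All.map (λ h → + 1 , h) hs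

-- Homogeneous points in barycentric coordinates

zero-or-positive : ∀ {i} → + 0 ℤ.≤ i → i ≡ + 0 ⊎ + 0 ℤ.< i
zero-or-positive {+ zero}  _ = inj₁ refl
zero-or-positive {+ suc n} _ = inj₂ (ℤ.+<+ z<s)

+-≡0ˡ : ∀ {i j} → + 0 ℤ.≤ i → + 0 ℤ.≤ j → i ℤ.+ j ≡ + 0 → i ≡ + 0
+-≡0ˡ {i} {j} 0≤i 0≤j e with zero-or-positive 0≤i
... | inj₁ i≡0 = i≡0
... | inj₂ 0<i = contradiction (subst (+ 0 ℤ.<_) e (ℤ.+-mono-<-≤ 0<i 0≤j)) (ℤ.<-irrefl refl)

+-≡0ʳ : ∀ {i j} → + 0 ℤ.≤ i → + 0 ℤ.≤ j → i ℤ.+ j ≡ + 0 → j ≡ + 0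
+-≡0ʳ {i} {j} 0≤i 0≤j e = +-≡0ˡ 0≤j 0≤i (trans (ℤ.+-comm j i) e)

*-≡0 : ∀ {i j} → + 0 ℤ.< j → i ℤ.* j ≡ + 0 → i ≡ + 0
*-≡0 {i} {j} 0<j e with ℤ.i*j≡0⇒i≡0∨j≡0 i e
... | inj₁ i≡0 = i≡0
... | inj₂ j≡0 = contradiction (subst (+ 0 ℤ.<_) j≡0 0<j) (ℤ.<-irrefl refl)

third : ℤ³ → ℤ
third h = proj₂ (proj₂ h)

⊛-cancel : ∀ {k} h h′ → + 0 ℤ.< k → k ⊛ h ≡ k ⊛ h′ → h ≡ h′
⊛-cancel {+ suc n} (x , y , z) (x′ , y′ , z′) _ e =
  cong₃ (ℤ.*-cancelˡ-≡ (+ suc n) x x′ (cong proj₁ e)) (ℤ.*-cancelˡ-≡ (+ suc n) y y′ (cong (λ h → proj₁ (proj₂ h)) e))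
        (ℤ.*-cancelˡ-≡ (+ suc n) z z′ (cong third e))
⊛-cancel {+ zero} _ _ (ℤ.+<+ ()) _

-- The edge forms at h are its barycentric coordinates; this is the transpose of `cramer`.
cramer-dual : ∀ a b c h → det a b c ⊛ h ≡
              form b c · h ⊛ lift a ⊕ form c a · h ⊛ lift b ⊕ form a b · h ⊛ lift c
cramer-dual (a₁ , a₂) (b₁ , b₂) (c₁ , c₂) (x , y , z) =
  cong₃ (p a₁ a₂ b₁ b₂ c₁ c₂ x y z) (q a₁ a₂ b₁ b₂ c₁ c₂ x y z) (r a₁ a₂ b₁ b₂ c₁ c₂ x y z)
  where
  open import Data.Integer.Base using (_+_; _*_; _-_)
  p : ∀ a₁ a₂ b₁ b₂ c₁ c₂ x y z → ((b₁ - a₁) * (c₂ - a₂) - (b₂ - a₂) * (c₁ - a₁)) * x ≡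
    ((b₂ - c₂) * x + (c₁ - b₁) * y + (b₁ * c₂ - b₂ * c₁) * z) * a₁ +
    ((c₂ - a₂) * x + (a₁ - c₁) * y + (c₁ * a₂ - c₂ * a₁) * z) * b₁ +
    ((a₂ - b₂) * x + (b₁ - a₁) * y + (a₁ * b₂ - a₂ * b₁) * z) * c₁
  p = solve-∀
  q : ∀ a₁ a₂ b₁ b₂ c₁ c₂ x y z → ((b₁ - a₁) * (c₂ - a₂) - (b₂ - a₂) * (c₁ - a₁)) * y ≡
    ((b₂ - c₂) * x + (c₁ - b₁) * y + (b₁ * c₂ - b₂ * c₁) * z) * a₂ +
    ((c₂ - a₂) * x + (a₁ - c₁) * y + (c₁ * a₂ - c₂ * a₁) * z) * b₂ +
    ((a₂ - b₂) * x + (b₁ - a₁) * y + (a₁ * b₂ - a₂ * b₁) * z) * c₂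
  q = solve-∀
  r : ∀ a₁ a₂ b₁ b₂ c₁ c₂ x y z → ((b₁ - a₁) * (c₂ - a₂) - (b₂ - a₂) * (c₁ - a₁)) * z ≡
    ((b₂ - c₂) * x + (c₁ - b₁) * y + (b₁ * c₂ - b₂ * c₁) * z) * + 1 +
    ((c₂ - a₂) * x + (a₁ - c₁) * y + (c₁ * a₂ - c₂ * a₁) * z) * + 1 +
    ((a₂ - b₂) * x + (b₁ - a₁) * y + (a₁ * b₂ - a₂ * b₁) * z) * + 1
  r = solve-∀

IsLattice : ℤ³ → LatticePoint → Set
IsLattice h z = h ≡ third h ⊛ lift z

-- Only the term of a survives in `cramer-dual`, and the comparison of third coordinates gives its
-- factor.
two-edges⇒corner : ∀ a b c h → + 0 ℤ.< det a b c → form a b · h ≡ + 0 → form c a · h ≡ + 0 → IsLattice h a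
two-edges⇒corner a b c h abc ab ca = ⊛-cancel h (third h ⊛ lift a) abc
  (trans dual (trans (cong (_⊛ lift a) (sym (cong third dual′))) (⊛-assoc (det a b c) (third h) (lift a))))
  where
  ⊛-assoc : ∀ k l φ → (k ℤ.* l) ⊛ φ ≡ k ⊛ (l ⊛ φ)
  ⊛-assoc k l (x , y , z) = cong₃ (ℤ.*-assoc k l x) (ℤ.*-assoc k l y) (ℤ.*-assoc k l z)
  drop-zeros : ∀ φ ψ χ → φ ⊕ + 0 ⊛ ψ ⊕ + 0 ⊛ χ ≡ φ
  drop-zeros (x , y , z) ψ χ = cong₃ (z² x) (z² y) (z² z)
    where
    z² : ∀ x → x ℤ.+ + 0 ℤ.+ + 0 ≡ x
    z² = solve-∀
  dual : det a b c ⊛ h ≡ form b c · h ⊛ lift a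
  dual = trans (cramer-dual a b c h) (trans
    (cong₂ (λ s t → form b c · h ⊛ lift a ⊕ s ⊛ lift b ⊕ t ⊛ lift c) ca ab)
    (drop-zeros (form b c · h ⊛ lift a) (lift b) (lift c)))
  dual′ : det a b c ⊛ h ≡ (form b c · h ℤ.* proj₁ a , form b c · h ℤ.* proj₂ a , form b c · h)
  dual′ = trans dual (cong₃ refl refl (ℤ.*-identityʳ _))

-- The position of a homogeneous point with respect to a triangle

-- A choice of an edge of T, from x to y, together with the opposite corner z.
data Rotation (T : LatticeTriangle) : (x y z : LatticePoint) → Set where
  abc : let open LatticeTriangle T in Rotation T a b c
  bca : let open LatticeTriangle T in Rotation T b c a
  cab : let open LatticeTriangle T in Rotation T c a b

rotation-det : ∀ {T x y z} → Rotation T x y z → + 0 ℤ.< det x y z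
rotation-det {T} abc = LatticeTriangle.counterclockwise T
rotation-det {T} bca = 0<-rotate a b c counterclockwise
  where open LatticeTriangle T using (a; b; c; counterclockwise)
rotation-det {T} cab = 0<-rotate b c a (0<-rotate a b c counterclockwise)
  where open LatticeTriangle T using (a; b; c; counterclockwise)

Edges : LatticeTriangle → (ℤ³ → Set) → Set
Edges T Q = Q (form a b) × Q (form b c) × Q (form c a)
  where open LatticeTriangle T using (a; b; c)

rotate-edges : ∀ {T x y z} (Q : ℤ³ → Set) → Rotation T x y z → Edges T Q → Q (form x y) × Q (form y z) × Q (form z x)
rotate-edges Q abc (p , q , r) = p , q , r
rotate-edges Q bca (p , q , r) = q , r , p
rotate-edges Q cab (p , q , r) = r , p , q

unrotate-edges : ∀ {T x y z} (Q : ℤ³ → Set) → Rotation T x y z → Q (form x y) → Q (form y z) → Q (form z x) → Edges T Q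
unrotate-edges Q abc p q r = p , q , r
unrotate-edges Q bca p q r = r , p , q
unrotate-edges Q cab p q r = q , r , p

record ClosedAt (T : LatticeTriangle) (h : ℤ³) : Set where
  constructor closedAt
  field edges : Edges T (λ φ → + 0 ℤ.≤ φ · h)

record InteriorAt (T : LatticeTriangle) (h : ℤ³) : Set where
  constructor interiorAt
  field edges : Edges T (λ φ → + 0 ℤ.< φ · h)

closedAt? : ∀ T h → Dec (ClosedAt T h)
closedAt? T h with (+ 0 ℤ.≤? form a b · h) ×-dec (+ 0 ℤ.≤? form b c · h) ×-dec (+ 0 ℤ.≤? form c a · h)
  where open LatticeTriangle T using (a; b; c)
... | yes e = yes (closedAt e)
... | no ¬e = no λ (closedAt e) → ¬e e

data NonCorner (T : LatticeTriangle) (h : ℤ³) : Set where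
  inside : InteriorAt T h → NonCorner T h
  edge   : ∀ {x y z} → Rotation T x y z → form x y · h ≡ + 0 →
           + 0 ℤ.< form y z · h → + 0 ℤ.< form z x · h → NonCorner T h

data Corner (T : LatticeTriangle) (h : ℤ³) : Set where
  corner : ∀ {x y z} → Rotation T x y z → form x y · h ≡ + 0 → form z x · h ≡ + 0 → Corner T h

locate : ∀ {T h} → ClosedAt T h → NonCorner T h ⊎ Corner T h
locate {T} (closedAt (ab , bc , ca)) with zero-or-positive ab | zero-or-positive bc | zero-or-positive ca
... | inj₂ p | inj₂ q | inj₂ r = inj₁ (inside (interiorAt (p , q , r)))
... | inj₁ p | inj₂ q | inj₂ r = inj₁ (edge abc p q r)
... | inj₂ p | inj₁ q | inj₂ r = inj₁ (edge bca q r p)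
... | inj₂ p | inj₂ q | inj₁ r = inj₁ (edge cab r p q)
... | inj₁ p | _      | inj₁ r = inj₂ (corner abc p r)
... | inj₁ p | inj₁ q | inj₂ _ = inj₂ (corner bca q p)
... | inj₂ _ | inj₁ q | inj₁ r = inj₂ (corner cab r q)

corner⇒lattice : ∀ {T h x y z} → Rotation T x y z → form x y · h ≡ + 0 → form z x · h ≡ + 0 → IsLattice h x
corner⇒lattice {T} {h} {x} {y} {z} ρ xy zx = two-edges⇒corner x y z h (rotation-det ρ) xy zx

same-edge : ∀ {T h x y z x′ y′ z′} → Rotation T x y z → Rotation T x′ y′ z′ → form x y · h ≡ + 0 →
            + 0 ℤ.< form y′ z′ · h → + 0 ℤ.< form z′ x′ · h → form x y ≡ form x′ y′
same-edge abc abc _ _ _ = refl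
same-edge abc bca e _ r = contradiction (subst (+ 0 ℤ.<_) e r) (ℤ.<-irrefl refl)
same-edge abc cab e q _ = contradiction (subst (+ 0 ℤ.<_) e q) (ℤ.<-irrefl refl)
same-edge bca abc e q _ = contradiction (subst (+ 0 ℤ.<_) e q) (ℤ.<-irrefl refl)
same-edge bca bca _ _ _ = refl
same-edge bca cab e _ r = contradiction (subst (+ 0 ℤ.<_) e r) (ℤ.<-irrefl refl)
same-edge cab abc e _ r = contradiction (subst (+ 0 ℤ.<_) e r) (ℤ.<-irrefl refl)
same-edge cab bca e q _ = contradiction (subst (+ 0 ℤ.<_) e q) (ℤ.<-irrefl refl)
same-edge cab cab _ _ _ = refl

-- Triangles with a common point

module _ (h g : ℤ³) where

  -- A sufficient condition for φ to be positive at K h + g for all large K, that is, at h moved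
  -- infinitesimally towards g.
  Increasing : ℤ³ → Set
  Increasing φ = + 0 ℤ.< φ · h ⊎ (+ 0 ℤ.≤ φ · h × + 0 ℤ.< φ · g)

  eventually : ∀ φ → Increasing φ → ∀ K → ∣ φ · g ∣ ℕ.< K → + 0 ℤ.< φ · (+ K ⊛ h ⊕ g)
  eventually φ up K lt = subst (+ 0 ℤ.<_) (sym (trans (·-⊕ʳ φ (+ K ⊛ h) g) (cong (ℤ._+ φ · g) (·-⊛ʳ φ (+ K) h)))) (go up)
    where
    open ℤ.≤-Reasoning
    large : ∀ i → + 0 ℤ.< i → + K ℤ.≤ + K ℤ.* i
    large i 0<i = subst (ℤ._≤ + K ℤ.* i) (ℤ.*-identityʳ (+ K)) (ℤ.*-monoˡ-≤-nonNeg (+ K) (ℤ.i<j⇒suc[i]≤j 0<i))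
    -∣i∣≤i : ∀ i → ℤ.- (+ ∣ i ∣) ℤ.≤ i
    -∣i∣≤i (+ zero) = ℤ.≤-refl
    -∣i∣≤i (+ suc n) = ℤ.-≤+
    -∣i∣≤i -[1+ n ] = ℤ.≤-refl
    go : Increasing φ → + 0 ℤ.< + K ℤ.* (φ · h) ℤ.+ φ · g
    go (inj₁ 0<φh) = begin-strict
      + 0                            ≡⟨ ℤ.+-inverseʳ (+ ∣ φ · g ∣) ⟨
      + ∣ φ · g ∣ ℤ.+ ℤ.- (+ ∣ φ · g ∣)    <⟨ ℤ.+-mono-<-≤ (ℤ.+<+ lt) (-∣i∣≤i (φ · g)) ⟩
      + K ℤ.+ φ · g                  ≤⟨ ℤ.+-monoˡ-≤ (φ · g) (large (φ · h) 0<φh) ⟩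
      + K ℤ.* (φ · h) ℤ.+ φ · g      ∎
    go (inj₂ (0≤φh , 0<φg)) = ℤ.+-mono-≤-< (*-nonneg (ℤ.+≤+ (z≤n {K})) 0≤φh) 0<φg

  all-eventually : ∀ {Φ} → All Increasing Φ → ∃ λ K → ∀ n → K ℕ.≤ n → All (λ φ → + 0 ℤ.< φ · (+ n ⊛ h ⊕ g)) Φ
  all-eventually [] = 0 , λ _ _ → []
  all-eventually {φ ∷ _} (up ∷ ups) with all-eventually ups
  ... | K , k = suc ∣ φ · g ∣ ℕ.⊔ K , λ n le →
    eventually φ up n (ℕ.≤-trans (ℕ.m≤m⊔n (suc ∣ φ · g ∣) K) le) ∷ k n (ℕ.≤-trans (ℕ.m≤n⊔m (suc ∣ φ · g ∣) K) le)

-- The line at infinity. Its value is the third coordinate, so that the finiteness of K h + g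
-- becomes one more sign condition for `all-eventually`.
infinity : ℤ³
infinity = + 0 , + 0 , + 1

infinity-· : ∀ h → infinity · h ≡ third h
infinity-· (x , y , z) = lemma x y z
  where
  lemma : ∀ x y z → + 0 ℤ.* x ℤ.+ + 0 ℤ.* y ℤ.+ + 1 ℤ.* z ≡ z
  lemma = solve-∀

DisjointAt : LatticeTriangle → LatticeTriangle → Set
DisjointAt S T = ∀ h → + 0 ℤ.< third h → InteriorAt S h → ¬ InteriorAt T h

no-overlap : ∀ {S T} → DisjointAt S T → ∀ h g → + 0 ℤ.< third h →
             Edges S (Increasing h g) → ¬ Edges T (Increasing h g)
no-overlap {S} {T} d h g h₃ (s₁ , s₂ , s₃) (t₁ , t₂ , t₃) = conclude (all-eventually h g {Φ}
    (inj₁ (subst (+ 0 ℤ.<_) (sym (infinity-· h)) h₃) ∷ s₁ ∷ s₂ ∷ s₃ ∷ t₁ ∷ t₂ ∷ t₃ ∷ []))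
  where
  open LatticeTriangle
  Φ : List ℤ³
  Φ = infinity ∷ form (a S) (b S) ∷ form (b S) (c S) ∷ form (c S) (a S) ∷
                 form (a T) (b T) ∷ form (b T) (c T) ∷ form (c T) (a T) ∷ []
  meet : ∀ h′ → ¬ All (λ φ → + 0 ℤ.< φ · h′) Φ
  meet h′ (o ∷ s₁′ ∷ s₂′ ∷ s₃′ ∷ t₁′ ∷ t₂′ ∷ t₃′ ∷ []) =
    d h′ (subst (+ 0 ℤ.<_) (infinity-· h′) o) (interiorAt (s₁′ , s₂′ , s₃′)) (interiorAt (t₁′ , t₂′ , t₃′))
  conclude : ¬ ∃ λ K → ∀ n → K ℕ.≤ n → All (λ φ → + 0 ℤ.< φ · (+ n ⊛ h ⊕ g)) Φ
  conclude (K , k) = meet (+ K ⊛ h ⊕ g) (k K ℕ.≤-refl)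

centroid : LatticeTriangle → ℤ³
centroid T = lift a ⊕ lift b ⊕ lift c
  where open LatticeTriangle T using (a; b; c)

form-centroid : ∀ {T} → Edges T (λ φ → + 0 ℤ.< φ · centroid T)
form-centroid {T} = at {a} {b} {c} refl abc , at {b} {c} {a} (rot a b c) bca ,
                    at {c} {a} {b} (trans (rot b c a) (rot a b c)) cab
  where
  open LatticeTriangle T using (a; b; c)
  rot : ∀ a b c → lift b ⊕ lift c ⊕ lift a ≡ lift a ⊕ lift b ⊕ lift c
  rot (a₁ , a₂) (b₁ , b₂) (c₁ , c₂) = cong₃ (lemma a₁ b₁ c₁) (lemma a₂ b₂ c₂) refl
    where
    lemma : ∀ a b c → b ℤ.+ c ℤ.+ a ≡ a ℤ.+ b ℤ.+ c
    lemma = solve-∀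
  at : ∀ {x y z} → lift x ⊕ lift y ⊕ lift z ≡ centroid T → Rotation T x y z → + 0 ℤ.< form x y · centroid T
  at {x} {y} {z} e ρ = subst (+ 0 ℤ.<_) (sym value≡) (rotation-det ρ)
    where
    open ≡-Reasoning
    value≡ : form x y · centroid T ≡ det x y z
    value≡ = begin
      form x y · centroid T                 ≡⟨ cong (form x y ·_) (sym e) ⟩
      form x y · (lift x ⊕ lift y ⊕ lift z) ≡⟨ ·-⊕ʳ (form x y) (lift x ⊕ lift y) (lift z) ⟩
      form x y · (lift x ⊕ lift y) ℤ.+ form x y · lift z
        ≡⟨ cong₂ ℤ._+_ (trans (·-⊕ʳ (form x y) (lift x) (lift y))
             (cong₂ ℤ._+_ (trans (form-lift x y x) (det-start x y)) (trans (form-lift x y y) (det-end x y)))) (form-lift x y z) ⟩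
      + 0 ℤ.+ det x y z                     ≡⟨ ℤ.+-identityˡ _ ⟩
      det x y z                             ∎

-- A short step from h towards the centroid of T enters the interior of T without leaving that of S.
interior-meets-closed : ∀ {S T} → DisjointAt S T → ∀ h → + 0 ℤ.< third h → InteriorAt S h → ¬ ClosedAt T h
interior-meets-closed {S} {T} d h h₃ (interiorAt (s₁ , s₂ , s₃)) (closedAt (t₁ , t₂ , t₃)) =
  let (g₁ , g₂ , g₃) = form-centroid {T}
  in no-overlap {S} {T} d h (centroid T) h₃ (inj₁ s₁ , inj₁ s₂ , inj₁ s₃)
       (inj₂ (t₁ , g₁) , inj₂ (t₂ , g₂) , inj₂ (t₃ , g₃))

slope : ℤ³ → ℤ³ → ℤ
slope (α , β , _) (α′ , β′ , _) = α ℤ.* β′ ℤ.- β ℤ.* α′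

-- Normal to the coefficient vector (α, β): the direction of the line φ = 0, taken as its point at
-- infinity.
normal : ℤ³ → ℤ³
normal (α , β , _) = ℤ.- β , α , + 0

normal-self : ∀ φ → φ · normal φ ≡ + 0
normal-self (α , β , γ) = lemma α β γ
  where
  lemma : ∀ α β γ → α ℤ.* (ℤ.- β) ℤ.+ β ℤ.* α ℤ.+ γ ℤ.* + 0 ≡ + 0
  lemma = solve-∀

normal-other : ∀ φ ψ → ψ · normal φ ≡ slope φ ψ
normal-other (α , β , γ) (α′ , β′ , γ′) = lemma α β α′ β′ γ′
  where
  lemma : ∀ α β α′ β′ γ′ → α′ ℤ.* (ℤ.- β) ℤ.+ β′ ℤ.* α ℤ.+ γ′ ℤ.* + 0 ≡ α ℤ.* β′ ℤ.- β ℤ.* α′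
  lemma = solve-∀

·-⊖ʳ : ∀ φ h → φ · (⊖ h) ≡ ℤ.- (φ · h)
·-⊖ʳ (α , β , γ) (x , y , z) = lemma α β γ x y z
  where
  lemma : ∀ α β γ x y z → α ℤ.* (ℤ.- x) ℤ.+ β ℤ.* (ℤ.- y) ℤ.+ γ ℤ.* (ℤ.- z) ≡ ℤ.- (α ℤ.* x ℤ.+ β ℤ.* y ℤ.+ γ ℤ.* z)
  lemma = solve-∀

slope-swap : ∀ φ ψ → slope ψ φ ≡ ℤ.- slope φ ψ
slope-swap (α , β , _) (α′ , β′ , _) = lemma α β α′ β′
  where
  lemma : ∀ α β α′ β′ → α′ ℤ.* β ℤ.- β′ ℤ.* α ≡ ℤ.- (α ℤ.* β′ ℤ.- β ℤ.* α′)
  lemma = solve-∀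

-- Each form vanishes along its own line, and `slope` is antisymmetric, so both values are equal to
-- `slope φ ψ`.
between : ∀ φ ψ → + 0 ℤ.< slope φ ψ → let d = normal φ ⊕ ⊖ normal ψ in + 0 ℤ.< φ · d × + 0 ℤ.< ψ · d
between φ ψ pos = subst (+ 0 ℤ.<_) (sym φd) pos , subst (+ 0 ℤ.<_) (sym ψd) pos
  where
  d = normal φ ⊕ ⊖ normal ψ
  φd : φ · d ≡ slope φ ψ
  φd = trans (·-⊕ʳ φ (normal φ) (⊖ normal ψ)) (trans (cong₂ ℤ._+_ (normal-self φ) (trans (·-⊖ʳ φ (normal ψ))
    (trans (cong ℤ.-_ (trans (normal-other ψ φ) (slope-swap φ ψ))) (ℤ.neg-involutive _)))) (ℤ.+-identityˡ _))
  ψd : ψ · d ≡ slope φ ψ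
  ψd = trans (·-⊕ʳ ψ (normal φ) (⊖ normal ψ)) (trans (cong₂ ℤ._+_ (normal-other φ ψ) (trans (·-⊖ʳ ψ (normal ψ))
    (cong ℤ.-_ (normal-self ψ)))) (ℤ.+-identityʳ _))

Degenerate : ℤ³ → Set
Degenerate (α , β , _) = α ≡ + 0 × β ≡ + 0

form-nondegenerate : ∀ x y z → + 0 ℤ.< det x y z → ¬ Degenerate (form x y)
form-nondegenerate x y z pos (α≡0 , β≡0) = ℤ.<-irrefl (sym det≡0) pos
  where
  det-of-point : ∀ x y → proj₂ x ℤ.- proj₂ y ≡ + 0 → proj₁ y ℤ.- proj₁ x ≡ + 0 → det x y z ≡ + 0
  det-of-point (x₁ , x₂) (y₁ , y₂) p q with ℤ.i-j≡0⇒i≡j x₂ y₂ p | ℤ.i-j≡0⇒i≡j y₁ x₁ q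
  ... | refl | refl = lemma x₁ x₂ (proj₁ z) (proj₂ z)
    where
    lemma : ∀ x₁ x₂ z₁ z₂ → (x₁ ℤ.- x₁) ℤ.* (z₂ ℤ.- x₂) ℤ.- (x₂ ℤ.- x₂) ℤ.* (z₁ ℤ.- x₁) ≡ + 0
    lemma = solve-∀
  det≡0 : det x y z ≡ + 0
  det≡0 = det-of-point x y α≡0 β≡0

-- Parallel lines with the finite point h in common coincide. After multiplication by a coefficient
-- of f the claim follows from a polynomial identity, and one of the two coefficients is nonzero.
parallel-lines : ∀ e f h z → slope e f ≡ + 0 → ¬ Degenerate f → + 0 ℤ.< third h →
                 e · h ≡ + 0 → f · h ≡ + 0 → f · lift z ≡ + 0 → e · lift z ≡ + 0
parallel-lines e@(α , β , γ) f@(α′ , β′ , γ′) h@(h₁ , h₂ , h₃) z@(z₁ , z₂) κ nd h₃>0 eh fh fz =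
  go (ℤ.i*j≡0⇒i≡0∨j≡0 α′ (trans (first α β γ α′ β′ γ′ h₁ h₂ h₃ z₁ z₂) vanish₁))
     (ℤ.i*j≡0⇒i≡0∨j≡0 β′ (trans (second α β γ α′ β′ γ′ h₁ h₂ h₃ z₁ z₂) vanish₂))
  where
  open import Data.Integer.Base using (_+_; _*_; _-_)
  open ≡-Reasoning
  first : ∀ α β γ α′ β′ γ′ h₁ h₂ h₃ z₁ z₂ → α′ * (h₃ * (α * z₁ + β * z₂ + γ * + 1)) ≡
    α′ * (α * h₁ + β * h₂ + γ * h₃) + α * (h₃ * (α′ * z₁ + β′ * z₂ + γ′ * + 1) - (α′ * h₁ + β′ * h₂ + γ′ * h₃))
      - (α * β′ - β * α′) * (h₃ * z₂ - h₂)
  first = solve-∀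
  second : ∀ α β γ α′ β′ γ′ h₁ h₂ h₃ z₁ z₂ → β′ * (h₃ * (α * z₁ + β * z₂ + γ * + 1)) ≡
    β′ * (α * h₁ + β * h₂ + γ * h₃) + β * (h₃ * (α′ * z₁ + β′ * z₂ + γ′ * + 1) - (α′ * h₁ + β′ * h₂ + γ′ * h₃))
      + (α * β′ - β * α′) * (h₃ * z₁ - h₁)
  second = solve-∀
  zeros₁ : ∀ s t u v → s * + 0 + t * (u * + 0 - + 0) - + 0 * v ≡ + 0
  zeros₁ = solve-∀
  zeros₂ : ∀ s t u v → s * + 0 + t * (u * + 0 - + 0) + + 0 * v ≡ + 0
  zeros₂ = solve-∀
  vanish₁ : α′ * (e · h) + α * (h₃ * (f · lift z) - f · h) - slope e f * (h₃ * z₂ - h₂) ≡ + 0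
  vanish₁ = trans (cong₂ _-_ (cong₂ (λ s t → α′ * s + α * t) eh (cong₂ (λ s t → h₃ * s - t) fz fh))
    (cong (_* (h₃ * z₂ - h₂)) κ)) (zeros₁ α′ α h₃ (h₃ * z₂ - h₂))
  vanish₂ : β′ * (e · h) + β * (h₃ * (f · lift z) - f · h) + slope e f * (h₃ * z₁ - h₁) ≡ + 0
  vanish₂ = trans (cong₂ _+_ (cong₂ (λ s t → β′ * s + β * t) eh (cong₂ (λ s t → h₃ * s - t) fz fh))
    (cong (_* (h₃ * z₁ - h₁)) κ)) (zeros₂ β′ β h₃ (h₃ * z₁ - h₁))
  done : h₃ * (e · lift z) ≡ + 0 → e · lift z ≡ + 0
  done p = *-≡0 h₃>0 (trans (ℤ.*-comm (e · lift z) h₃) p)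
  go : α′ ≡ + 0 ⊎ h₃ * (e · lift z) ≡ + 0 → β′ ≡ + 0 ⊎ h₃ * (e · lift z) ≡ + 0 → e · lift z ≡ + 0
  go (inj₂ p) _        = done p
  go (inj₁ _) (inj₂ p) = done p
  go (inj₁ p) (inj₁ q) = contradiction (p , q) nd

record CommonLine (S T : LatticeTriangle) (h : ℤ³) : Set where
  field
    {x y z x′ y′ z′} : LatticePoint
    ρ    : Rotation S x y z
    σ    : Rotation T x′ y′ z′
    on   : form x y · h ≡ + 0
    off₁ : + 0 ℤ.< form y z · h
    off₂ : + 0 ℤ.< form z x · h
    x′-on : form x y · lift x′ ≡ + 0
    y′-on : form x y · lift y′ ≡ + 0

-- If the edges of S and T through h were not parallel, then a short step from h in the
-- direction given by between would lead into both interiors.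

common-line : ∀ {S T} → DisjointAt S T → ∀ h → + 0 ℤ.< third h → ClosedAt S h → ClosedAt T h →
              NonCorner S h → NonCorner T h → CommonLine S T h
common-line {S} {T} d h h₃ s t (inside i) _ = contradiction t (interior-meets-closed {S} {T} d h h₃ i)
common-line {S} {T} d h h₃ s t (edge _ _ _ _) (inside i) = contradiction s (interior-meets-closed {T} {S} (λ h h₃ i j → d h h₃ j i) h h₃ i)
common-line {S} {T} d h h₃ s t (edge {x} {y} {z} ρ e₁ e₂ e₃) (edge {x′} {y′} {z′} σ f₁ f₂ f₃) with ℤ.<-cmp (+ 0) (slope (form x y) (form x′ y′))
... | tri≈ _ κ _ = record { ρ = ρ ; σ = σ ; on = e₁ ; off₁ = e₂ ; off₂ = e₃
  ; x′-on = on-line x′ (trans (form-lift x′ y′ x′) (det-start x′ y′))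
  ; y′-on = on-line y′ (trans (form-lift x′ y′ y′) (det-end x′ y′)) }
  where
  on-line : ∀ v → form x′ y′ · lift v ≡ + 0 → form x y · lift v ≡ + 0
  on-line v = parallel-lines (form x y) (form x′ y′) h v (sym κ) (form-nondegenerate x′ y′ z′ (rotation-det σ)) h₃ e₁ f₁
... | tri< pos _ _ = let (p , q) = between (form x y) (form x′ y′) pos
                         g = normal (form x y) ⊕ ⊖ normal (form x′ y′)
  in contradiction (unrotate-edges (Increasing h g) σ (inj₂ (ℤ.≤-reflexive (sym f₁) , q)) (inj₁ f₂) (inj₁ f₃))
  (no-overlap {S} {T} d h g h₃ (unrotate-edges (Increasing h g) ρ (inj₂ (ℤ.≤-reflexive (sym e₁) , p)) (inj₁ e₂) (inj₁ e₃)))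
... | tri> _ _ neg = let (p , q) = between (form x′ y′) (form x y) (subst (+ 0 ℤ.<_) (sym (slope-swap (form x y) (form x′ y′))) (ℤ.neg-mono-< neg))
                         g = normal (form x′ y′) ⊕ ⊖ normal (form x y)
  in contradiction (unrotate-edges (Increasing h g) σ (inj₂ (ℤ.≤-reflexive (sym f₁) , p)) (inj₁ f₂) (inj₁ f₃))
  (no-overlap {S} {T} d h g h₃ (unrotate-edges (Increasing h g) ρ (inj₂ (ℤ.≤-reflexive (sym e₁) , q)) (inj₁ e₂) (inj₁ e₃)))

OnLine : ℤ³ → Colour → Set
OnLine e X = ∃ λ z → e · lift z ≡ + 0 × colour z ≡ X

collinear : ∀ e x y z → ¬ Degenerate e → e · lift x ≡ + 0 → e · lift y ≡ + 0 → e · lift z ≡ + 0 → det x y z ≡ + 0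
collinear e x y z nd ex ey ez = go (ℤ.i*j≡0⇒i≡0∨j≡0 (det x y z) (cong proj₁ vanish))
                                   (ℤ.i*j≡0⇒i≡0∨j≡0 (det x y z) (cong (λ h → proj₁ (proj₂ h)) vanish))
  where
  vanish : det x y z ⊛ e ≡ + 0 ⊛ form y z ⊕ + 0 ⊛ form z x ⊕ + 0 ⊛ form x y
  vanish = trans (cramer x y z e) (cong₂ _⊕_ (cong₂ (λ s t → s ⊛ form y z ⊕ t ⊛ form z x) ex ey) (cong (_⊛ form x y) ez))
  go : det x y z ≡ + 0 ⊎ proj₁ e ≡ + 0 → det x y z ≡ + 0 ⊎ proj₁ (proj₂ e) ≡ + 0 → det x y z ≡ + 0
  go (inj₁ p) _        = p
  go (inj₂ _) (inj₁ p) = p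
  go (inj₂ p) (inj₂ q) = contradiction (p , q) nd

-- Collinear lattice points span the doubled area 0, which is even.
OnLine-repeats : ∀ e {X Y Z} → ¬ Degenerate e → OnLine e X → OnLine e Y → OnLine e Z → Repeats X Y Z
OnLine-repeats e nd (x , ex , refl) (y , ey , refl) (z , ez , refl) =
  even-det⇒repeats x y z (+ 0) (collinear e x y z nd ex ey ez)

EvenTriangle : LatticeTriangle → Set
EvenTriangle T = Repeats (colour a) (colour b) (colour c)
  where open LatticeTriangle T using (a; b; c)

-- A colour that occurs on every edge of an even triangle.

centre : LatticeTriangle → Colour
centre T with colour (LatticeTriangle.a T) ≟ᶜ colour (LatticeTriangle.b T)
... | yes _ = colour (LatticeTriangle.a T)
... | no _  = colour (LatticeTriangle.c T)

centre-corner : ∀ {T x y z} → EvenTriangle T → Rotation T x y z → centre T ≡ colour x ⊎ centre T ≡ colour y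
centre-corner {T} ev ρ with colour (LatticeTriangle.a T) ≟ᶜ colour (LatticeTriangle.b T)
centre-corner ev abc         | yes e = inj₁ refl
centre-corner ev bca         | yes e = inj₁ e
centre-corner ev cab         | yes e = inj₂ refl
centre-corner (₁₂ p) _       | no ¬e = contradiction p ¬e
centre-corner (₂₃ p) abc     | no ¬e = inj₂ (sym p)
centre-corner (₁₃ p) abc     | no ¬e = inj₁ (sym p)
centre-corner _      bca     | no ¬e = inj₂ refl
centre-corner _      cab     | no ¬e = inj₁ refl

centre-OnLine : ∀ {T x y z} e → EvenTriangle T → Rotation T x y z → e · lift x ≡ + 0 → e · lift y ≡ + 0 → OnLine e (centre T)
centre-OnLine {x = x} {y} e ev ρ ex ey with centre-corner ev ρ
... | inj₁ p = x , ex , sym p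
... | inj₂ p = y , ey , sym p

-- Colours of rational points, and walks along segments

lattice? : ∀ h → Dec (∃ (IsLattice h))
lattice? (x , y , d) with d ℤ.∣? x | d ℤ.∣? y
... | yes (ℤ.divides p e) | yes (ℤ.divides q e′) = yes ((p , q) ,
  cong₃ (trans e (ℤ.*-comm p d)) (trans e′ (ℤ.*-comm q d)) (sym (ℤ.*-identityʳ d)))
... | no ¬p | _     = no λ ((p , q) , e) → ¬p (ℤ.divides p (trans (cong proj₁ e) (ℤ.*-comm d p)))
... | yes _ | no ¬q = no λ ((p , q) , e) → ¬q (ℤ.divides q (trans (cong (λ h → proj₁ (proj₂ h)) e) (ℤ.*-comm d q)))

lattice-unique : ∀ h x y → + 0 ℤ.< third h → IsLattice h x → IsLattice h y → x ≡ y
lattice-unique h x y h₃ p q = cong (λ h → proj₁ h , proj₁ (proj₂ h)) (⊛-cancel (lift x) (lift y) h₃ (trans (sym p) q))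

lattice-on : ∀ e h x → + 0 ℤ.< third h → IsLattice h x → e · h ≡ + 0 → e · lift x ≡ + 0
lattice-on e h x h₃ p eh = *-≡0 h₃ (trans (ℤ.*-comm (e · lift x) (third h))
  (trans (sym (·-⊛ʳ e (third h) (lift x))) (trans (cong (e ·_) (sym p)) eh)))

-- The first tile of the list that contains h is consulted; `same-transition` shows that another
-- choice has the same effect on walks. The colour `A` is a default for points outside all tiles.
centreAt : List LatticeTriangle → ℤ³ → Colour
centreAt []       h = A
centreAt (T ∷ Ts) h with closedAt? T h
... | yes _ = centre T
... | no _  = centreAt Ts h

centreAt-spec : ∀ {Ts h} → Any (λ T → ClosedAt T h) Ts →
                ∃ λ T → T ∈ Ts × ClosedAt T h × centreAt Ts h ≡ centre T
centreAt-spec {T ∷ Ts} {h} any with closedAt? T h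
... | yes c = T , here refl , c , refl
centreAt-spec (here c)    | no ¬c = contradiction c ¬c
centreAt-spec (there any) | no ¬c with centreAt-spec any
... | T , T∈ , c , e = T , there T∈ , c , e

-- The points at which segments are cut need not be lattice points, but the walks have to pass
-- through some colour there. On an edge or on the boundary, the centre of a tile is still a colour
-- of that line.
label : List LatticeTriangle → ℤ³ → Colour
label Ts h with lattice? h
... | yes (z , _) = colour z
... | no _        = centreAt Ts h

label-lattice : ∀ Ts h z → + 0 ℤ.< third h → IsLattice h z → label Ts h ≡ colour z
label-lattice Ts h z h₃ p with lattice? h
... | yes (z′ , p′) = cong colour (lattice-unique h z′ z h₃ p′ p)
... | no ¬p = contradiction (z , p) ¬p

-- If ℓ has opposite signs at p and q, this is the point where ℓ crosses the segment between them.
cut : ℤ³ → ℤ³ → ℤ³ → ℤ³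
cut ℓ p q = + ∣ ℓ · p ∣ ⊛ q ⊕ + ∣ ℓ · q ∣ ⊛ p

-- The colour of p itself is left out, so that consecutive walks can be concatenated.

walk : List LatticeTriangle → List ℤ³ → ℤ³ → ℤ³ → List Colour
walk Ts []      p q = centreAt Ts (p ⊕ q) ∷ label Ts q ∷ []
walk Ts (ℓ ∷ L) p q with ℓ · p ℤ.* (ℓ · q) ℤ.<? + 0
... | yes _ = walk Ts L p (cut ℓ p q) ++ walk Ts L (cut ℓ p q) q
... | no _  = walk Ts L p q

-- Reduced walks that have arrived at the colour X; on these, moving along a segment acts by
-- homotopy classes.
record On (X : Colour) (s : List Colour) : Set where
  constructor stacked
  field
    reduced : Reduced s
    top     : ∃ λ r → s ≡ X ∷ r

run-reduced : ∀ w {s} → Reduced s → Reduced (run w s)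
run-reduced []      r = r
run-reduced (x ∷ w) r = run-reduced w (push-reduced x r)

push-On : ∀ {X s} Y → On X s → On Y (push Y s)
push-On {X} {s} Y (stacked r _) = stacked (push-reduced Y r) (push-top Y s)

push-repeats′ : ∀ {X s} Y Z → On X s → Repeats X Y Z → push Z (push Y s) ≡ push Z s
push-repeats′ {X} Y Z (stacked r (_ , refl)) = push-repeats X Y Z r

push-back′ : ∀ {X s} Y → On X s → push X (push Y s) ≡ s
push-back′ {X} Y (stacked r (_ , refl)) = push-back X Y r

push-same′ : ∀ {X s} → On X s → push X s ≡ s
push-same′ {X} (stacked _ (r , refl)) = push-same X r

-- Dissections seen from homogeneous points

module _ (P : ConvexLatticePolygon) where

  boundary : Fin (size P) → ℤ³
  boundary i = form (vertex P i) (vertex P (next i))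

  record InPolygon (h : ℤ³) : Set where
    constructor inPolygon
    field
      finite : + 0 ℤ.< third h
      inner  : ∀ i → + 0 ℤ.≤ boundary i · h

  -- The trace of an even dissection on the rational points. No real numbers occur any more, and all
  -- signs are decidable.
  record Tiling (Ts : List LatticeTriangle) : Set where
    field
      covers  : ∀ h → InPolygon h → Any (λ T → ClosedAt T h) Ts
      apart   : AllPairs DisjointAt Ts
      corner≥ : ∀ i → All (λ T → All (0≤ boundary i on_) (corners T)) Ts
      even    : All EvenTriangle Ts

closed⇒closedAt : ∀ T h h₃ → Closed T (rational h h₃) → ClosedAt T h
closed⇒closedAt T h h₃ (ab , bc , ca) = closedAt
  (0≤at⇒0≤· {h} {h₃} (side⇒0≤ a b (rational h h₃) ab) , 0≤at⇒0≤· {h} {h₃} (side⇒0≤ b c (rational h h₃) bc) ,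
   0≤at⇒0≤· {h} {h₃} (side⇒0≤ c a (rational h h₃) ca))
  where open LatticeTriangle T using (a; b; c)

closedAt⇒closed : ∀ T h h₃ → ClosedAt T h → Closed T (rational h h₃)
closedAt⇒closed T h h₃ (closedAt (ab , bc , ca)) =
  0≤⇒side a b (rational h h₃) (0≤·⇒0≤at {h} {h₃} ab) , 0≤⇒side b c (rational h h₃) (0≤·⇒0≤at {h} {h₃} bc) ,
  0≤⇒side c a (rational h h₃) (0≤·⇒0≤at {h} {h₃} ca)
  where open LatticeTriangle T using (a; b; c)

interiorAt⇒interior : ∀ T h h₃ → InteriorAt T h → Interior T (rational h h₃)
interiorAt⇒interior T h h₃ (interiorAt (ab , bc , ca)) =
  0<⇒side a b (rational h h₃) (0<·⇒0<at {h} {h₃} ab) , 0<⇒side b c (rational h h₃) (0<·⇒0<at {h} {h₃} bc) ,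
  0<⇒side c a (rational h h₃) (0<·⇒0<at {h} {h₃} ca)
  where open LatticeTriangle T using (a; b; c)

corner-closedAt : ∀ T → All (λ z → ClosedAt T (lift z)) (corners T)
corner-closedAt T =
  closedAt (0≤form-start a b , 0≤form {b} {c} {a} (ℤ.<⇒≤ bca>0) , 0≤form-end c a) ∷
  closedAt (0≤form-end a b , 0≤form-start b c , 0≤form {c} {a} {b} (ℤ.<⇒≤ cab>0)) ∷
  closedAt (0≤form {a} {b} {c} (ℤ.<⇒≤ counterclockwise) , 0≤form-end b c , 0≤form-start c a) ∷ []
  where
  open LatticeTriangle T using (a; b; c; counterclockwise)
  bca>0 = 0<-rotate a b c counterclockwise
  cab>0 = 0<-rotate b c a bca>0

-- Membership of a rational point in a tile is decidable, which removes the double negation from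
-- `union`.
dissection⇒tiling : ∀ P Ts → Dissects P Ts → All HasIntegerArea Ts → Tiling P Ts
dissection⇒tiling P Ts d areas = record
  { covers  = λ h ip → decidable-stable (Any.any? (λ T → closedAt? T h) Ts) λ k →
      cover dc (rational h (InPolygon.finite ip)) (region h ip) λ any →
        k (Any.map (λ {T} → closed⇒closedAt T h (InPolygon.finite ip)) any)
  ; apart   = AllPairs.map (λ {S} {T} dis h h₃ i j → dis (rational h h₃) (interiorAt⇒interior S h h₃ i , interiorAt⇒interior T h h₃ j))
      (disjoint dc)
  ; corner≥ = λ i → All.map (λ {T} w → All.map (λ {z} ca →
      0≤at⇒0≤· {lift z} {ℤ.+<+ z<s} (side⇒0≤ (vertex P i) (vertex P (next i)) (rational (lift z) (ℤ.+<+ z<s))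
        (w (rational (lift z) (ℤ.+<+ z<s)) (closedAt⇒closed T (lift z) (ℤ.+<+ z<s) ca) i))) (corner-closedAt T)) (within dc)
  ; even    = All.map (λ {T} (k , e) → let open LatticeTriangle T in
      even-det⇒repeats a b c k (half≡integer⇒ (det a b c) k e)) areas
  }
  where
  dc = dissects⇒cuts {P} d
  region : ∀ h ip → Region P (rational h (InPolygon.finite {P} ip))
  region h (inPolygon h₃ inn) i = 0≤⇒side (vertex P i) (vertex P (next i)) (rational h h₃) (0≤·⇒0≤at {h} {h₃} (inn i))

AllPairs-lookup : {V : Set} {R : V → V → Set} {xs : List V} {x y : V} →
                  AllPairs R xs → x ∈ xs → y ∈ xs → x ≡ y ⊎ R x y ⊎ R y x
AllPairs-lookup (_ ∷ _)  (here refl) (here refl) = inj₁ refl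
AllPairs-lookup (r ∷ _)  (here refl) (there y∈)  = inj₂ (inj₁ (All.lookup r y∈))
AllPairs-lookup (r ∷ _)  (there x∈)  (here refl) = inj₂ (inj₂ (All.lookup r x∈))
AllPairs-lookup (_ ∷ rs) (there x∈)  (there y∈)  = AllPairs-lookup rs x∈ y∈

form-start : ∀ x y → form x y · lift x ≡ + 0
form-start x y = trans (form-lift x y x) (det-start x y)

form-end : ∀ x y → form x y · lift y ≡ + 0
form-end x y = trans (form-lift x y y) (det-end x y)

-- Lines that separate points

Opposite : ℤ → ℤ → Set
Opposite i j = i ℤ.* j ℤ.< + 0

*-neg-pos : ∀ {i j} → i ℤ.< + 0 → + 0 ℤ.< j → Opposite i j
*-neg-pos { -[1+ _ ]} {+ suc _} _ _ = ℤ.-<+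
*-neg-pos {_} {+ 0} _ (ℤ.+<+ ())
*-neg-pos {+ _} {_} (ℤ.+<+ ()) _

opposite-signs : ∀ i j → Opposite i j → (+ 0 ℤ.< i × j ℤ.< + 0) ⊎ (i ℤ.< + 0 × + 0 ℤ.< j)
opposite-signs i j h with ℤ.<-cmp (+ 0) i | ℤ.<-cmp (+ 0) j
... | tri≈ _ refl _ | _ = contradiction h (ℤ.<-irrefl refl)
... | tri< _ _ _ | tri≈ _ refl _ = contradiction (subst (ℤ._< + 0) (ℤ.*-zeroʳ i) h) (ℤ.<-irrefl refl)
... | tri> _ _ _ | tri≈ _ refl _ = contradiction (subst (ℤ._< + 0) (ℤ.*-zeroʳ i) h) (ℤ.<-irrefl refl)
... | tri< p _ _ | tri< q _ _ = contradiction h (ℤ.<-asym (*-positive p q))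
... | tri< p _ _ | tri> _ _ q = inj₁ (p , q)
... | tri> _ _ p | tri< q _ _ = inj₂ (p , q)
... | tri> _ _ p | tri> _ _ q = contradiction h (ℤ.<-asym (subst (+ 0 ℤ.<_) (lemma i j) (*-positive (ℤ.neg-mono-< p) (ℤ.neg-mono-< q))))
  where
  lemma : ∀ i j → (ℤ.- i) ℤ.* (ℤ.- j) ≡ i ℤ.* j
  lemma = solve-∀

not-all-opposite : ∀ i j k → Opposite i j → Opposite j k → ¬ Opposite i k
not-all-opposite i j k p q r with opposite-signs i j p | opposite-signs j k q | opposite-signs i k r
... | inj₁ (_ , a) | inj₁ (b , _) | _ = ℤ.<-asym a b
... | inj₁ (a , _) | inj₂ _ | inj₂ (b , _) = ℤ.<-asym a b
... | inj₁ _ | inj₂ (_ , a) | inj₁ (_ , b) = ℤ.<-asym a b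
... | inj₂ (_ , a) | inj₂ (b , _) | _ = ℤ.<-asym a b
... | inj₂ (a , _) | inj₁ _ | inj₁ (b , _) = ℤ.<-asym a b
... | inj₂ _ | inj₁ (_ , a) | inj₂ (_ , b) = ℤ.<-asym a b

cut-zero : ∀ i j → Opposite i j → + ∣ i ∣ ℤ.* j ℤ.+ + ∣ j ∣ ℤ.* i ≡ + 0
cut-zero (+ m) -[1+ n ] _ = lemma (+ m) (+ suc n)
  where
  lemma : ∀ x y → x ℤ.* (ℤ.- y) ℤ.+ y ℤ.* x ≡ + 0
  lemma = solve-∀
cut-zero -[1+ m ] (+ n) _ = lemma (+ suc m) (+ n)
  where
  lemma : ∀ x y → x ℤ.* y ℤ.+ y ℤ.* (ℤ.- x) ≡ + 0
  lemma = solve-∀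
cut-zero (+ m) (+ n) h = contradiction h (ℤ.≤⇒≯ (*-nonneg (ℤ.+≤+ (z≤n {m})) (ℤ.+≤+ (z≤n {n}))))
cut-zero -[1+ m ] -[1+ n ] (ℤ.+<+ ())

∣∣-positive : ∀ i j → Opposite i j → + 0 ℤ.< + ∣ i ∣
∣∣-positive (+ suc n) j h = ℤ.+<+ z<s
∣∣-positive (+ zero) j h = contradiction h (ℤ.<-irrefl refl)
∣∣-positive -[1+ n ] j h = ℤ.+<+ z<s

Positive₃ : ℤ³ → (x y z : ℤ³) → Set
Positive₃ φ x y z = + 0 ℤ.≤ φ · x × + 0 ℤ.≤ φ · y × + 0 ℤ.≤ φ · z

OneSided : ℤ³ → (x y z : ℤ³) → Set
OneSided φ x y z = Positive₃ φ x y z ⊎ Positive₃ (⊖ φ) x y z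

·-⊖ˡ : ∀ φ h → (⊖ φ) · h ≡ ℤ.- (φ · h)
·-⊖ˡ φ h = trans (·-comm (⊖ φ) h) (trans (·-⊖ʳ h φ) (cong ℤ.-_ (·-comm h φ)))

⊖-nonneg : ∀ φ h → φ · h ℤ.≤ + 0 → + 0 ℤ.≤ (⊖ φ) · h
⊖-nonneg φ h le = subst (+ 0 ℤ.≤_) (sym (·-⊖ˡ φ h)) (ℤ.neg-mono-≤ le)

⊖-nonpos : ∀ φ h → + 0 ℤ.≤ (⊖ φ) · h → φ · h ℤ.≤ + 0
⊖-nonpos φ h le = subst (ℤ._≤ + 0) (trans (cong ℤ.-_ (·-⊖ˡ φ h)) (ℤ.neg-involutive (φ · h))) (ℤ.neg-mono-≤ le)

one-sided : ∀ φ x y z → ¬ Opposite (φ · x) (φ · y) → ¬ Opposite (φ · y) (φ · z) → ¬ Opposite (φ · x) (φ · z) → OneSided φ x y z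
one-sided φ x y z xy yz xz = go (ℤ.<-cmp (+ 0) (φ · x)) (ℤ.<-cmp (+ 0) (φ · y))
  where
  after-pos : ∀ {i j} → + 0 ℤ.< i → ¬ Opposite i j → + 0 ℤ.≤ j
  after-pos {i} {j} p h = ℤ.≮⇒≥ λ n → h (subst (ℤ._< + 0) (ℤ.*-comm j i) (*-neg-pos n p))
  after-neg : ∀ {i j} → i ℤ.< + 0 → ¬ Opposite i j → j ℤ.≤ + 0
  after-neg n h = ℤ.≮⇒≥ λ p → h (*-neg-pos n p)
  go : _ → _ → OneSided φ x y z
  go (tri< p _ _) _ = inj₁ (ℤ.<⇒≤ p , after-pos p xy , after-pos p xz)
  go (tri> _ _ n) _ = inj₂ (⊖-nonneg φ x (ℤ.<⇒≤ n) , ⊖-nonneg φ y (after-neg n xy) , ⊖-nonneg φ z (after-neg n xz))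
  go (tri≈ _ e _) (tri< p _ _) = inj₁ (ℤ.≤-reflexive e , ℤ.<⇒≤ p , after-pos p yz)
  go (tri≈ _ e _) (tri> _ _ n) = inj₂ (⊖-nonneg φ x (ℤ.≤-reflexive (sym e)) , ⊖-nonneg φ y (ℤ.<⇒≤ n) , ⊖-nonneg φ z (after-neg n yz))
  go (tri≈ _ e _) (tri≈ _ e′ _) with ℤ.≤-total (+ 0) (φ · z)
  ... | inj₁ p = inj₁ (ℤ.≤-reflexive e , ℤ.≤-reflexive e′ , p)
  ... | inj₂ n = inj₂ (⊖-nonneg φ x (ℤ.≤-reflexive (sym e)) , ⊖-nonneg φ y (ℤ.≤-reflexive (sym e′)) , ⊖-nonneg φ z n)

zeroˡ-¬opposite : ∀ {i j} → i ≡ + 0 → ¬ Opposite i j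
zeroˡ-¬opposite refl = ℤ.<-irrefl refl

zeroʳ-¬opposite : ∀ {i j} → j ≡ + 0 → ¬ Opposite i j
zeroʳ-¬opposite {i} refl h = ℤ.<-irrefl refl (subst (ℤ._< + 0) (ℤ.*-zeroʳ i) h)

+-nonnegˡ : ∀ {i j} → + 0 ℤ.≤ i ℤ.+ j → j ℤ.≤ + 0 → + 0 ℤ.≤ i
+-nonnegˡ {i} {j} h le = ℤ.≤-trans h (subst (i ℤ.+ j ℤ.≤_) (ℤ.+-identityʳ i) (ℤ.+-monoʳ-≤ i le))

+-nonnegʳ : ∀ {i j} → + 0 ℤ.≤ i ℤ.+ j → i ℤ.≤ + 0 → + 0 ℤ.≤ j
+-nonnegʳ {i} {j} h le = +-nonnegˡ (subst (+ 0 ℤ.≤_) (ℤ.+-comm i j) h) le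

-- If the three values are nonpositive with a nonnegative sum, they vanish.
one-sided-sum : ∀ φ x y z → OneSided φ x y z → + 0 ℤ.≤ φ · (x ⊕ y ⊕ z) → Positive₃ φ x y z
one-sided-sum φ x y z (inj₁ p) _ = p
one-sided-sum φ x y z (inj₂ (x≤ , y≤ , z≤)) s =
  +-nonnegˡ xy≥ (⊖-nonpos φ y y≤) , +-nonnegʳ {φ · x} xy≥ (⊖-nonpos φ x x≤) ,
  +-nonnegʳ {φ · x ℤ.+ φ · y} s′ (ℤ.+-mono-≤ (⊖-nonpos φ x x≤) (⊖-nonpos φ y y≤))
  where
  s′ : + 0 ℤ.≤ φ · x ℤ.+ φ · y ℤ.+ φ · z
  s′ = subst (+ 0 ℤ.≤_) (trans (·-⊕ʳ φ (x ⊕ y) z) (cong (ℤ._+ φ · z) (·-⊕ʳ φ x y))) s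
  xy≥ : + 0 ℤ.≤ φ · x ℤ.+ φ · y
  xy≥ = +-nonnegˡ s′ (⊖-nonpos φ z z≤)

one-sided-sum₂ : ∀ φ x y z → OneSided φ x y z → + 0 ℤ.≤ φ · (x ⊕ y) → + 0 ℤ.≤ φ · x × + 0 ℤ.≤ φ · y
one-sided-sum₂ φ x y z (inj₁ (p , q , _)) _ = p , q
one-sided-sum₂ φ x y z (inj₂ (x≤ , y≤ , _)) s =
  +-nonnegˡ s′ (⊖-nonpos φ y y≤) , +-nonnegʳ {φ · x} s′ (⊖-nonpos φ x x≤)
  where
  s′ : + 0 ℤ.≤ φ · x ℤ.+ φ · y
  s′ = subst (+ 0 ℤ.≤_) (·-⊕ʳ φ x y) s

one-sided-rotate : ∀ φ x y z → OneSided φ x y z → OneSided φ y z x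
one-sided-rotate φ x y z (inj₁ (p , q , r)) = inj₁ (q , r , p)
one-sided-rotate φ x y z (inj₂ (p , q , r)) = inj₂ (q , r , p)

one-sided-swap : ∀ φ x y z → OneSided φ x y z → OneSided φ x z y
one-sided-swap φ x y z (inj₁ (p , q , r)) = inj₁ (p , r , q)
one-sided-swap φ x y z (inj₂ (p , q , r)) = inj₂ (p , r , q)

-- The cone spanned by p, q and r, described dually by forms; in this way its points inherit
-- `OneSided` at once.
Cone : (p q r h : ℤ³) → Set
Cone p q r h = ∀ φ → Positive₃ φ p q r → + 0 ℤ.≤ φ · h

cone-one-sided : ∀ {p q r x y z} → Cone p q r x → Cone p q r y → Cone p q r z → ∀ φ → OneSided φ p q r → OneSided φ x y z
cone-one-sided x y z φ (inj₁ h) = inj₁ (x φ h , y φ h , z φ h)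
cone-one-sided x y z φ (inj₂ h) = inj₂ (x (⊖ φ) h , y (⊖ φ) h , z (⊖ φ) h)

·-cut : ∀ φ ℓ p q → φ · cut ℓ p q ≡ + ∣ ℓ · p ∣ ℤ.* (φ · q) ℤ.+ + ∣ ℓ · q ∣ ℤ.* (φ · p)
·-cut φ ℓ p q = trans (·-⊕ʳ φ (+ ∣ ℓ · p ∣ ⊛ q) (+ ∣ ℓ · q ∣ ⊛ p)) (cong₂ ℤ._+_ (·-⊛ʳ φ (+ ∣ ℓ · p ∣) q) (·-⊛ʳ φ (+ ∣ ℓ · q ∣) p))

cut-nonneg : ∀ φ ℓ p q → + 0 ℤ.≤ φ · p → + 0 ℤ.≤ φ · q → + 0 ℤ.≤ φ · cut ℓ p q
cut-nonneg φ ℓ p q hp hq = subst (+ 0 ℤ.≤_) (sym (·-cut φ ℓ p q))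
  (ℤ.+-mono-≤ (*-nonneg (ℤ.+≤+ (z≤n {∣ ℓ · p ∣})) hq) (*-nonneg (ℤ.+≤+ (z≤n {∣ ℓ · q ∣})) hp))

cut-on : ∀ ℓ p q → Opposite (ℓ · p) (ℓ · q) → ℓ · cut ℓ p q ≡ + 0
cut-on ℓ p q h = trans (·-cut ℓ ℓ p q) (cut-zero (ℓ · p) (ℓ · q) h)

cut-preserves-line : ∀ φ ℓ p q → φ · p ≡ + 0 → φ · q ≡ + 0 → φ · cut ℓ p q ≡ + 0
cut-preserves-line φ ℓ p q hp hq = trans (·-cut φ ℓ p q)
  (cong₂ ℤ._+_ (trans (cong (+ ∣ ℓ · p ∣ ℤ.*_) hq) (ℤ.*-zeroʳ (+ ∣ ℓ · p ∣)))
               (trans (cong (+ ∣ ℓ · q ∣ ℤ.*_) hp) (ℤ.*-zeroʳ (+ ∣ ℓ · q ∣))))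

lines : List LatticeTriangle → List ℤ³
lines []       = []
lines (T ∷ Ts) = form a b ∷ form b c ∷ form c a ∷ lines Ts
  where open LatticeTriangle T using (a; b; c)

∈-lines : ∀ {T Ts} → T ∈ Ts → Edges T (_∈ lines Ts)
∈-lines (here refl) = here refl , there (here refl) , there (there (here refl))
∈-lines (there T∈) with ∈-lines T∈
... | p , q , r = there (there (there p)) , there (there (there q)) , there (there (there r))

another : ∀ {n} → 3 ℕ.≤ n → (i k : Fin n) → ∃ λ j → j ≢ i × j ≢ k
another {suc (suc (suc n))} _ zero          zero          = suc zero , (λ ()) , λ ()
another {suc (suc (suc n))} _ zero          (suc zero)    = suc (suc zero) , (λ ()) , λ ()
another {suc (suc (suc n))} _ zero          (suc (suc _)) = suc zero , (λ ()) , λ ()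
another {suc (suc (suc n))} _ (suc zero)    zero          = suc (suc zero) , (λ ()) , λ ()
another {suc (suc (suc n))} _ (suc (suc _)) zero          = suc zero , (λ ()) , λ ()
another {suc (suc (suc n))} _ (suc _)       (suc _)       = zero , (λ ()) , λ ()
another {suc zero} (s≤s ())
another {suc (suc zero)} (s≤s (s≤s ()))

closedAt-⊕ : ∀ {T p q} → ClosedAt T p → ClosedAt T q → ClosedAt T (p ⊕ q)
closedAt-⊕ {T} {p} {q} (closedAt (h₁ , h₂ , h₃)) (closedAt (k₁ , k₂ , k₃)) = closedAt
  (sum (form a b) h₁ k₁ , sum (form b c) h₂ k₂ , sum (form c a) h₃ k₃)
  where
  open LatticeTriangle T using (a; b; c)
  sum : ∀ φ → + 0 ℤ.≤ φ · p → + 0 ℤ.≤ φ · q → + 0 ℤ.≤ φ · (p ⊕ q)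
  sum φ h k = subst (+ 0 ℤ.≤_) (sym (·-⊕ʳ φ p q)) (ℤ.+-mono-≤ h k)

BoundaryEdge : ConvexLatticePolygon → LatticePoint → LatticePoint → Set
BoundaryEdge P x y = ∃ λ i → x ≡ vertex P i × y ≡ vertex P (next i)

-- Holonomy in a tiling of the polygon

module _ (P : ConvexLatticePolygon) (Ts : List LatticeTriangle) (τ : Tiling P Ts) where

  open Tiling τ
  open InPolygon

  private
    InP = InPolygon P
    lab = label Ts

  InP-⊕ : ∀ {p q} → InP p → InP q → InP (p ⊕ q)
  InP-⊕ {p} {q} ip iq = inPolygon (ℤ.+-mono-< (finite ip) (finite iq))
    λ i → subst (+ 0 ℤ.≤_) (sym (·-⊕ʳ (boundary P i) p q)) (ℤ.+-mono-≤ (inner ip i) (inner iq i))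

  InP-cut : ∀ ℓ {p q} → Opposite (ℓ · p) (ℓ · q) → InP p → InP q → InP (cut ℓ p q)
  InP-cut ℓ {p} {q} opp ip iq = inPolygon
    (ℤ.+-mono-<-≤ (*-positive (∣∣-positive (ℓ · p) (ℓ · q) opp) (finite iq)) (*-nonneg (ℤ.+≤+ (z≤n {∣ ℓ · q ∣})) (ℤ.<⇒≤ (finite ip))))
    λ i → cut-nonneg (boundary P i) ℓ p q (inner ip i) (inner iq i)

  same-or-apart : ∀ {S T} → S ∈ Ts → T ∈ Ts → S ≡ T ⊎ DisjointAt S T
  same-or-apart S∈ T∈ with AllPairs-lookup apart S∈ T∈
  ... | inj₁ e        = inj₁ e
  ... | inj₂ (inj₁ d) = inj₂ d
  ... | inj₂ (inj₂ d) = inj₂ λ h h₃ i j → d h h₃ j i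

  non-lattice⇒non-corner : ∀ {T h} → ClosedAt T h → (∀ z → ¬ IsLattice h z) → NonCorner T h
  non-lattice⇒non-corner t ¬l with locate t
  ... | inj₁ n = n
  ... | inj₂ (corner ρ e e′) = contradiction (corner⇒lattice ρ e e′) (¬l _)

  -- If h is not a lattice point, its label is the centre of some tile S. As h is no corner, either
  -- S is T or S has an edge on the same line by `common-line`, and the centre of S occurs on its
  -- edges.
  label-OnLine : ∀ {T x y z h} → T ∈ Ts → Rotation T x y z → InP h → ClosedAt T h → form x y · h ≡ + 0 →
                 OnLine (form x y) (lab h)
  label-OnLine {T} {x} {y} {z} {h} T∈ ρ ip t e with lattice? h
  ... | yes (v , p) = v , lattice-on (form x y) h v (finite ip) p e , refl
  ... | no ¬l with centreAt-spec (covers h ip)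
  ... | S , S∈ , s , eq with same-or-apart T∈ S∈
  ... | inj₁ refl = subst (OnLine (form x y)) (sym eq)
        (centre-OnLine (form x y) (All.lookup even T∈) ρ (form-start x y) (form-end x y))
  ... | inj₂ d with common-line d h (finite ip) t s (non-lattice⇒non-corner t λ z p → ¬l (z , p)) (non-lattice⇒non-corner s λ z p → ¬l (z , p))
  ... | cl = subst (OnLine (form x y)) (sym eq) (subst (λ φ → OnLine φ (centre S)) (sym (same-edge ρ (CommonLine.ρ cl) e off₁ off₂))
        (centre-OnLine (form (CommonLine.x cl) (CommonLine.y cl)) (All.lookup even S∈) σ x′-on y′-on))
    where open CommonLine cl using (off₁; off₂; σ; x′-on; y′-on)

  -- Corners are extreme points: two edge forms vanish at the sum and are nonnegative at p and q, so
  -- they vanish at both, and p and q are that corner.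
  corner-labels : ∀ {T p q} → InP p → InP q → ClosedAt T p → ClosedAt T q → Corner T (p ⊕ q) → lab p ≡ lab q
  corner-labels {T} {p} {q} ip iq tp tq (corner {x} {y} {z} ρ e e′) =
    trans (label-lattice Ts p x (finite ip) (corner⇒lattice ρ (zeroˡ (form x y) xy≥p xy≥q e) (zeroˡ (form z x) zx≥p zx≥q e′)))
          (sym (label-lattice Ts q x (finite iq) (corner⇒lattice ρ (zeroʳ (form x y) xy≥p xy≥q e) (zeroʳ (form z x) zx≥p zx≥q e′))))
    where
    zeroˡ : ∀ φ → + 0 ℤ.≤ φ · p → + 0 ℤ.≤ φ · q → φ · (p ⊕ q) ≡ + 0 → φ · p ≡ + 0
    zeroˡ φ hp hq e = +-≡0ˡ hp hq (trans (sym (·-⊕ʳ φ p q)) e)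
    zeroʳ : ∀ φ → + 0 ℤ.≤ φ · p → + 0 ℤ.≤ φ · q → φ · (p ⊕ q) ≡ + 0 → φ · q ≡ + 0
    zeroʳ φ hp hq e = +-≡0ʳ hp hq (trans (sym (·-⊕ʳ φ p q)) e)
    at-p = rotate-edges (λ φ → + 0 ℤ.≤ φ · p) ρ (ClosedAt.edges tp)
    at-q = rotate-edges (λ φ → + 0 ℤ.≤ φ · q) ρ (ClosedAt.edges tq)
    xy≥p = proj₁ at-p
    xy≥q = proj₁ at-q
    zx≥p = proj₂ (proj₂ at-p)
    zx≥q = proj₂ (proj₂ at-q)

  -- Two tiles that share a proper segment from p to q have edges on its line. Both centres and both
  -- labels are then among its at most two colours, so that either detour is homotopic to the direct
  -- move. If p + q is a corner, both detours are backtrackings.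
  same-transition : ∀ {S T p q s} → S ∈ Ts → T ∈ Ts → InP p → InP q → ClosedAt S p → ClosedAt S q →
                    ClosedAt T p → ClosedAt T q → On (lab p) s →
                    push (lab q) (push (centre S) s) ≡ push (lab q) (push (centre T) s)
  same-transition {S} {T} {p} {q} {s} S∈ T∈ ip iq sp sq tp tq o with same-or-apart S∈ T∈
  ... | inj₁ refl = refl
  ... | inj₂ d = go (locate (closedAt-⊕ sp sq)) (locate (closedAt-⊕ tp tq))
    where
    Goal : Set
    Goal = push (lab q) (push (centre S) s) ≡ push (lab q) (push (centre T) s)
    at-corner : lab p ≡ lab q → Goal
    at-corner e = trans (push-back′ (centre S) o′) (sym (push-back′ (centre T) o′))
      where
      o′ : On (lab q) s
      o′ = subst (λ X → On X s) e o
    go : NonCorner S (p ⊕ q) ⊎ Corner S (p ⊕ q) → NonCorner T (p ⊕ q) ⊎ Corner T (p ⊕ q) → Goal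
    go (inj₂ k) _        = at-corner (corner-labels ip iq sp sq k)
    go (inj₁ _) (inj₂ k) = at-corner (corner-labels ip iq tp tq k)
    go (inj₁ m) (inj₁ n) = trans (push-repeats′ (centre S) (lab q) o (along (centre-OnLine e (All.lookup even S∈) (CommonLine.ρ cl) (form-start x y) (form-end x y))))
                          (sym (push-repeats′ (centre T) (lab q) o (along (centre-OnLine e (All.lookup even T∈) σ x′-on y′-on))))
      where
      cl : CommonLine S T (p ⊕ q)
      cl = common-line d (p ⊕ q) (finite (InP-⊕ ip iq)) (closedAt-⊕ sp sq) (closedAt-⊕ tp tq) m n
      open CommonLine cl using (x; y; z; σ; x′-on; y′-on; on)
      e : ℤ³
      e = form x y
      split : e · p ℤ.+ e · q ≡ + 0
      split = trans (sym (·-⊕ʳ e p q)) on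
      p≥ : + 0 ℤ.≤ e · p
      p≥ = proj₁ (rotate-edges (λ φ → + 0 ℤ.≤ φ · p) (CommonLine.ρ cl) (ClosedAt.edges sp))
      q≥ : + 0 ℤ.≤ e · q
      q≥ = proj₁ (rotate-edges (λ φ → + 0 ℤ.≤ φ · q) (CommonLine.ρ cl) (ClosedAt.edges sq))
      along : ∀ {X} → OnLine e X → Repeats (lab p) X (lab q)
      along oX = OnLine-repeats e (form-nondegenerate x y z (rotation-det (CommonLine.ρ cl)))
        (label-OnLine S∈ (CommonLine.ρ cl) ip sp (+-≡0ˡ p≥ q≥ split)) oX
        (label-OnLine S∈ (CommonLine.ρ cl) iq sq (+-≡0ʳ p≥ q≥ split))

  walk-On : ∀ L p q {s} → Reduced s → On (lab q) (run (walk Ts L p q) s)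
  walk-On [] p q {s} r = stacked (push-reduced (lab q) (push-reduced (centreAt Ts (p ⊕ q)) r)) (push-top (lab q) (push (centreAt Ts (p ⊕ q)) s))
  walk-On (ℓ ∷ L) p q {s} r with ℓ · p ℤ.* (ℓ · q) ℤ.<? + 0
  ... | no _  = walk-On L p q r
  ... | yes _ = subst (On (lab q)) (sym (run-++ (walk Ts L p (cut ℓ p q)) (walk Ts L (cut ℓ p q) q) s))
                  (walk-On L (cut ℓ p q) q (On.reduced (walk-On L p (cut ℓ p q) r)))

  walk-cut : ∀ ℓ L p q s → Opposite (ℓ · p) (ℓ · q) →
             run (walk Ts (ℓ ∷ L) p q) s ≡ run (walk Ts L (cut ℓ p q) q) (run (walk Ts L p (cut ℓ p q)) s)
  walk-cut ℓ L p q s opp with ℓ · p ℤ.* (ℓ · q) ℤ.<? + 0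
  ... | yes _ = run-++ (walk Ts L p (cut ℓ p q)) (walk Ts L (cut ℓ p q) q) s
  ... | no ¬o = contradiction opp ¬o

  walk-uncut : ∀ ℓ L p q s → ¬ Opposite (ℓ · p) (ℓ · q) → run (walk Ts (ℓ ∷ L) p q) s ≡ run (walk Ts L p q) s
  walk-uncut ℓ L p q s ¬o with ℓ · p ℤ.* (ℓ · q) ℤ.<? + 0
  ... | yes o = contradiction o ¬o
  ... | no _  = refl

  walk-loop : ∀ L p {s} → On (lab p) s → run (walk Ts L p p) s ≡ s
  walk-loop []      p o = push-back′ (centreAt Ts (p ⊕ p)) o
  walk-loop (ℓ ∷ L) p {s} o = trans (walk-uncut ℓ L p p s
    λ opp → [ (λ (a , b) → ℤ.<-asym a b) , (λ (a , b) → ℤ.<-asym a b) ]′ (opposite-signs (ℓ · p) (ℓ · p) opp)) (walk-loop L p o)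

  -- Every line of the dissection that may separate p, q and r is still to
  -- be processed.

  Remaining : List ℤ³ → (p q r : ℤ³) → Set
  Remaining L p q r = ∀ φ → φ ∈ lines Ts → φ ∈ L ⊎ OneSided φ p q r

  -- The tile at p + q + r contains all three points, since its edges do not separate them.

  unseparated : ∀ {p q r} → InP p → InP q → InP r → Remaining [] p q r →
                ∃ λ T → T ∈ Ts × ClosedAt T p × ClosedAt T q × ClosedAt T r
  unseparated {p} {q} {r} ip iq ir rem = go (centreAt-spec (covers (p ⊕ q ⊕ r) (InP-⊕ (InP-⊕ ip iq) ir)))
    where
    positive : ∀ φ → φ ∈ lines Ts → + 0 ℤ.≤ φ · (p ⊕ q ⊕ r) → Positive₃ φ p q r
    positive φ m s with rem φ m
    ... | inj₁ ()
    ... | inj₂ o = one-sided-sum φ p q r o s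
    in-tile : ∀ T → Edges T (_∈ lines Ts) → ClosedAt T (p ⊕ q ⊕ r) → ClosedAt T p × ClosedAt T q × ClosedAt T r
    in-tile T (m₁ , m₂ , m₃) (closedAt (s₁ , s₂ , s₃)) =
      let (p₁ , q₁ , r₁) = positive (form a b) m₁ s₁
          (p₂ , q₂ , r₂) = positive (form b c) m₂ s₂
          (p₃ , q₃ , r₃) = positive (form c a) m₃ s₃
      in closedAt (p₁ , p₂ , p₃) , closedAt (q₁ , q₂ , q₃) , closedAt (r₁ , r₂ , r₃)
      where open LatticeTriangle T using (a; b; c)
    go : (∃ λ T → T ∈ Ts × ClosedAt T (p ⊕ q ⊕ r) × centreAt Ts (p ⊕ q ⊕ r) ≡ centre T) →
         ∃ λ T → T ∈ Ts × ClosedAt T p × ClosedAt T q × ClosedAt T r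
    go (T , T∈ , t , _) = T , T∈ , in-tile T (∈-lines T∈) t

  -- The same for the tile that `walk` consults at p + q. The point r only serves to express by
  -- `OneSided` that φ does not separate p and q.
  unseparated₂ : ∀ {p q} → InP p → InP q → (∀ φ → φ ∈ lines Ts → ∃ λ r → OneSided φ p q r) →
                 ∃ λ T → T ∈ Ts × ClosedAt T p × ClosedAt T q × centreAt Ts (p ⊕ q) ≡ centre T
  unseparated₂ {p} {q} ip iq rem = go (centreAt-spec (covers (p ⊕ q) (InP-⊕ ip iq)))
    where
    positive : ∀ φ → φ ∈ lines Ts → + 0 ℤ.≤ φ · (p ⊕ q) → + 0 ℤ.≤ φ · p × + 0 ℤ.≤ φ · q
    positive φ m s = one-sided-sum₂ φ p q (proj₁ (rem φ m)) (proj₂ (rem φ m)) s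
    in-tile : ∀ T → Edges T (_∈ lines Ts) → ClosedAt T (p ⊕ q) → ClosedAt T p × ClosedAt T q
    in-tile T (m₁ , m₂ , m₃) (closedAt (s₁ , s₂ , s₃)) =
      let (p₁ , q₁) = positive (form a b) m₁ s₁
          (p₂ , q₂) = positive (form b c) m₂ s₂
          (p₃ , q₃) = positive (form c a) m₃ s₃
      in closedAt (p₁ , p₂ , p₃) , closedAt (q₁ , q₂ , q₃)
      where open LatticeTriangle T using (a; b; c)
    go : (∃ λ T → T ∈ Ts × ClosedAt T (p ⊕ q) × centreAt Ts (p ⊕ q) ≡ centre T) →
         ∃ λ T → T ∈ Ts × ClosedAt T p × ClosedAt T q × centreAt Ts (p ⊕ q) ≡ centre T
    go (T , T∈ , t , e) = let (tp , tq) = in-tile T (∈-lines T∈) t in T , T∈ , tp , tq , e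

  Homotopic : List ℤ³ → (p q r : ℤ³) → Set
  Homotopic L p q r = ∀ {s} → On (lab p) s → run (walk Ts L q r) (run (walk Ts L p q) s) ≡ run (walk Ts L p r) s

  OneSided₂ : ℤ³ → ℤ³ → Set
  OneSided₂ x y = ∀ φ → φ ∈ lines Ts → ∃ λ z → OneSided φ x y z

  direct : ∀ {T x y s} → T ∈ Ts → InP x → InP y → OneSided₂ x y → ClosedAt T x → ClosedAt T y → On (lab x) s →
           push (lab y) (push (centreAt Ts (x ⊕ y)) s) ≡ push (lab y) (push (centre T) s)
  direct {T} {x} {y} {s} T∈ ix iy os tx ty o = go (unseparated₂ ix iy os)
    where
    go : (∃ λ S → S ∈ Ts × ClosedAt S x × ClosedAt S y × centreAt Ts (x ⊕ y) ≡ centre S) →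
         push (lab y) (push (centreAt Ts (x ⊕ y)) s) ≡ push (lab y) (push (centre T) s)
    go (S , S∈ , sx , sy , e) = trans (cong (λ X → push (lab y) (push X s)) e) (same-transition S∈ T∈ ix iy sx sy tx ty o)

  -- By `direct` all three segments may be taken through the centre of T, and then the visit to q is
  -- a backtracking.
  homotopic-in-tile : ∀ {T p q r} → T ∈ Ts → InP p → InP q → InP r → (∀ φ → φ ∈ lines Ts → OneSided φ p q r) →
                      ClosedAt T p → ClosedAt T q → ClosedAt T r → Homotopic [] p q r
  homotopic-in-tile {T} {p} {q} {r} T∈ ip iq ir os tp tq tr {s} o = begin
    push (lab r) (push (centreAt Ts (q ⊕ r)) (push (lab q) (push (centreAt Ts (p ⊕ q)) s)))
      ≡⟨ cong (λ u → push (lab r) (push (centreAt Ts (q ⊕ r)) u)) (direct T∈ ip iq pq tp tq o) ⟩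
    push (lab r) (push (centreAt Ts (q ⊕ r)) (push (lab q) (push (centre T) s)))
      ≡⟨ direct T∈ iq ir qr tq tr (push-On (lab q) (push-On (centre T) o)) ⟩
    push (lab r) (push (centre T) (push (lab q) (push (centre T) s)))
      ≡⟨ cong (push (lab r)) (push-back′ (lab q) (push-On (centre T) o)) ⟩
    push (lab r) (push (centre T) s)
      ≡⟨ direct T∈ ip ir pr tp tr o ⟨
    push (lab r) (push (centreAt Ts (p ⊕ r)) s) ∎
    where
    open ≡-Reasoning
    pq : OneSided₂ p q
    pq φ m = r , os φ m
    qr : OneSided₂ q r
    qr φ m = p , one-sided-rotate φ p q r (os φ m)
    pr : OneSided₂ p r
    pr φ m = q , one-sided-swap φ p q r (os φ m)

  homotopic-base : ∀ {p q r} → InP p → InP q → InP r → Remaining [] p q r → Homotopic [] p q r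
  homotopic-base {p} {q} {r} ip iq ir rem = go (unseparated ip iq ir rem)
    where
    one-sided-all : ∀ φ → φ ∈ lines Ts → OneSided φ p q r
    one-sided-all φ m with rem φ m
    ... | inj₁ ()
    ... | inj₂ o = o
    go : (∃ λ T → T ∈ Ts × ClosedAt T p × ClosedAt T q × ClosedAt T r) → Homotopic [] p q r
    go (T , T∈ , tp , tq , tr) = homotopic-in-tile T∈ ip iq ir one-sided-all tp tq tr

  -- The triangle p q r is subdivided so that ℓ crosses no side of the pieces, and their homotopies
  -- are composed. In the pieces ℓ is one-sided, and the lines treated before remain so because the
  -- pieces lie in the cone of p, q and r.
  homotopic : ∀ L {p q r} → InP p → InP q → InP r → Remaining L p q r → Homotopic L p q r
  homotopic []      ip iq ir rem = homotopic-base ip iq ir rem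
  homotopic (ℓ ∷ L) {p} {q} {r} ip iq ir rem {s} o =
    go (opposite? p q) (opposite? q r) (opposite? p r)
    where
    open ≡-Reasoning
    Opp : ℤ³ → ℤ³ → Set
    Opp x y = Opposite (ℓ · x) (ℓ · y)
    opposite? : ∀ x y → Dec (Opp x y)
    opposite? x y = ℓ · x ℤ.* (ℓ · y) ℤ.<? + 0
    W : ℤ³ → ℤ³ → List Colour → List Colour
    W x y = run (walk Ts L x y)
    W′ : ℤ³ → ℤ³ → List Colour → List Colour
    W′ x y = run (walk Ts (ℓ ∷ L) x y)
    on-W : ∀ {x y s} → On (lab x) s → On (lab y) (W x y s)
    on-W {x} {y} o = walk-On L x y (On.reduced o)

    record Inside (h : ℤ³) : Set where
      field
        inP  : InP h
        cone : Cone p q r h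
    open Inside

    p∈ : Inside p
    p∈ = record { inP = ip ; cone = λ φ → proj₁ }
    q∈ : Inside q
    q∈ = record { inP = iq ; cone = λ φ h → proj₁ (proj₂ h) }
    r∈ : Inside r
    r∈ = record { inP = ir ; cone = λ φ h → proj₂ (proj₂ h) }
    cut∈ : ∀ {x y} → Inside x → Inside y → Opp x y → Inside (cut ℓ x y)
    cut∈ {x} {y} x∈ y∈ opp = record
      { inP  = InP-cut ℓ opp (inP x∈) (inP y∈)
      ; cone = λ φ h → cut-nonneg φ ℓ x y (cone x∈ φ h) (cone y∈ φ h) }

    sub : ∀ {x y z} → Inside x → Inside y → Inside z → ¬ Opp x y → ¬ Opp y z → ¬ Opp x z → Homotopic L x y z
    sub {x} {y} {z} x∈ y∈ z∈ xy yz xz = homotopic L (inP x∈) (inP y∈) (inP z∈) remaining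
      where
      remaining : Remaining L x y z
      remaining φ m with rem φ m
      ... | inj₁ (here refl) = inj₂ (one-sided φ x y z xy yz xz)
      ... | inj₁ (there m′)  = inj₁ m′
      ... | inj₂ os          = inj₂ (cone-one-sided (cone x∈) (cone y∈) (cone z∈) φ os)

    zˡ : ∀ {x y z} → Opp x y → ¬ Opp (cut ℓ x y) z
    zˡ {x} {y} opp = zeroˡ-¬opposite (cut-on ℓ x y opp)
    zʳ : ∀ {x y z} → Opp x y → ¬ Opp z (cut ℓ x y)
    zʳ {x} {y} {z} opp = zeroʳ-¬opposite {ℓ · z} (cut-on ℓ x y opp)

    go : Dec (Opp p q) → Dec (Opp q r) → Dec (Opp p r) → W′ q r (W′ p q s) ≡ W′ p r s
    go (no pq) (no qr) (no pr) = begin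
      W′ q r (W′ p q s) ≡⟨ trans (walk-uncut ℓ L q r _ qr) (cong (W q r) (walk-uncut ℓ L p q s pq)) ⟩
      W q r (W p q s)   ≡⟨ sub p∈ q∈ r∈ pq qr pr o ⟩
      W p r s           ≡⟨ walk-uncut ℓ L p r s pr ⟨
      W′ p r s          ∎
    go (yes pq) (yes qr) (yes pr) = contradiction pr (not-all-opposite (ℓ · p) (ℓ · q) (ℓ · r) pq qr)
    -- The corner triangle u q v is cut off, and the quadrilateral p u v r is divided by the
    -- diagonal p v.
    go (yes pq) (yes qr) (no pr) = begin
      W′ q r (W′ p q s)                ≡⟨ trans (walk-cut ℓ L q r _ qr) (cong (λ u → W v r (W q v u)) (walk-cut ℓ L p q s pq)) ⟩
      W v r (W q v (W u q (W p u s)))  ≡⟨ cong (W v r) (sub u∈ q∈ v∈ (zˡ pq) (zʳ qr) (zˡ pq) (on-W o)) ⟩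
      W v r (W u v (W p u s))          ≡⟨ cong (W v r) (sub p∈ u∈ v∈ (zʳ pq) (zˡ pq) (zʳ qr) o) ⟩
      W v r (W p v s)                  ≡⟨ sub p∈ v∈ r∈ (zʳ qr) (zˡ qr) pr o ⟩
      W p r s                          ≡⟨ walk-uncut ℓ L p r s pr ⟨
      W′ p r s                         ∎
      where
      u = cut ℓ p q
      v = cut ℓ q r
      u∈ = cut∈ p∈ q∈ pq
      v∈ = cut∈ q∈ r∈ qr
    go (yes pq) (no qr) (yes pr) = begin
      W′ q r (W′ p q s)         ≡⟨ trans (walk-uncut ℓ L q r _ qr) (cong (W q r) (walk-cut ℓ L p q s pq)) ⟩
      W q r (W u q (W p u s))   ≡⟨ sub u∈ q∈ r∈ (zˡ pq) qr (zˡ pq) (on-W o) ⟩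
      W u r (W p u s)           ≡⟨ sub u∈ v∈ r∈ (zˡ pq) (zˡ pr) (zˡ pq) (on-W o) ⟨
      W v r (W u v (W p u s))   ≡⟨ cong (W v r) (sub p∈ u∈ v∈ (zʳ pq) (zˡ pq) (zʳ pr) o) ⟩
      W v r (W p v s)           ≡⟨ walk-cut ℓ L p r s pr ⟨
      W′ p r s                  ∎
      where
      u = cut ℓ p q
      v = cut ℓ p r
      u∈ = cut∈ p∈ q∈ pq
      v∈ = cut∈ p∈ r∈ pr
    go (no pq) (yes qr) (yes pr) = begin
      W′ q r (W′ p q s)         ≡⟨ trans (walk-cut ℓ L q r _ qr) (cong (λ t → W u r (W q u t)) (walk-uncut ℓ L p q s pq)) ⟩
      W u r (W q u (W p q s))   ≡⟨ cong (W u r) (sub p∈ q∈ u∈ pq (zʳ qr) (zʳ qr) o) ⟩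
      W u r (W p u s)           ≡⟨ sub u∈ v∈ r∈ (zˡ qr) (zˡ pr) (zˡ qr) (on-W o) ⟨
      W v r (W u v (W p u s))   ≡⟨ cong (W v r) (sub p∈ u∈ v∈ (zʳ qr) (zˡ qr) (zʳ pr) o) ⟩
      W v r (W p v s)           ≡⟨ walk-cut ℓ L p r s pr ⟨
      W′ p r s                  ∎
      where
      u = cut ℓ q r
      v = cut ℓ p r
      u∈ = cut∈ q∈ r∈ qr
      v∈ = cut∈ p∈ r∈ pr
    -- Here ℓ passes through r, since r is opposite to neither p nor q.
    go (yes pq) (no qr) (no pr) = begin
      W′ q r (W′ p q s)         ≡⟨ trans (walk-uncut ℓ L q r _ qr) (cong (W q r) (walk-cut ℓ L p q s pq)) ⟩
      W q r (W u q (W p u s))   ≡⟨ sub u∈ q∈ r∈ (zˡ pq) qr (zˡ pq) (on-W o) ⟩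
      W u r (W p u s)           ≡⟨ sub p∈ u∈ r∈ (zʳ pq) (zˡ pq) pr o ⟩
      W p r s                   ≡⟨ walk-uncut ℓ L p r s pr ⟨
      W′ p r s                  ∎
      where
      u = cut ℓ p q
      u∈ = cut∈ p∈ q∈ pq
    go (no pq) (yes qr) (no pr) = begin
      W′ q r (W′ p q s)         ≡⟨ trans (walk-cut ℓ L q r _ qr) (cong (λ t → W u r (W q u t)) (walk-uncut ℓ L p q s pq)) ⟩
      W u r (W q u (W p q s))   ≡⟨ cong (W u r) (sub p∈ q∈ u∈ pq (zʳ qr) (zʳ qr) o) ⟩
      W u r (W p u s)           ≡⟨ sub p∈ u∈ r∈ (zʳ qr) (zˡ qr) pr o ⟩
      W p r s                   ≡⟨ walk-uncut ℓ L p r s pr ⟨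
      W′ p r s                  ∎
      where
      u = cut ℓ q r
      u∈ = cut∈ q∈ r∈ qr
    go (no pq) (no qr) (yes pr) = begin
      W′ q r (W′ p q s)         ≡⟨ trans (walk-uncut ℓ L q r _ qr) (cong (W q r) (walk-uncut ℓ L p q s pq)) ⟩
      W q r (W p q s)           ≡⟨ cong (W q r) (sub p∈ v∈ q∈ (zʳ pr) (zˡ pr) pq o) ⟨
      W q r (W v q (W p v s))   ≡⟨ sub v∈ q∈ r∈ (zˡ pr) qr (zˡ pr) (on-W o) ⟩
      W v r (W p v s)           ≡⟨ walk-cut ℓ L p r s pr ⟨
      W′ p r s                  ∎
      where
      v = cut ℓ p r
      v∈ = cut∈ p∈ r∈ pr

  -- The boundary form is nonnegative at the corners of T and vanishes at h, which is a combination
  -- of them with positive weights at x and y. So it vanishes at x and y, and the centre occurs at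
  -- one of these.
  centre-on-boundary : ∀ {T x y z h} i → T ∈ Ts → Rotation T x y z → boundary P i · h ≡ + 0 →
    + 0 ℤ.< form y z · h → + 0 ℤ.< form z x · h → + 0 ℤ.≤ form x y · h → OnLine (boundary P i) (centre T)
  centre-on-boundary {T} {x} {y} {z} {h} i T∈ ρ ℓh yz zx xy = centre-OnLine ℓ (All.lookup even T∈) ρ
    (*-≡0 yz (+-≡0ˡ x-term y-term (+-≡0ˡ (ℤ.+-mono-≤ x-term y-term) z-term sum)))
    (*-≡0 zx (+-≡0ʳ x-term y-term (+-≡0ˡ (ℤ.+-mono-≤ x-term y-term) z-term sum)))
    where
    ℓ = boundary P i
    rotate-corners : ∀ {x y z} → Rotation T x y z → 0≤ ℓ on x × 0≤ ℓ on y × 0≤ ℓ on z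
    rotate-corners abc with All.lookup (corner≥ i) T∈
    ... | p ∷ q ∷ r ∷ [] = p , q , r
    rotate-corners bca with All.lookup (corner≥ i) T∈
    ... | p ∷ q ∷ r ∷ [] = q , r , p
    rotate-corners cab with All.lookup (corner≥ i) T∈
    ... | p ∷ q ∷ r ∷ [] = r , p , q
    x-term = *-nonneg (proj₁ (rotate-corners ρ)) (ℤ.<⇒≤ yz)
    y-term = *-nonneg (proj₁ (proj₂ (rotate-corners ρ))) (ℤ.<⇒≤ zx)
    z-term = *-nonneg (proj₂ (proj₂ (rotate-corners ρ))) xy
    sum : ℓ · lift x ℤ.* (form y z · h) ℤ.+ ℓ · lift y ℤ.* (form z x · h) ℤ.+ ℓ · lift z ℤ.* (form x y · h) ≡ + 0
    sum = trans (sym (cramer-· x y z ℓ h)) (trans (cong (det x y z ℤ.*_) ℓh) (ℤ.*-zeroʳ (det x y z)))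

  non-corner-on-boundary : ∀ {T h} i → T ∈ Ts → NonCorner T h → boundary P i · h ≡ + 0 → OnLine (boundary P i) (centre T)
  non-corner-on-boundary i T∈ (inside (interiorAt (ab , bc , ca))) ℓh = centre-on-boundary i T∈ abc ℓh bc ca (ℤ.<⇒≤ ab)
  non-corner-on-boundary i T∈ (edge ρ e f g) ℓh = centre-on-boundary i T∈ ρ ℓh f g (ℤ.≤-reflexive (sym e))

  label-on-boundary : ∀ i {h} → InP h → boundary P i · h ≡ + 0 → OnLine (boundary P i) (lab h)
  label-on-boundary i {h} ip ℓh with lattice? h
  ... | yes (v , p) = v , lattice-on (boundary P i) h v (finite ip) p ℓh , refl
  ... | no ¬l with centreAt-spec (covers h ip)
  ... | S , S∈ , s , eq = subst (OnLine (boundary P i)) (sym eq)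
    (non-corner-on-boundary i S∈ (non-lattice⇒non-corner s λ z p → ¬l (z , p)) ℓh)

  boundary-nondegenerate : ∀ i → ¬ Degenerate (boundary P i)
  boundary-nondegenerate i = go (another (3≤size P) i (next i))
    where
    go : (∃ λ j → j ≢ i × j ≢ next i) → ¬ Degenerate (boundary P i)
    go (j , p , q) = form-nondegenerate (vertex P i) (vertex P (next i)) (vertex P j) (convex P i j p q)

  -- All colours met along a boundary edge are colours of lattice points on its line, so at most two
  -- of them occur and the intermediate ones cancel. The segment counts as the degenerate triangle p
  -- q q in `Remaining`.
  boundary-walk : ∀ i L {p q} → InP p → InP q → boundary P i · p ≡ + 0 → boundary P i · q ≡ + 0 → Remaining L p q q →
                  ∀ {s} → On (lab p) s → run (walk Ts L p q) s ≡ push (lab q) s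
  boundary-walk i [] {p} {q} ip iq ℓp ℓq rem {s} o = go (unseparated₂ ip iq one-sided-all)
    where
    ℓ = boundary P i
    one-sided-all : OneSided₂ p q
    one-sided-all φ m with rem φ m
    ... | inj₁ ()
    ... | inj₂ os = q , os
    go : (∃ λ T → T ∈ Ts × ClosedAt T p × ClosedAt T q × centreAt Ts (p ⊕ q) ≡ centre T) →
         push (lab q) (push (centreAt Ts (p ⊕ q)) s) ≡ push (lab q) s
    go (T , T∈ , tp , tq , e) = trans (cong (λ X → push (lab q) (push X s)) e) (at (locate (closedAt-⊕ tp tq)))
      where
      at : NonCorner T (p ⊕ q) ⊎ Corner T (p ⊕ q) → push (lab q) (push (centre T) s) ≡ push (lab q) s
      at (inj₁ m) = push-repeats′ (centre T) (lab q) o (OnLine-repeats ℓ (boundary-nondegenerate i)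
        (label-on-boundary i ip ℓp) (non-corner-on-boundary i T∈ m (trans (·-⊕ʳ ℓ p q) (cong₂ ℤ._+_ ℓp ℓq)))
        (label-on-boundary i iq ℓq))
      at (inj₂ k) = trans (push-back′ (centre T) o′) (sym (push-same′ o′))
        where
        o′ : On (lab q) s
        o′ = subst (λ X → On X s) (corner-labels ip iq tp tq k) o
  boundary-walk i (ℓ ∷ L) {p} {q} ip iq ℓp ℓq rem {s} o = go (ℓ · p ℤ.* (ℓ · q) ℤ.<? + 0)
    where
    open ≡-Reasoning
    go : Dec (Opposite (ℓ · p) (ℓ · q)) → run (walk Ts (ℓ ∷ L) p q) s ≡ push (lab q) s
    go (no ¬opp) = trans (walk-uncut ℓ L p q s ¬opp) (boundary-walk i L ip iq ℓp ℓq remaining o)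
      where
      remaining : Remaining L p q q
      remaining φ m with rem φ m
      ... | inj₁ (here refl) = inj₂ (one-sided φ p q q ¬opp (λ h → ℤ.<-asym h (square (φ · q) h)) ¬opp)
        where
        square : ∀ i → Opposite i i → + 0 ℤ.< i ℤ.* i
        square i h = [ (λ (a , b) → contradiction a (ℤ.<-asym b)) , (λ (a , b) → contradiction a (ℤ.<-asym b)) ]′ (opposite-signs i i h)
      ... | inj₁ (there m′)  = inj₁ m′
      ... | inj₂ os          = inj₂ os
    go (yes opp) = begin
      run (walk Ts (ℓ ∷ L) p q) s                       ≡⟨ walk-cut ℓ L p q s opp ⟩
      run (walk Ts L u q) (run (walk Ts L p u) s)       ≡⟨ boundary-walk i L iu iq ℓu ℓq remaining-u (walk-On L p u (On.reduced o)) ⟩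
      push (lab q) (run (walk Ts L p u) s)              ≡⟨ cong (push (lab q)) (boundary-walk i L ip iu ℓp ℓu remaining-p o) ⟩
      push (lab q) (push (lab u) s)                     ≡⟨ push-repeats′ (lab u) (lab q) o (OnLine-repeats (boundary P i) (boundary-nondegenerate i)
                                                              (label-on-boundary i ip ℓp) (label-on-boundary i iu ℓu) (label-on-boundary i iq ℓq)) ⟩
      push (lab q) s                                    ∎
      where
      u = cut ℓ p q
      iu : InP u
      iu = InP-cut ℓ opp ip iq
      ℓu : boundary P i · u ≡ + 0
      ℓu = cut-preserves-line (boundary P i) ℓ p q ℓp ℓq
      zero-u : ∀ x → ¬ Opposite (ℓ · u) (ℓ · x)
      zero-u x = zeroˡ-¬opposite (cut-on ℓ p q opp)
      remaining-u : Remaining L u q q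
      remaining-u φ m with rem φ m
      ... | inj₁ (here refl) = inj₂ (one-sided φ u q q (zero-u q) (λ h → [ (λ (a , b) → ℤ.<-asym a b) , (λ (a , b) → ℤ.<-asym a b) ]′ (opposite-signs (φ · q) (φ · q) h)) (zero-u q))
      ... | inj₁ (there m′)  = inj₁ m′
      ... | inj₂ os          = inj₂ (cone-one-sided {p} {q} {q} (λ φ (hp , hq , _) → cut-nonneg φ ℓ p q hp hq) (λ φ (_ , hq , _) → hq) (λ φ (_ , hq , _) → hq) φ os)
      remaining-p : Remaining L p u u
      remaining-p φ m with rem φ m
      ... | inj₁ (here refl) = inj₂ (one-sided φ p u u (zeroʳ-¬opposite {φ · p} (cut-on φ p q opp)) (zero-u u) (zeroʳ-¬opposite {φ · p} (cut-on φ p q opp)))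
      ... | inj₁ (there m′)  = inj₁ m′
      ... | inj₂ os          = inj₂ (cone-one-sided {p} {q} {q} (λ φ (hp , _) → hp) (λ φ (hp , hq , _) → cut-nonneg φ ℓ p q hp hq) (λ φ (hp , hq , _) → cut-nonneg φ ℓ p q hp hq) φ os)

  InP-vertex : ∀ i → InP (lift (vertex P i))
  InP-vertex i = inPolygon (ℤ.+<+ z<s) λ j → vertex-nonneg P j (∈-tabulate⁺ i)

  label-vertex : ∀ v → lab (lift v) ≡ colour v
  label-vertex v@(x , y) = label-lattice Ts (lift v) v (ℤ.+<+ z<s) (cong₃ (sym (ℤ.*-identityˡ x)) (sym (ℤ.*-identityˡ y)) refl)

  private
    W : LatticePoint → LatticePoint → List Colour → List Colour
    W x y = run (walk Ts (lines Ts) (lift x) (lift y))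

  push-edge : ∀ {o x y s} → InP (lift o) → BoundaryEdge P x y → On (colour o) s → push (colour y) (W o x s) ≡ W o y s
  push-edge {o} {s = s} io (i , refl , refl) σ = begin
    push (colour y) (W o x s)         ≡⟨ cong (λ X → push X (W o x s)) (label-vertex y) ⟨
    push (lab (lift y)) (W o x s)     ≡⟨ boundary-walk i (lines Ts) ix iy (form-start x y) (form-end x y) (λ _ → inj₁)
                                           (walk-On (lines Ts) (lift o) (lift x) (On.reduced σ)) ⟨
    W x y (W o x s)                   ≡⟨ homotopic (lines Ts) io ix iy (λ _ → inj₁) (subst (λ X → On X s) (sym (label-vertex o)) σ) ⟩
    W o y s                           ∎
    where
    open ≡-Reasoning
    x = vertex P i
    y = vertex P (next i)
    ix = InP-vertex i
    iy = InP-vertex (next i)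

  -- The polygon is fanned from o: the part of the boundary traversed so far is homotopic to the
  -- straight walk from o to the current vertex, and at the end this is a loop at o.
  push-boundary : ∀ {o x s} ys → InP (lift o) → Linked (BoundaryEdge P) (x ∷ ys ∷ʳ o) → On (colour o) s →
                  run (map colour (ys ∷ʳ o)) (W o x s) ≡ s
  push-boundary {o} [] io (e ∷ _) σ = trans (push-edge io e σ)
    (walk-loop (lines Ts) (lift o) (subst (λ X → On X _) (sym (label-vertex o)) σ))
  push-boundary {o} (y ∷ ys) io (e ∷ es) σ = trans (cong (run (map colour (ys ∷ʳ o))) (push-edge io e σ)) (push-boundary ys io es σ)

  push-cycle : ∀ i ys → Linked (BoundaryEdge P) (vertex P i ∷ ys ∷ʳ vertex P i) →
               run (map colour (ys ∷ʳ vertex P i)) [ colour (vertex P i) ] ≡ [ colour (vertex P i) ]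
  push-cycle i ys l = trans (cong (run (map colour (ys ∷ʳ vertex P i))) (sym (walk-loop (lines Ts) (lift (vertex P i))
      (subst (λ X → On X [ colour (vertex P i) ]) (sym (label-vertex (vertex P i))) σ))))
    (push-boundary ys (InP-vertex i) l σ)
    where
    σ : On (colour (vertex P i)) [ colour (vertex P i) ]
    σ = stacked one ([] , refl)

Linked-∷ʳ : ∀ {V : Set} {R : V → V → Set} xs {y z} → Linked R (xs ∷ʳ y) → R y z → Linked R (xs ∷ʳ y ∷ʳ z)
Linked-∷ʳ []           _        r = r ∷ [-]
Linked-∷ʳ (x ∷ [])     (q ∷ qs) r = q ∷ Linked-∷ʳ [] qs r
Linked-∷ʳ (x ∷ y ∷ xs) (q ∷ qs) r = q ∷ Linked-∷ʳ (y ∷ xs) qs r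

Linked-cycle : ∀ {V : Set} {R : V → V → Set} {n} (f : Fin (suc n) → V) → (∀ i → R (f i) (f (next i))) →
               Linked R (tabulate f ∷ʳ f zero)
Linked-cycle {V} {R} {n} f r = close (snocView (tabulate f)) refl
  where
  chain′ : Linked R (tabulate f)
  chain′ = Linked-tabulate f λ i j j≡ → subst (λ k → R (f i) (f k))
    (toℕ-injective (trans (toℕ-next i (subst (ℕ._< suc n) j≡ (toℕ<n j))) (sym j≡))) (r i)
  close : ∀ {xs} → Snoc xs → xs ≡ tabulate f → Linked R (tabulate f ∷ʳ f zero)
  close [] ()
  close (snoc xs z) e = subst (λ ys → Linked R (ys ∷ʳ f zero)) e (Linked-∷ʳ xs (subst (Linked R) (sym e) chain′)
    (subst₂ R (sym (tabulate-last f (sym e))) (cong f (toℕ-injective (toℕ-next-last (fromℕ n) (cong suc (toℕ-fromℕ n))))) (r (fromℕ n))))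

integer⇒null : ∀ P → DissectableInto HasIntegerArea P → Null (boundaryWord P)
integer⇒null P (Ts , d , areas) =
  go (vertex P) (ℕ.≤-trans (s≤s z≤n) (3≤size P)) (λ i → i , refl , refl) (push-cycle P Ts τ)
  where
  τ = dissection⇒tiling P Ts d areas
  Edge : LatticePoint → LatticePoint → Set
  Edge = BoundaryEdge P
  go : ∀ {n} (f : Fin n → LatticePoint) → 1 ℕ.≤ n → (∀ i → Edge (f i) (f (next i))) →
       (∀ i ys → Linked Edge (f i ∷ ys ∷ʳ f i) → run (map colour (ys ∷ʳ f i)) [ colour (f i) ] ≡ [ colour (f i) ]) →
       Null (map colour (tabulate f))
  go {suc n} f _ edges cycle = colour (f zero) , map colour ys , refl ,
    trans (cong (λ w → run w [ colour (f zero) ]) (sym (map-++ colour ys [ f zero ]))) (cycle zero ys (Linked-cycle f edges))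
    where ys = tabulate (λ i → f (suc i))

-- The stack machine and its running time

iterate-+ : {A : Set} (f : A → A) (x : A) (m n : ℕ) → iterate f x (m ℕ.+ n) ≡ iterate f (iterate f x m) n
iterate-+ f x zero    n = refl
iterate-+ f x (suc m) n = iterate-+ f (f x) m n

-- R[0] is the index of the last vertex read, R[1] its colour, R[2] the address of the top of
-- the stack, which starts at R[10]; R[9] holds a sentinel that differs from all colours.

decider : Program
decider =
  const 2 10 ∷
  const 9 5 ∷
  read 10 0 ∷
  const 5 4 ∷
  inc 0 ∷          -- 4: next letter
  read 1 0 ∷
  jumpEq 1 5 18 ∷
  load 3 2 ∷
  jumpEq 1 3 4 ∷
  copy 4 2 ∷
  dec 4 ∷
  load 3 4 ∷
  jumpEq 1 3 16 ∷
  inc 2 ∷          -- push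
  store 2 1 ∷
  jumpEq 0 0 4 ∷
  dec 2 ∷          -- 16: pop
  jumpEq 0 0 4 ∷
  const 6 10 ∷     -- 18: no letters left
  jumpEq 2 6 23 ∷
  inc 6 ∷
  jumpEq 2 6 23 ∷
  halt false ∷
  halt true ∷ []

code-injective : ∀ x y → code x ≡ code y → x ≡ y
code-injective A A _ = refl
code-injective B B _ = refl
code-injective C C _ = refl
code-injective D D _ = refl
code-injective A B ()
code-injective A C ()
code-injective A D ()
code-injective B A ()
code-injective B C ()
code-injective B D ()
code-injective C A ()
code-injective C B ()
code-injective C D ()
code-injective D A ()
code-injective D B ()
code-injective D C ()

code<4 : ∀ x → code x ℕ.< 4
code<4 A = s≤s z≤n
code<4 B = s≤s (s≤s z≤n)
code<4 C = s≤s (s≤s (s≤s z≤n))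
code<4 D = s≤s (s≤s (s≤s (s≤s z≤n)))

≡ᵇ-yes : ∀ {m n} → m ≡ n → (m ≡ᵇ n) ≡ true
≡ᵇ-yes {zero}  refl = refl
≡ᵇ-yes {suc m} refl = ≡ᵇ-yes {m} refl

≡ᵇ-no : ∀ {m n} → m ≢ n → (m ≡ᵇ n) ≡ false
≡ᵇ-no {zero}  {zero}  h = contradiction refl h
≡ᵇ-no {zero}  {suc n} h = refl
≡ᵇ-no {suc m} {zero}  h = refl
≡ᵇ-no {suc m} {suc n} h = ≡ᵇ-no λ e → h (cong suc e)

jump-yes : ∀ {m n} l l′ R → m ≡ n → running (if m ≡ᵇ n then l else l′) R ≡ running l R
jump-yes l l′ R e = cong (λ b → running (if b then l else l′) R) (≡ᵇ-yes e)

jump-no : ∀ {m n} l l′ R → m ≢ n → running (if m ≡ᵇ n then l else l′) R ≡ running l′ R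
jump-no l l′ R h = cong (λ b → running (if b then l else l′) R) (≡ᵇ-no h)

Stored : Registers → List Colour → Set
Stored R []      = ⊤
Stored R (y ∷ t) = R (10 ℕ.+ length t) ≡ code y × Stored R t

Stored-cong : ∀ {R R′} s → (∀ j → j ℕ.< length s → R′ (10 ℕ.+ j) ≡ R (10 ℕ.+ j)) → Stored R s → Stored R′ s
Stored-cong []      h st        = tt
Stored-cong (y ∷ t) h (e , st) = trans (h (length t) (ℕ.n<1+n _)) e , Stored-cong t (λ j lt → h j (ℕ.m<n⇒m<1+n lt)) st

record Invariant (R : Registers) (i : ℕ) (s : List Colour) : Set where
  field
    index    : R 0 ≡ i
    top-at   : R 2 ≡ 9 ℕ.+ length s
    end-code : R 5 ≡ 4
    sentinel : R 9 ≡ 5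
    stored   : Stored R s

push-new : ∀ x y → x ≢ y → push x (y ∷ []) ≡ x ∷ y ∷ []
push-new x y p with x ≟ᶜ y
... | yes e = contradiction e p
... | no _  = refl

push-cancel : ∀ x y t → x ≢ y → push x (y ∷ x ∷ t) ≡ x ∷ t
push-cancel x y t p with x ≟ᶜ y
... | yes e = contradiction e p
... | no _ with x ≟ᶜ x
... | yes _ = refl
... | no q  = contradiction refl q

push-third : ∀ x y z t → x ≢ y → x ≢ z → push x (y ∷ z ∷ t) ≡ x ∷ y ∷ z ∷ t
push-third x y z t p q with x ≟ᶜ y
... | yes e = contradiction e p
... | no _ with x ≟ᶜ z
... | yes e = contradiction e q
... | no _  = refl

drop-suc : {V : Set} (vs : List V) → ∀ j {p ws} → drop j vs ≡ p ∷ ws → drop (suc j) vs ≡ ws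
drop-suc (_ ∷ _)  zero    refl = refl
drop-suc (_ ∷ vs) (suc j) e    = drop-suc vs j e

-- The final test of the machine. On a reduced stack with the first letter of the word at the bottom
-- it amounts to `Small`.
shallow : List Colour → Bool
shallow []              = true
shallow (_ ∷ [])        = true
shallow (_ ∷ _ ∷ [])    = true
shallow (_ ∷ _ ∷ _ ∷ _) = false

module _ (vs : List LatticePoint) where

  codeAt-just : ∀ j {p ws} → drop j vs ≡ p ∷ ws → codeAt vs j ≡ code (colour p)
  codeAt-just j e rewrite e = refl

  codeAt-nothing : ∀ j → drop j vs ≡ [] → codeAt vs j ≡ 4
  codeAt-nothing j e rewrite e = refl

  record Reaches (n : ℕ) (st st′ : State) : Set where
    constructor reaches
    field result : iterate (step decider vs) st n ≡ st′

  open Reaches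

  then : ∀ {m n st st′ st″} → Reaches m st st′ → Reaches n st′ st″ → Reaches (m ℕ.+ n) st st″
  then {m} {n} {st} r r′ = reaches (trans (iterate-+ (step decider vs) st m n)
    (trans (cong (λ s → iterate (step decider vs) s n) (result r)) (result r′)))

  halted-stays : ∀ n b → iterate (step decider vs) (halted b) n ≡ halted b
  halted-stays zero    b = refl
  halted-stays (suc n) b = halted-stays n b

  module _ (R : Registers) {i : ℕ} {y : Colour} {t : List Colour} (inv : Invariant R i (y ∷ t)) where

    open Invariant inv

    private
      v : ℕ
      v = codeAt vs (suc (R 0))
      R₁ R₂ R₃ R₄ R₅ : Registers
      R₁ = (R [ 0 ≔ suc (R 0) ]) [ 1 ≔ v ]
      R₂ = R₁ [ 3 ≔ R₁ (R 2) ]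
      R₃ = (R₂ [ 4 ≔ R 2 ]) [ 4 ≔ pred (R 2) ]
      R₄ = R₃ [ 3 ≔ R₃ (pred (R 2)) ]
      R₅ = R₄ [ 2 ≔ suc (R 2) ]

    -- A letter costs 5 instructions if it repeats the top of the stack, 11 if it pops, and 12 if it
    -- is pushed.
    round : ∀ x → codeAt vs (suc i) ≡ code x →
            ∃₂ λ k R′ → k ℕ.≤ 12 × Reaches k (running 4 R) (running 4 R′) × Invariant R′ (suc i) (push x (y ∷ t))
    round x cx = by-top (x ≟ᶜ y)
      where
      Result : List Colour → Set
      Result s = ∃₂ λ k R′ → k ℕ.≤ 12 × Reaches k (running 4 R) (running 4 R′) × Invariant R′ (suc i) s
      h : ℕ
      h = length t
      v≡ : v ≡ code x
      v≡ = trans (cong (λ j → codeAt vs (suc j)) index) cx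
      to-8 : Reaches 4 (running 4 R) (running 8 R₂)
      to-8 = then {3} {1} (reaches (jump-no 18 7 R₁ λ e → ℕ.<-irrefl (trans (sym v≡) (trans e end-code)) (code<4 x))) (reaches refl)
      top≡ : R₁ (R 2) ≡ code y
      top≡ = trans (cong R₁ top-at) (proj₁ stored)
      to-12 : x ≢ y → Reaches 8 (running 4 R) (running 12 R₄)
      to-12 x≢y = then {4} {4} to-8 (then {1} {3}
        (reaches (jump-no 4 9 R₂ λ e → x≢y (code-injective x y (trans (sym v≡) (trans e top≡))))) (reaches refl))
      second≡ : R₃ (pred (R 2)) ≡ R (9 ℕ.+ h)
      second≡ = trans (cong (λ a → R₃ (pred a)) top-at) (unchanged t)
        where
        unchanged : ∀ t → R₃ (9 ℕ.+ length t) ≡ R (9 ℕ.+ length t)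
        unchanged []      = refl
        unchanged (_ ∷ _) = refl
      grow : x ≢ y → code x ≢ R (9 ℕ.+ h) → Result (x ∷ y ∷ t)
      grow x≢y x≢second = 12 , R₆ , ℕ.≤-refl ,
        then {8} {4} (to-12 x≢y) (then {1} {3}
          (reaches (jump-no 16 13 R₄ λ e → x≢second (trans (sym v≡) (trans e second≡))))
          (then {2} {1} (reaches (cong (λ a → running 15 (R₅ [ suc a ≔ v ])) top-at)) (reaches (jump-yes {R 0} 4 16 R₆ refl)))) ,
        record { index = cong suc index ; top-at = cong suc top-at ; end-code = end-code ; sentinel = sentinel
               ; stored = trans (cong (λ b → if b then v else R₅ (11 ℕ.+ h)) (≡ᵇ-yes {h} refl)) v≡ ,
                          Stored-cong {R} {R₆} (y ∷ t) below stored }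
        where
        R₆ : Registers
        R₆ = R₅ [ 11 ℕ.+ h ≔ v ]
        below : ∀ j → j ℕ.< suc h → R₆ (10 ℕ.+ j) ≡ R (10 ℕ.+ j)
        below j lt = cong (λ b → if b then v else R (10 ℕ.+ j)) (≡ᵇ-no {j} {suc h} λ e → ℕ.<-irrefl e lt)
      by-top : Dec (x ≡ y) → Result (push x (y ∷ t))
      by-top (yes refl) = 5 , R₂ , s≤s (s≤s (s≤s (s≤s (s≤s z≤n)))) ,
        then {4} {1} to-8 (reaches (jump-yes 4 9 R₂ (trans v≡ (sym top≡)))) ,
        subst (Invariant R₂ (suc i)) (sym (push-same x t)) (record
          { index = cong suc index ; top-at = top-at ; end-code = end-code ; sentinel = sentinel
          ; stored = Stored-cong {R} {R₂} (x ∷ t) (λ _ _ → refl) stored })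
      by-top (no x≢y) = by-second t refl
        where
        by-second : ∀ t′ → t ≡ t′ → Result (push x (y ∷ t))
        -- Below a single letter the machine reads the sentinel, which equals no colour code, and so
        -- it pushes.
        by-second [] refl = subst Result (sym (push-new x y x≢y))
          (grow x≢y λ e → ℕ.<-asym (code<4 x) (subst (4 ℕ.<_) (sym (trans e sentinel)) ℕ.≤-refl))
        by-second (z ∷ t′) refl = by-third (x ≟ᶜ z)
          where
          z≡ : R (10 ℕ.+ length t′) ≡ code z
          z≡ = proj₁ (proj₂ stored)
          by-third : Dec (x ≡ z) → Result (push x (y ∷ z ∷ t′))
          by-third (no x≢z) = subst Result (sym (push-third x y z t′ x≢y x≢z))
            (grow x≢y λ e → x≢z (code-injective x z (trans e z≡)))
          by-third (yes refl) = subst Result (sym (push-cancel x y t′ x≢y)) (11 , R₄ [ 2 ≔ pred (R 2) ] , ℕ.n≤1+n 11 ,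
            then {8} {3} (to-12 x≢y) (then {1} {2} (reaches (jump-yes 16 13 R₄ (trans v≡ (sym (trans second≡ z≡)))))
              (then {1} {1} (reaches refl) (reaches (jump-yes {R 0} 4 18 (R₄ [ 2 ≔ pred (R 2) ]) refl)))) ,
            record { index = cong suc index ; top-at = cong pred top-at ; end-code = end-code ; sentinel = sentinel
                   ; stored = Stored-cong {R} {R₄ [ 2 ≔ pred (R 2) ]} (x ∷ t′) (λ _ _ → refl) (proj₂ stored) })

    final : codeAt vs (suc i) ≡ 4 → ∃ λ k → k ℕ.≤ 8 × Reaches k (running 4 R) (halted (shallow (y ∷ t)))
    final c4 = by-depth t refl
      where
      S : Registers
      S = R₁ [ 6 ≔ 10 ]
      to-19 : Reaches 4 (running 4 R) (running 19 S)
      to-19 = then {3} {1} (reaches (jump-yes 18 7 R₁ (trans (trans (cong (λ j → codeAt vs (suc j)) index) c4) (sym end-code)))) (reaches refl)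
      S′ : Registers
      S′ = S [ 6 ≔ 11 ]
      to-21 : R 2 ≢ 10 → Reaches 6 (running 4 R) (running 21 S′)
      to-21 h = then {4} {2} to-19 (then {1} {1} (reaches (jump-no 23 20 S h)) (reaches refl))
      by-depth : ∀ t′ → t ≡ t′ → ∃ λ k → k ℕ.≤ 8 × Reaches k (running 4 R) (halted (shallow (y ∷ t′)))
      by-depth [] refl = 6 , ℕ.m≤n+m 6 2 , then {4} {2} to-19 (then {1} {1} (reaches (jump-yes 23 20 S top-at)) (reaches refl))
      by-depth (z ∷ []) refl = 8 , ℕ.≤-refl , then {6} {2} (to-21 λ e → contradiction (trans (sym top-at) e) λ ())
        (then {1} {1} (reaches (jump-yes 23 22 S′ top-at)) (reaches refl))
      by-depth (z ∷ w ∷ t′) refl = 8 , ℕ.≤-refl , then {6} {2} (to-21 λ e → contradiction (trans (sym top-at) e) λ ())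
        (then {1} {1} (reaches (jump-no 23 22 S′ λ e → contradiction (trans (sym top-at) e) λ ())) (reaches refl))

  -- Twelve steps per remaining letter, and eight to finish.

  main-loop : ∀ ws R {i y t} → Invariant R i (y ∷ t) → drop (suc i) vs ≡ ws →
              ∃ λ k → k ℕ.≤ 12 ℕ.* length ws ℕ.+ 8 ×
                      Reaches k (running 4 R) (halted (shallow (run (map colour ws) (y ∷ t))))
  main-loop [] R {i} inv e = final R inv (codeAt-nothing (suc i) e)
  main-loop (w ∷ ws) R {i} {y} {t} inv e = continue (round R inv (colour w) (codeAt-just (suc i) e))
    where
    Goal : List Colour → Set
    Goal s = ∃ λ k → k ℕ.≤ 12 ℕ.* suc (length ws) ℕ.+ 8 × Reaches k (running 4 R) (halted (shallow (run (map colour ws) s)))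
    continue : (∃₂ λ k R′ → k ℕ.≤ 12 × Reaches k (running 4 R) (running 4 R′) × Invariant R′ (suc i) (push (colour w) (y ∷ t))) →
               Goal (push (colour w) (y ∷ t))
    continue (k , R′ , k≤ , r , inv′) = next-round (push-top (colour w) (y ∷ t)) inv′
      where
      next-round : ∀ {s} → (∃ λ r → s ≡ colour w ∷ r) → Invariant R′ (suc i) s → Goal s
      next-round (_ , refl) inv″ with main-loop ws R′ inv″ (drop-suc vs (suc i) e)
      ... | l , l≤ , r′ = k ℕ.+ l ,
        subst (k ℕ.+ l ℕ.≤_) (trans (sym (ℕ.+-assoc 12 (12 ℕ.* length ws) 8)) (cong (ℕ._+ 8) (sym (ℕ.*-suc 12 (length ws)))))
          (ℕ.+-mono-≤ k≤ l≤) ,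
        then r r′

-- The 4 instructions of the set-up and the at most 8 of the final test add up to the 12 that are
-- allotted to the first letter, which the loop does not treat.
decides : ∀ v vs → HaltsWithin decider (v ∷ vs) (12 ℕ.* suc (length vs)) (shallow (run (map colour vs) [ colour v ]))
decides v vs with main-loop (v ∷ vs) vs (((initialR [ 2 ≔ 10 ]) [ 9 ≔ 5 ]) [ 10 ≔ code (colour v) ] [ 5 ≔ 4 ]) inv refl
  where
  initialR : Registers
  initialR _ = 0
  inv : Invariant (((initialR [ 2 ≔ 10 ]) [ 9 ≔ 5 ]) [ 10 ≔ code (colour v) ] [ 5 ≔ 4 ]) 0 (colour v ∷ [])
  inv = record { index = refl ; top-at = refl ; end-code = refl ; sentinel = refl ; stored = refl , tt }
... | k , k≤ , reaches r = begin
  iterate (step decider (v ∷ vs)) initial (12 ℕ.* suc (length vs))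
    ≡⟨ cong (iterate (step decider (v ∷ vs)) initial) (sym total) ⟩
  iterate (step decider (v ∷ vs)) initial (4 ℕ.+ k ℕ.+ rest)
    ≡⟨ iterate-+ (step decider (v ∷ vs)) initial (4 ℕ.+ k) rest ⟩
  iterate (step decider (v ∷ vs)) (iterate (step decider (v ∷ vs)) initial (4 ℕ.+ k)) rest
    ≡⟨ cong (λ st → iterate (step decider (v ∷ vs)) st rest) r ⟩
  iterate (step decider (v ∷ vs)) (halted (shallow (run (map colour vs) [ colour v ]))) rest
    ≡⟨ halted-stays (v ∷ vs) rest _ ⟩
  halted (shallow (run (map colour vs) [ colour v ])) ∎
  where
  open ≡-Reasoning
  rest : ℕ
  rest = 12 ℕ.* suc (length vs) ℕ.∸ (4 ℕ.+ k)
  total : 4 ℕ.+ k ℕ.+ rest ≡ 12 ℕ.* suc (length vs)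
  total = ℕ.m+[n∸m]≡n (subst (4 ℕ.+ k ℕ.≤_)
    (trans (ℕ.+-comm 4 (12 ℕ.* length vs ℕ.+ 8)) (trans (ℕ.+-assoc (12 ℕ.* length vs) 8 4)
      (trans (ℕ.+-comm (12 ℕ.* length vs) 12) (sym (ℕ.*-suc 12 (length vs)))))) (ℕ.+-monoʳ-≤ 4 k≤))

-- A pop needs two letters on the stack, so the first letter of the word stays at the bottom. Hence
-- the lower letter of a final stack of two is the letter that closes the walk.
data Bottom (x : Colour) : List Colour → Set where
  this  : Bottom x (x ∷ [])
  above : ∀ {y s} → Bottom x s → Bottom x (y ∷ s)

push-bottom : ∀ {x} y {s} → Bottom x s → Bottom x (push y s)
push-bottom y {z ∷ s} b with y ≟ᶜ z
... | yes _ = b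
push-bottom y {z ∷ []} b | no _ = above b
push-bottom y {z ∷ w ∷ s} b | no _ with y ≟ᶜ w
push-bottom y {z ∷ w ∷ s} (above b) | no _ | yes _ = b
... | no _ = above b

run-bottom : ∀ {x} w {s} → Bottom x s → Bottom x (run w s)
run-bottom []      b = b
run-bottom (y ∷ w) b = run-bottom w (push-bottom y b)

shallow⇒Small : ∀ {x s} → Reduced s → Bottom x s → shallow s ≡ true → Small x s
shallow⇒Small one this _ = single
shallow⇒Small one (above ()) _
shallow⇒Small (two p) (above this) _ = double λ e → p (sym e)
shallow⇒Small (two p) (above (above ())) _
shallow⇒Small (more _ _ _) _ ()

Small⇒shallow : ∀ {x s} → Small x s → shallow s ≡ true
Small⇒shallow single     = refl
Small⇒shallow (double _) = refl

-- The equivalences and the decision procedure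

diagonal⇒integer : ∀ P → DiagonallyDissectableInto HasIntegerArea P → DissectableInto HasIntegerArea P
diagonal⇒integer P (Ts , d , _ , areas) = Ts , d , areas

contractible⇒diagonal : ∀ P → Contractible (boundaryWord P) → DiagonallyDissectableInto HasIntegerArea P
contractible⇒diagonal P (_ , r) = triangulated⇒dissectable P (Contractible⇒Triangulated colour (vertices P) r refl)

null⇒contractible : ∀ {w} → Null w → Contractible w
null⇒contractible (x , v , refl , h) = Null⇒Contractible x v h

integer⇒contractible : ∀ P → DissectableInto HasIntegerArea P → Contractible (boundaryWord P)
integer⇒contractible P d = null⇒contractible (integer⇒null P d)

verdict : List LatticePoint → Bool
verdict []       = false
verdict (v ∷ vs) = shallow (run (map colour vs) [ colour v ])

verdict⇒Null : ∀ vs → verdict vs ≡ true → Null (map colour vs)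
verdict⇒Null (v ∷ vs) e = colour v , map colour vs , refl , Small⇒Null (colour v) (map colour vs)
  (shallow⇒Small (run-reduced (map colour vs) one) (run-bottom (map colour vs) this) e)

Null⇒verdict : ∀ vs → Null (map colour vs) → verdict vs ≡ true
Null⇒verdict (v ∷ vs) (_ , _ , refl , h) = Small⇒shallow (Null⇒Small (colour v) (map colour vs) h)

halts-with-verdict : ∀ vs → 1 ℕ.≤ length vs → HaltsWithin decider vs (12 ℕ.* length vs) (verdict vs)
halts-with-verdict (v ∷ vs) _ = decides v vs

theorem4 : ((P : ConvexLatticePolygon) →
    (DissectableInto HasArea1 P ⇔ DissectableInto HasIntegerArea P) ×
    (DissectableInto HasIntegerArea P ⇔ DiagonallyDissectableInto HasIntegerArea P) ×
    (DiagonallyDissectableInto HasIntegerArea P ⇔ Contractible (boundaryWord P)))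
    × LinearTimeDecidable (λ P →
    DissectableInto HasArea1 P × DissectableInto HasIntegerArea P ×
    DiagonallyDissectableInto HasIntegerArea P × Contractible (boundaryWord P))
theorem4 = equivalences , decider , 12 , λ P → verdict (vertices P) , halts P , mk⇔ (sound P) (complete P)
  where
  equivalences : ∀ P → _
  equivalences P =
    mk⇔ (unit⇒integer P) (integer⇒unit P) ,
    mk⇔ (λ d → contractible⇒diagonal P (integer⇒contractible P d)) (diagonal⇒integer P) ,
    mk⇔ (λ d → integer⇒contractible P (diagonal⇒integer P d)) (contractible⇒diagonal P)
  halts : ∀ P → HaltsWithin decider (vertices P) (12 ℕ.* size P) (verdict (vertices P))
  halts P = subst (λ n → HaltsWithin decider (vertices P) (12 ℕ.* n) (verdict (vertices P))) (length-tabulate (vertex P))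
    (halts-with-verdict (vertices P) (subst (1 ℕ.≤_) (sym (length-tabulate (vertex P))) (ℕ.≤-trans (s≤s z≤n) (3≤size P))))
  sound : ∀ P → verdict (vertices P) ≡ true → DissectableInto HasArea1 P × DissectableInto HasIntegerArea P ×
          DiagonallyDissectableInto HasIntegerArea P × Contractible (boundaryWord P)
  sound P e = integer⇒unit P integer , integer , diagonal , contractible
    where
    contractible = null⇒contractible (verdict⇒Null (vertices P) e)
    diagonal = contractible⇒diagonal P contractible
    integer = diagonal⇒integer P diagonal
  complete : ∀ P → DissectableInto HasArea1 P × DissectableInto HasIntegerArea P ×
             DiagonallyDissectableInto HasIntegerArea P × Contractible (boundaryWord P) → verdict (vertices P) ≡ true
  complete P (_ , integer , _) = Null⇒verdict (vertices P) (integer⇒null P integer)
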